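{- Let $K=\prod_{i,j\ge1}\dfrac1{1-x_iy_j-\theta_i\phi_j}$. Then $$K=\sum_\Lambda\overleftarrow{m_\Lambda(x,\theta)}\;h_\Lambda(y,\phi),$$ the sum running over all superpartitions $\Lambda$.
   Context: $x_i,y_j$ ($i,j\ge1$) are commuting variables; $\theta_i,\phi_j$ are mutually anticommuting variables (each squares to zero, any two of them anticommute), commuting with the $x_i,y_j$. A superpartition of $(n|m)$ is $\Lambda=(\Lambda_1,\dots,\Lambda_m;\Lambda_{m+1},\Lambda_{m+2},\dots)$ with nonnegative integer entries, $\Lambda_1>\dots>\Lambda_m\ge 0$, $\Lambda_{m+1}\ge\Lambda_{m+2}\ge\dots\ge0$ (finitely many nonzero; trailing zeros after the semicolon ignored) and $\sum_i\Lambda_i=n$; $\ell(\Lambda)=m+\#\{i>m:\Lambda_i>0\}$. The supermonomial $m_\Lambda(x,\theta)$ is the sum of all distinct terms obtained from $\theta_1\cdots\theta_m x_1^{\Lambda_1}x_2^{\Lambda_2}\cdots$ by simultaneous permutations of the pairs $(x_i,\theta_i)$. The functions $h_n,\tilde h_n$ are defined by $\sum_{n\ge0}t^n\bigl(h_n(x)+\tau\tilde h_n(x,\theta)\bigr)=\prod_i(1-tx_i-\tau\theta_i)^{ -1}$ ($t$ commuting, $\tau$ anticommuting), and $h_\Lambda=\tilde h_{\Lambda_1}\cdots\tilde h_{\Lambda_m}h_{\Lambda_{m+1}}\cdots h_{\Lambda_{\ell(\Lambda)}}$. For $f(x,\theta)$ homogeneous of degree $m$ in $\theta$, $\overleftarrow{f}=(-1)^{m(m-1)/2}f$.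 -}

module Defs where

open import Data.Bool.Base using (Bool; true; false; _∨_; if_then_else_)
import Data.Bool.Properties as Bool
open import Data.Integer.Base as ℤ using (ℤ; 0ℤ; 1ℤ; -1ℤ)
import Data.Integer.Properties as ℤ
open import Algebra.Properties.CommutativeSemigroup ℤ.+-commutativeSemigroup using (interchange)
open import Data.List.Base using (List; []; _∷_; [_]; _++_; map; foldr; concatMap; length; replicate; upTo; applyUpTo; zipWith; deduplicate; cartesianProductWith)
import Data.List.Properties as List
open import Data.List.Relation.Binary.Subset.Propositional using (_⊆_)
open import Data.List.Relation.Unary.All as All using (All; []; _∷_)
import Data.List.Relation.Unary.All.Properties as All
open import Data.List.Relation.Unary.Linked using (Linked)
open import Data.List.Relation.Unary.Unique.Propositional using (Unique)
open import Data.Nat.Base using (ℕ; zero; suc; _+_; _*_; _∸_; _≤_; _<_; _>_; _≥_; z≤n; s≤s; z<s; s<s)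
open import Data.Nat.Combinatorics using (_C_)
import Data.Nat.Properties as ℕ
open import Algebra.Properties.CommutativeSemigroup ℕ.+-commutativeSemigroup using () renaming (interchange to ℕ-interchange)
open import Data.Product.Base using (∃-syntax; _×_; _,_; proj₁; proj₂)
import Data.Product.Properties as Product
open import Function.Base using (_∘_; id)
open import Relation.Binary.Definitions using (DecidableEquality)
open import Relation.Binary.PropositionalEquality using (_≡_; _≢_; refl; sym; trans; cong; cong₂; subst; module ≡-Reasoning)
open import Relation.Nullary using (does)
open import Relation.Nullary.Decidable using (dec-false)
import Relation.Binary.PropositionalEquality.Properties as ≡

-- All variables come in pairs (zₖ , ζₖ), k ∈ ℕ, with zₖ commuting and ζₖ
-- anticommuting.  The list (e₀ , b₀) ∷ (e₁ , b₁) ∷ … stands for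
--   z₀^e₀ z₁^e₁ ⋯ ζ₀^b₀ ζ₁^b₁ ⋯
-- with the ζ's in increasing order of their index.  Trailing entries
-- (0 , false) are immaterial: 'norm' removes them.

Mon : Set
Mon = List (ℕ × Bool)

infix 4 _≟ᵐ_
_≟ᵐ_ : DecidableEquality Mon
_≟ᵐ_ = List.≡-dec (Product.≡-dec ℕ._≟_ Bool._≟_)

infixr 5 _◃_
_◃_ : ℕ × Bool → Mon → Mon
(zero , false) ◃ [] = []
p              ◃ μ  = p ∷ μ

norm : Mon → Mon
norm []      = []
norm (p ∷ μ) = p ◃ norm μ

bit : Bool → ℕ
bit false = 0
bit true  = 1

oddDegree : Mon → ℕ
oddDegree []            = 0
oddDegree ((_ , b) ∷ μ) = bit b + oddDegree μ

degree : Mon → ℕ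
degree []            = 0
degree ((e , b) ∷ μ) = e + bit b + degree μ

infixl 7 _∙_
_∙_ : Mon → Mon → Mon
[]            ∙ ν             = ν
(p ∷ μ)       ∙ []            = p ∷ μ
((d , a) ∷ μ) ∙ ((e , b) ∷ ν) = (d + e , a ∨ b) ∷ (μ ∙ ν)

-1^_ : ℕ → ℤ
-1^ n = -1ℤ ℤ.^ n

-- The product of the monomials μ and ν (in this order) is ε μ ν · (μ ∙ ν):
-- ζₖ² = 0, and a ζₖ in ν has to be moved past every ζₗ in μ with l > k.
ε : Mon → Mon → ℤ
ε []                _                 = 1ℤ
ε (_ ∷ _)           []                = 1ℤ
ε ((_ , _) ∷ μ)     ((_ , false) ∷ ν) = ε μ ν
ε ((_ , false) ∷ μ) ((_ , true) ∷ ν)  = (-1^ oddDegree μ) ℤ.* ε μ ν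
ε ((_ , true) ∷ μ)  ((_ , true) ∷ ν)  = 0ℤ

splitEntry : ℕ × Bool → List ((ℕ × Bool) × (ℕ × Bool))
splitEntry (e , false) = map (λ i → (e ∸ i , false) , (i , false)) (upTo (suc e))
splitEntry (e , true)  = map (λ i → (e ∸ i , true)  , (i , false)) (upTo (suc e))
                      ++ map (λ i → (e ∸ i , false) , (i , true))  (upTo (suc e))

-- All factorisations of a monomial, up to sign, as a product of two.
splits : Mon → List (Mon × Mon)
splits []      = [ [] , [] ]
splits (p ∷ μ) =
  cartesianProductWith (λ (a , b) (α , β) → a ∷ α , b ∷ β) (splitEntry p) (splits μ)

-- A series is the function sending a monomial to its coefficient.
Series : Set
Series = Mon → ℤ

infix 4 _≈_
_≈_ : Series → Series → Set
f ≈ g = ∀ μ → f μ ≡ g μ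

∑ : {A : Set} → List A → (A → ℤ) → ℤ
∑ []       f = 0ℤ
∑ (a ∷ as) f = f a ℤ.+ ∑ as f

infixl 6 _+ˢ_ _-ˢ_
infixl 7 _*ˢ_ _•_
infixr 8 _^ˢ_

_+ˢ_ _-ˢ_ _*ˢ_ : Series → Series → Series
(f +ˢ g) μ = f μ ℤ.+ g μ
(f -ˢ g) μ = f μ ℤ.- g μ
(f *ˢ g) μ = ∑ (splits μ) λ (α , β) → ε α β ℤ.* (f α ℤ.* g β)

_•_ : ℤ → Series → Series
(c • f) μ = c ℤ.* f μ

-- A term (c , α) is the monomial α with coefficient c.
Term : Set
Term = ℤ × Mon

infix 4 _≟ᵗ_
_≟ᵗ_ : DecidableEquality Term
_≟ᵗ_ = Product.≡-dec ℤ._≟_ _≟ᵐ_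

infixl 7 _*ᵗ_
infixr 8 _^ᵗ_

1ᵗ : Term
1ᵗ = 1ℤ , []

_*ᵗ_ : Term → Term → Term
(c , α) *ᵗ (d , β) = ε α β ℤ.* (c ℤ.* d) , α ∙ β

_^ᵗ_ : Term → ℕ → Term
u ^ᵗ zero  = 1ᵗ
u ^ᵗ suc k = u ^ᵗ k *ᵗ u

∏ᵗ : List Term → Term
∏ᵗ = foldr _*ᵗ_ 1ᵗ

series : Term → Series
series (c , α) μ = if does (norm α ≟ᵐ norm μ) then c else 0ℤ

zᵗ ζᵗ : ℕ → Term
zᵗ k = 1ℤ , replicate k (0 , false) ++ [ 1 , false ]
ζᵗ k = 1ℤ , replicate k (0 , false) ++ [ 0 , true ]

z ζ : ℕ → Series
z k = series (zᵗ k)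
ζ k = series (ζᵗ k)

0ˢ 1ˢ : Series
0ˢ _ = 0ℤ
1ˢ   = series 1ᵗ

_^ˢ_ : Series → ℕ → Series
f ^ˢ zero  = 1ˢ
f ^ˢ suc k = f ^ˢ k *ˢ f

∏ˢ : List Series → Series
∏ˢ = foldr _*ˢ_ 1ˢ

∏< : ℕ → (ℕ → Series) → Series
∏< zero    F = 1ˢ
∏< (suc n) F = ∏< n F *ˢ F n

-- Inverse of a series with constant term 1: the geometric series
-- ∑ₖ (1 - f)ᵏ, whose k-th summand has no term of degree less than k.
-- See ⁻¹-inverse.
infix 9 _⁻¹
_⁻¹ : Series → Series
(f ⁻¹) μ = ∑ (upTo (suc (degree μ))) λ k → ((1ˢ -ˢ f) ^ˢ k) μ

-- Coefficientwise (eventually constant) convergence of a sequence.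
Convergent : (ℕ → Series) → Set
Convergent s = ∀ μ → ∃[ N ] (∀ n → N ≤ n → s n μ ≡ s N μ)

limit : (s : ℕ → Series) → Convergent s → Series
limit s c μ = s (proj₁ (c μ)) μ

-- Coefficientwise unconditional convergence of a sum over an arbitrary
-- index set.
HasSum : {I : Set} → (I → Series) → Series → Set
HasSum {I} F S = ∀ μ → ∃[ L ] (Unique L ×
  (∀ (L′ : List I) → Unique L′ → L ⊆ L′ → ∑ L′ (λ i → F i μ) ≡ S μ))

∑-cong : {A : Set} {f g : A → ℤ} {as : List A} → All (λ a → f a ≡ g a) as → ∑ as f ≡ ∑ as g
∑-cong []       = refl
∑-cong (e ∷ es) = cong₂ ℤ._+_ e (∑-cong es)

∑-cong′ : {A : Set} {f g : A → ℤ} (as : List A) → (∀ a → f a ≡ g a) → ∑ as f ≡ ∑ as g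
∑-cong′ as e = ∑-cong (All.universal e as)

∑-0 : {A : Set} (as : List A) → ∑ as (λ _ → 0ℤ) ≡ 0ℤ
∑-0 []       = refl
∑-0 (_ ∷ as) = trans (ℤ.+-identityˡ _) (∑-0 as)

∑-zero : {A : Set} {f : A → ℤ} {as : List A} → All (λ a → f a ≡ 0ℤ) as → ∑ as f ≡ 0ℤ
∑-zero {as = as} es = trans (∑-cong es) (∑-0 as)

∑-++ : {A : Set} (f : A → ℤ) (as bs : List A) → ∑ (as ++ bs) f ≡ ∑ as f ℤ.+ ∑ bs f
∑-++ f []       bs = sym (ℤ.+-identityˡ _)
∑-++ f (a ∷ as) bs = trans (cong (ℤ._+_ (f a)) (∑-++ f as bs)) (sym (ℤ.+-assoc (f a) _ _))

∑-map : {A B : Set} (f : B → ℤ) (g : A → B) (as : List A) → ∑ (map g as) f ≡ ∑ as (f ∘ g)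
∑-map f g []       = refl
∑-map f g (a ∷ as) = cong (ℤ._+_ (f (g a))) (∑-map f g as)

∑-+ : {A : Set} (f g : A → ℤ) (as : List A) → ∑ as (λ a → f a ℤ.+ g a) ≡ ∑ as f ℤ.+ ∑ as g
∑-+ f g []       = refl
∑-+ f g (a ∷ as) = trans (cong (ℤ._+_ (f a ℤ.+ g a)) (∑-+ f g as)) (interchange (f a) (g a) _ _)

∑-*ˡ : {A : Set} (c : ℤ) (f : A → ℤ) (as : List A) → ∑ as (λ a → c ℤ.* f a) ≡ c ℤ.* ∑ as f
∑-*ˡ c f []       = sym (ℤ.*-zeroʳ c)
∑-*ˡ c f (a ∷ as) = trans (cong (ℤ._+_ (c ℤ.* f a)) (∑-*ˡ c f as)) (sym (ℤ.*-distribˡ-+ c (f a) _))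

∑-*ʳ : {A : Set} (c : ℤ) (f : A → ℤ) (as : List A) → ∑ as (λ a → f a ℤ.* c) ≡ ∑ as f ℤ.* c
∑-*ʳ c f as = trans (∑-cong′ as λ a → ℤ.*-comm (f a) c) (trans (∑-*ˡ c f as) (ℤ.*-comm c _))

∑-swap : {A B : Set} (f : A → B → ℤ) (as : List A) (bs : List B) →
         ∑ as (λ a → ∑ bs (f a)) ≡ ∑ bs (λ b → ∑ as (λ a → f a b))
∑-swap f []       bs = sym (∑-0 bs)
∑-swap f (a ∷ as) bs = trans (cong (ℤ._+_ (∑ bs (f a))) (∑-swap f as bs)) (sym (∑-+ (f a) _ bs))

∑-product : {A B C : Set} (f : C → ℤ) (g : A → B → C) (as : List A) (bs : List B) →
            ∑ (cartesianProductWith g as bs) f ≡ ∑ as (λ a → ∑ bs (f ∘ g a))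
∑-product f g []       bs = refl
∑-product f g (a ∷ as) bs = trans (∑-++ f (map (g a) bs) _)
  (cong₂ ℤ._+_ (∑-map f (g a) bs) (∑-product f g as bs))

splits-length : ∀ μ → All (λ (α , β) → length α ≡ length μ × length β ≡ length μ) (splits μ)
splits-length []      = (refl , refl) ∷ []
splits-length (p ∷ μ) =
  All.cartesianProductWith⁺ (≡.setoid _) (≡.setoid _) _ (splitEntry p) (splits μ) λ _ m →
    let e , e′ = All.lookup (splits-length μ) m in cong suc e , cong suc e′

entryDegree : ℕ × Bool → ℕ
entryDegree (e , b) = e + bit b

splitEntry-degree : ∀ p → All (λ (a , b) → entryDegree a + entryDegree b ≡ entryDegree p) (splitEntry p)
splitEntry-degree (e , false) = All.map⁺ (All.applyUpTo⁺₁ id (suc e) λ {i} i<1+e →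
  trans (ℕ-interchange (e ∸ i) 0 i 0) (cong (_+ 0) (ℕ.m∸n+n≡m (ℕ.m<1+n⇒m≤n i<1+e))))
splitEntry-degree (e , true)  = All.++⁺
  (All.map⁺ (All.applyUpTo⁺₁ id (suc e) λ {i} i<1+e →
    trans (ℕ-interchange (e ∸ i) 1 i 0) (cong (_+ 1) (ℕ.m∸n+n≡m (ℕ.m<1+n⇒m≤n i<1+e)))))
  (All.map⁺ (All.applyUpTo⁺₁ id (suc e) λ {i} i<1+e →
    trans (ℕ-interchange (e ∸ i) 0 i 1) (cong (_+ 1) (ℕ.m∸n+n≡m (ℕ.m<1+n⇒m≤n i<1+e)))))

splits-degree : ∀ μ → All (λ (α , β) → degree α + degree β ≡ degree μ) (splits μ)
splits-degree []      = refl ∷ []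
splits-degree (p ∷ μ) =
  All.cartesianProductWith⁺ (≡.setoid _) (≡.setoid _) _ (splitEntry p) (splits μ)
    λ {(a , b)} {(α , β)} m m′ →
      trans (ℕ-interchange (entryDegree a) (degree α) (entryDegree b) (degree β))
            (cong₂ _+_ (All.lookup (splitEntry-degree p) m) (All.lookup (splits-degree μ) m′))

zeros : Mon → Mon
zeros = map (λ _ → 0 , false)

norm-zeros : ∀ μ → norm (zeros μ) ≡ []
norm-zeros []      = refl
norm-zeros (_ ∷ μ) rewrite norm-zeros μ = refl

ε-zeros : ∀ μ → ε μ (zeros μ) ≡ 1ℤ
ε-zeros []      = refl
ε-zeros (_ ∷ μ) = ε-zeros μ

∑-splits-onlyˡ : ∀ μ (g : Mon × Mon → ℤ) → (∀ α β → norm β ≢ [] → g (α , β) ≡ 0ℤ) →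
                 ∑ (splits μ) g ≡ g (μ , zeros μ)
∑-splits-onlyˡ []      g _   = ℤ.+-identityʳ _
∑-splits-onlyˡ (p ∷ μ) g g≡0 = trans (∑-product g _ (splitEntry p) (splits μ)) (first p)
  where
  inner : (ℕ × Bool) × (ℕ × Bool) → ℤ
  inner (a , b) = ∑ (splits μ) (λ (α , β) → g (a ∷ α , b ∷ β))

  ◃≢[] : ∀ {β} → norm β ≢ [] → (0 , false) ◃ norm β ≢ []
  ◃≢[] {β} ne eq with norm β
  ... | []    = ne refl
  ... | _ ∷ _ with () ← eq

  suc≢[] : ∀ i b μ → (suc i , b) ◃ μ ≢ []
  suc≢[] i b μ ()

  true≢[] : ∀ i μ → (i , true) ◃ μ ≢ []
  true≢[] zero    μ ()
  true≢[] (suc i) μ ()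

  inner-0 : ∀ a → inner (a , (0 , false)) ≡ g (a ∷ μ , zeros (p ∷ μ))
  inner-0 a = ∑-splits-onlyˡ μ _ λ α β ne → g≡0 (a ∷ α) _ (◃≢[] {β} ne)

  inner-suc : ∀ a i → inner (a , (suc i , false)) ≡ 0ℤ
  inner-suc a i = ∑-zero (All.universal (λ (α , β) → g≡0 _ _ (suc≢[] i false (norm β))) (splits μ))

  inner-true : ∀ a i → inner (a , (i , true)) ≡ 0ℤ
  inner-true a i = ∑-zero (All.universal (λ (α , β) → g≡0 _ _ (true≢[] i (norm β))) (splits μ))

  even : ∀ e b → ∑ (map (λ i → (e ∸ i , b) , (i , false)) (upTo (suc e))) inner
               ≡ g ((e , b) ∷ μ , zeros (p ∷ μ))
  even e b = trans (cong₂ ℤ._+_ (inner-0 (e , b))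
    (∑-zero (All.map⁺ {xs = applyUpTo suc e} (All.applyUpTo⁺₂ suc e λ i → inner-suc _ i))))
    (ℤ.+-identityʳ _)

  first : ∀ q → ∑ (splitEntry q) inner ≡ g (q ∷ μ , zeros (p ∷ μ))
  first (e , false) = even e false
  first (e , true)  = trans (∑-++ inner (map (λ i → (e ∸ i , true) , (i , false)) (upTo (suc e))) _)
    (trans (cong₂ ℤ._+_ (even e true)
      (trans (∑-map inner (λ i → (e ∸ i , false) , (i , true)) (upTo (suc e)))
        (∑-zero (All.universal (λ i → inner-true (e ∸ i , false) i) (upTo (suc e))))))
      (ℤ.+-identityʳ _))

1ˢ-norm : ∀ μ → norm μ ≡ [] → 1ˢ μ ≡ 1ℤ
1ˢ-norm μ e rewrite e = refl

1ˢ-norm≢ : ∀ μ → norm μ ≢ [] → 1ˢ μ ≡ 0ℤ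
1ˢ-norm≢ μ ne rewrite dec-false ([] ≟ᵐ norm μ) (ne ∘ sym) = refl

*-identityʳ : ∀ f → f *ˢ 1ˢ ≈ f
*-identityʳ f μ = trans
  (∑-splits-onlyˡ μ _ λ α β ne →
    trans (cong (λ c → ε α β ℤ.* (f α ℤ.* c)) (1ˢ-norm≢ β ne))
    (trans (cong (ℤ._*_ (ε α β)) (ℤ.*-zeroʳ (f α))) (ℤ.*-zeroʳ (ε α β))))
  (trans (cong₂ (λ a b → a ℤ.* (f μ ℤ.* b)) (ε-zeros μ) (1ˢ-norm (zeros μ) (norm-zeros μ)))
  (trans (ℤ.*-identityˡ _) (ℤ.*-identityʳ _)))

-- f ≈[ N ] g: equality after setting zₖ = ζₖ = 0 for all k ≥ N.
infix 4 _≈[_]_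
_≈[_]_ : Series → ℕ → Series → Set
f ≈[ N ] g = ∀ μ → length μ ≤ N → f μ ≡ g μ

*-cong : ∀ {N f f′ g g′} → f ≈[ N ] f′ → g ≈[ N ] g′ → f *ˢ g ≈[ N ] f′ *ˢ g′
*-cong p q μ l = ∑-cong (All.map (λ {(α , β)} (e , e′) →
  cong (ℤ._*_ (ε α β)) (cong₂ ℤ._*_ (p α (ℕ.≤-trans (ℕ.≤-reflexive e) l))
                                (q β (ℕ.≤-trans (ℕ.≤-reflexive e′) l)))) (splits-length μ))

*-zeroʳ : ∀ {N} f {g} → g ≈[ N ] 0ˢ → f *ˢ g ≈[ N ] 0ˢ
*-zeroʳ f q μ l = ∑-zero (All.map (λ {(α , β)} (e , e′) →
  trans (cong (λ c → ε α β ℤ.* (f α ℤ.* c)) (q β (ℕ.≤-trans (ℕ.≤-reflexive e′) l)))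
  (trans (cong (ℤ._*_ (ε α β)) (ℤ.*-zeroʳ (f α))) (ℤ.*-zeroʳ (ε α β)))) (splits-length μ))

*-zeroˡ : ∀ {N f} g → f ≈[ N ] 0ˢ → f *ˢ g ≈[ N ] 0ˢ
*-zeroˡ g q μ l = ∑-zero (All.map (λ {(α , β)} (e , e′) →
  trans (cong (λ c → ε α β ℤ.* (c ℤ.* g β)) (q α (ℕ.≤-trans (ℕ.≤-reflexive e) l)))
  (trans (cong (ℤ._*_ (ε α β)) (ℤ.*-zeroˡ (g β))) (ℤ.*-zeroʳ (ε α β)))) (splits-length μ))

⁻¹-trivial : ∀ {N f} → f ≈[ N ] 1ˢ → f ⁻¹ ≈[ N ] 1ˢ
⁻¹-trivial {N} {f} p μ l = trans (cong (ℤ._+_ (1ˢ μ)) (∑-zero {as = applyUpTo suc (degree μ)}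
  (All.applyUpTo⁺₂ suc (degree μ) λ k → *-zeroʳ ((1ˢ -ˢ f) ^ˢ k) 1-f≈0 μ l))) (ℤ.+-identityʳ _)
  where
  1-f≈0 : 1ˢ -ˢ f ≈[ N ] 0ˢ
  1-f≈0 ν l = trans (cong (ℤ._-_ (1ˢ ν)) (p ν l)) (ℤ.+-inverseʳ (1ˢ ν))

1-f-g : ∀ {N f g} → f ≈[ N ] 0ˢ → g ≈[ N ] 0ˢ → 1ˢ -ˢ f -ˢ g ≈[ N ] 1ˢ
1-f-g p q μ l = trans (cong₂ (λ a b → 1ˢ μ ℤ.- a ℤ.- b) (p μ l) (q μ l))
  (trans (ℤ.+-identityʳ _) (ℤ.+-identityʳ _))

norm-length : ∀ μ → length (norm μ) ≤ length μ
norm-length []                   = z≤n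
norm-length ((zero , false) ∷ μ) with norm μ | norm-length μ
... | []    | _ = z≤n
... | _ ∷ _ | l = s≤s l
norm-length ((zero , true) ∷ μ)  = s≤s (norm-length μ)
norm-length ((suc _ , _) ∷ μ)    = s≤s (norm-length μ)

shift-length : ∀ k p → norm [ p ] ≡ [ p ] →
               length (norm (replicate k (0 , false) ++ [ p ])) ≡ suc k
shift-length zero    p e = cong length e
shift-length (suc k) p e with norm (replicate k (0 , false) ++ [ p ]) | shift-length k p e
... | _ ∷ _ | l = cong suc l

variable-vanishes : ∀ {N k} p → norm [ p ] ≡ [ p ] → N ≤ k →
                    series (1ℤ , replicate k (0 , false) ++ [ p ]) ≈[ N ] 0ˢ
variable-vanishes {N} {k} p e N≤k μ l =
  cong (λ b → if b then 1ℤ else 0ℤ) (dec-false (norm α ≟ᵐ norm μ) λ eq → ℕ.<-irrefl refl (begin-strict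
    k               <⟨ ℕ.n<1+n k ⟩
    suc k           ≡⟨ shift-length k p e ⟨
    length (norm α) ≡⟨ cong length eq ⟩
    length (norm μ) ≤⟨ norm-length μ ⟩
    length μ        ≤⟨ l ⟩
    N               ≤⟨ N≤k ⟩
    k               ∎))
  where
  open ℕ.≤-Reasoning
  α : Mon
  α = replicate k (0 , false) ++ [ p ]

z-vanishes : ∀ {N k} → N ≤ k → z k ≈[ N ] 0ˢ
z-vanishes = variable-vanishes (1 , false) refl

ζ-vanishes : ∀ {N k} → N ≤ k → ζ k ≈[ N ] 0ˢ
ζ-vanishes = variable-vanishes (0 , true) refl

∏<-cong : ∀ {N F G} n → (∀ i → F i ≈[ N ] G i) → ∏< n F ≈[ N ] ∏< n G
∏<-cong zero    p μ l = refl
∏<-cong (suc n) p     = *-cong (∏<-cong n p) (p n)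

∏<-stable : ∀ {N} M F → (∀ i → M ≤ i → F i ≈[ N ] 1ˢ) → ∀ d → ∏< (d + M) F ≈[ N ] ∏< M F
∏<-stable M F p zero    μ l = refl
∏<-stable M F p (suc d) μ l = trans
  (*-cong {g′ = 1ˢ} (∏<-stable M F p d) (p (d + M) (ℕ.m≤n+m M d)) μ l) (*-identityʳ (∏< M F) μ)

∏<-stable′ : ∀ {N M n} F → (∀ i → M ≤ i → F i ≈[ N ] 1ˢ) → M ≤ n → ∏< n F ≈[ N ] ∏< M F
∏<-stable′ {N} {M} {n} F p M≤n =
  subst (λ k → ∏< k F ≈[ N ] ∏< M F) (ℕ.m∸n+n≡m M≤n) (∏<-stable M F p (n ∸ M))

∏<-trivial : ∀ {N} n F → (∀ i → F i ≈[ N ] 1ˢ) → ∏< n F ≈[ N ] 1ˢ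
∏<-trivial n F p = ∏<-stable′ {n = n} F (λ i _ → p i) z≤n

degree-0 : ∀ μ → degree μ ≡ 0 → norm μ ≡ []
degree-0 []                   _ = refl
degree-0 ((zero , false) ∷ μ) e rewrite degree-0 μ e = refl

norm-degree : ∀ μ → norm μ ≡ [] → degree μ ≡ 0
norm-degree []                   _ = refl
norm-degree ((zero , false) ∷ μ) e with norm μ in eq
... | [] = norm-degree μ eq

power-vanishes : ∀ u → (∀ μ → norm μ ≡ [] → u μ ≡ 0ℤ) → ∀ k μ → degree μ < k → (u ^ˢ k) μ ≡ 0ℤ
power-vanishes u u₀ (suc k) μ d<1+k = ∑-zero (All.map (λ {s} → summand {s}) (splits-degree μ))
  where
  summand : ∀ {s} → degree (proj₁ s) + degree (proj₂ s) ≡ degree μ →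
            ε (proj₁ s) (proj₂ s) ℤ.* ((u ^ˢ k) (proj₁ s) ℤ.* u (proj₂ s)) ≡ 0ℤ
  summand {α , β} e with degree β in eq
  ... | zero  = trans (cong (λ c → ε α β ℤ.* ((u ^ˢ k) α ℤ.* c)) (u₀ β (degree-0 β eq)))
                (trans (cong (ℤ._*_ (ε α β)) (ℤ.*-zeroʳ ((u ^ˢ k) α))) (ℤ.*-zeroʳ (ε α β)))
  ... | suc d = trans (cong (λ c → ε α β ℤ.* (c ℤ.* u β)) (power-vanishes u u₀ k α α<k))
                (trans (cong (ℤ._*_ (ε α β)) (ℤ.*-zeroˡ (u β))) (ℤ.*-zeroʳ (ε α β)))
    where
    α<k : degree α < k
    α<k = ℕ.<-≤-trans (subst (degree α <_) e (ℕ.m<m+n (degree α) z<s)) (ℕ.m<1+n⇒m≤n d<1+k)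

∑-upTo-extend : ∀ (f : ℕ → ℤ) m n → m ≤ n → (∀ k → m ≤ k → f k ≡ 0ℤ) → ∑ (upTo n) f ≡ ∑ (upTo m) f
∑-upTo-extend f m n m≤n f≡0 = go f id m n m≤n f≡0
  where
  go : ∀ (f : ℕ → ℤ) (g : ℕ → ℕ) m n → m ≤ n → (∀ k → m ≤ k → f (g k) ≡ 0ℤ) →
       ∑ (applyUpTo g n) f ≡ ∑ (applyUpTo g m) f
  go f g zero    n       _         h = ∑-zero (All.applyUpTo⁺₂ g n λ i → h i z≤n)
  go f g (suc m) (suc n) (s≤s m≤n) h = cong (ℤ._+_ (f (g 0))) (go f (g ∘ suc) m n m≤n λ k m≤k → h (suc k) (s≤s m≤k))

∑-telescope : ∀ (f : ℕ → ℤ) n → ∑ (upTo n) f ℤ.- ∑ (upTo n) (f ∘ suc) ≡ f 0 ℤ.- f n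
∑-telescope f n = trans (cong (λ c → ∑ (upTo n) f ℤ.- c) (shift id n)) (go id n)
  where
  shift : ∀ (g : ℕ → ℕ) n → ∑ (applyUpTo g n) (f ∘ suc) ≡ ∑ (applyUpTo (suc ∘ g) n) f
  shift g zero    = refl
  shift g (suc n) = cong (ℤ._+_ (f (suc (g 0)))) (shift (g ∘ suc) n)

  cancel : ∀ a b c d → (a ℤ.+ b) ℤ.- (c ℤ.+ d) ≡ (a ℤ.- c) ℤ.+ (b ℤ.- d)
  cancel a b c d = trans (cong (ℤ._+_ (a ℤ.+ b)) (ℤ.neg-distrib-+ c d)) (interchange a b (ℤ.- c) (ℤ.- d))

  go : ∀ (g : ℕ → ℕ) n → ∑ (applyUpTo g n) f ℤ.- ∑ (applyUpTo (g ∘ suc) n) f ≡ f (g 0) ℤ.- f (g n)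
  go g zero    = sym (ℤ.+-inverseʳ (f (g 0)))
  go g (suc n) = trans (cancel (f (g 0)) _ (f (g 1)) _)
    (trans (cong (ℤ._+_ (f (g 0) ℤ.- f (g 1))) (go (g ∘ suc) n))
           (ℤ.+-minus-telescope (f (g 0)) (f (g 1)) (f (g (suc n)))))

⁻¹-inverse : ∀ f → (∀ μ → norm μ ≡ [] → f μ ≡ 1ℤ) → f ⁻¹ *ˢ f ≈ 1ˢ
⁻¹-inverse f f₀ μ = begin
  (f ⁻¹ *ˢ f) μ
    ≡⟨ ∑-cong (All.map (λ {s} → step {s}) (splits-degree μ)) ⟩
  ∑ (splits μ) (λ s → ∑ (upTo D) (λ k → summand s (1ˢ -ˢ u) k))
    ≡⟨ ∑-swap (λ s k → summand s (1ˢ -ˢ u) k) (splits μ) (upTo D) ⟩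
  ∑ (upTo D) (λ k → ((u ^ˢ k) *ˢ (1ˢ -ˢ u)) μ)
    ≡⟨ ∑-cong′ (upTo D) distrib ⟩
  ∑ (upTo D) (λ k → (u ^ˢ k) μ ℤ.+ -1ℤ ℤ.* (u ^ˢ suc k) μ)
    ≡⟨ ∑-+ (λ k → (u ^ˢ k) μ) (λ k → -1ℤ ℤ.* (u ^ˢ suc k) μ) (upTo D) ⟩
  ∑ (upTo D) (λ k → (u ^ˢ k) μ) ℤ.+ ∑ (upTo D) (λ k → -1ℤ ℤ.* (u ^ˢ suc k) μ)
    ≡⟨ cong (ℤ._+_ (∑ (upTo D) (λ k → (u ^ˢ k) μ))) (trans (∑-*ˡ -1ℤ (λ k → (u ^ˢ suc k) μ) (upTo D)) (ℤ.-1*i≡-i _)) ⟩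
  ∑ (upTo D) (λ k → (u ^ˢ k) μ) ℤ.- ∑ (upTo D) (λ k → (u ^ˢ suc k) μ)
    ≡⟨ ∑-telescope (λ k → (u ^ˢ k) μ) D ⟩
  1ˢ μ ℤ.- (u ^ˢ D) μ
    ≡⟨ cong (ℤ._-_ (1ˢ μ)) (power-vanishes u u₀ D μ (ℕ.n<1+n _)) ⟩
  1ˢ μ ℤ.- 0ℤ
    ≡⟨ ℤ.+-identityʳ _ ⟩
  1ˢ μ ∎
  where
  open ≡-Reasoning
  u : Series
  u = 1ˢ -ˢ f

  D : ℕ
  D = suc (degree μ)

  u₀ : ∀ ν → norm ν ≡ [] → u ν ≡ 0ℤ
  u₀ ν e = ℤ.i≡j⇒i-j≡0 (trans (1ˢ-norm ν e) (sym (f₀ ν e)))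

  summand : Mon × Mon → Series → ℕ → ℤ
  summand (α , β) g k = ε α β ℤ.* ((u ^ˢ k) α ℤ.* g β)

  1-u : ∀ ν → f ν ≡ (1ˢ -ˢ u) ν
  1-u ν = sym (trans (cong (ℤ._+_ (1ˢ ν)) (trans (ℤ.neg-distrib-+ (1ˢ ν) (ℤ.- f ν)) (cong (ℤ._+_ (ℤ.- 1ˢ ν)) (ℤ.neg-involutive (f ν)))))
    (trans (sym (ℤ.+-assoc (1ˢ ν) (ℤ.- 1ˢ ν) (f ν))) (trans (cong (ℤ._+ f ν) (ℤ.+-inverseʳ (1ˢ ν))) (ℤ.+-identityˡ (f ν)))))

  step : ∀ {s} → degree (proj₁ s) + degree (proj₂ s) ≡ degree μ →
         ε (proj₁ s) (proj₂ s) ℤ.* ((f ⁻¹) (proj₁ s) ℤ.* f (proj₂ s)) ≡ ∑ (upTo D) (summand s (1ˢ -ˢ u))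
  step {α , β} e = trans
    (cong₂ (λ a b → ε α β ℤ.* (a ℤ.* b))
      (sym (∑-upTo-extend (λ k → (u ^ˢ k) α) (suc (degree α)) D
        (s≤s (subst (degree α ≤_) e (ℕ.m≤m+n _ _))) (λ k → power-vanishes u u₀ k α)))
      (1-u β))
    (trans (cong (ℤ._*_ (ε α β)) (sym (∑-*ʳ ((1ˢ -ˢ u) β) (λ k → (u ^ˢ k) α) (upTo D))))
           (sym (∑-*ˡ (ε α β) _ (upTo D))))

  distrib : ∀ k → ((u ^ˢ k) *ˢ (1ˢ -ˢ u)) μ ≡ (u ^ˢ k) μ ℤ.+ -1ℤ ℤ.* (u ^ˢ suc k) μ
  distrib k = trans (∑-cong′ (splits μ) λ (α , β) → lemma (ε α β) ((u ^ˢ k) α) (1ˢ β) (u β))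
    (trans (∑-+ _ _ (splits μ)) (cong₂ ℤ._+_ (*-identityʳ (u ^ˢ k) μ) (∑-*ˡ -1ℤ _ (splits μ))))
    where
    lemma : ∀ a b c d → a ℤ.* (b ℤ.* (c ℤ.- d)) ≡ a ℤ.* (b ℤ.* c) ℤ.+ -1ℤ ℤ.* (a ℤ.* (b ℤ.* d))
    lemma a b c d = trans (cong (ℤ._*_ a) (trans (ℤ.*-distribˡ-+ b c (ℤ.- d)) (cong (ℤ._+_ (b ℤ.* c)) (sym (ℤ.neg-distribʳ-* b d)))))
      (trans (ℤ.*-distribˡ-+ a (b ℤ.* c) (ℤ.- (b ℤ.* d)))
        (cong (ℤ._+_ (a ℤ.* (b ℤ.* c))) (trans (sym (ℤ.neg-distribʳ-* a (b ℤ.* d))) (sym (ℤ.-1*i≡-i _)))))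

1-fg-hk-constant : ∀ {f g h k} → (∀ μ → norm μ ≡ [] → f μ ≡ 0ℤ) → (∀ μ → norm μ ≡ [] → h μ ≡ 0ℤ) →
                   ∀ μ → norm μ ≡ [] → (1ˢ -ˢ f *ˢ g -ˢ h *ˢ k) μ ≡ 1ℤ
1-fg-hk-constant {f} {g} {h} {k} f₀ h₀ μ e = trans
  (cong₂ (λ a b → 1ˢ μ ℤ.- a ℤ.- b) (product₀ f g f₀) (product₀ h k h₀))
  (trans (ℤ.+-identityʳ _) (trans (ℤ.+-identityʳ _) (1ˢ-norm μ e)))
  where
  product₀ : ∀ f g → (∀ μ → norm μ ≡ [] → f μ ≡ 0ℤ) → (f *ˢ g) μ ≡ 0ℤ
  product₀ f g f₀ = ∑-zero (All.map (λ {(α , β)} d →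
    trans (cong (λ c → ε α β ℤ.* (c ℤ.* g β))
      (f₀ α (degree-0 α (ℕ.m+n≡0⇒m≡0 (degree α) (trans d (norm-degree μ e))))))
    (trans (cong (ℤ._*_ (ε α β)) (ℤ.*-zeroˡ (g β))) (ℤ.*-zeroʳ (ε α β)))) (splits-degree μ))

variable-constant : ∀ k p → norm [ p ] ≡ [ p ] → ∀ μ → norm μ ≡ [] →
                    series (1ℤ , replicate k (0 , false) ++ [ p ]) μ ≡ 0ℤ
variable-constant k p e μ μ₀ = cong (λ b → if b then 1ℤ else 0ℤ) (dec-false (norm α ≟ᵐ norm μ)
  λ eq → ℕ.1+n≢0 (trans (sym (shift-length k p e)) (cong length (trans eq μ₀))))
  where
  α : Mon
  α = replicate k (0 , false) ++ [ p ]

z-constant : ∀ k μ → norm μ ≡ [] → z k μ ≡ 0ℤ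
z-constant k = variable-constant k (1 , false) refl

ζ-constant : ∀ k μ → norm μ ≡ [] → ζ k μ ≡ 0ℤ
ζ-constant k = variable-constant k (0 , true) refl

-- Index 0 is reserved for (t , τ).
record Alphabet : Set where
  field
    index   : ℕ → ℕ
    i<index : ∀ i → i < index i

open Alphabet

-- Two disjoint alphabets; the variables are numbered from 0.
X Y : Alphabet
X .index i   = suc (i + i)
X .i<index i = s≤s (ℕ.m≤m+n i i)
Y .index i   = suc (suc (i + i))
Y .i<index i = s≤s (ℕ.≤-trans (ℕ.m≤m+n i i) (ℕ.n≤1+n _))

even odd : Alphabet → ℕ → Series
even A i = z (index A i)
odd  A i = ζ (index A i)

t τ : Series
t = z 0
τ = ζ 0

x θ y φ : ℕ → Series
x = even X
θ = odd X
y = even Y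
φ = odd Y

even-vanishes : ∀ {N} A i → N ≤ i → even A i ≈[ N ] 0ˢ
even-vanishes A i N≤i = z-vanishes (ℕ.≤-trans N≤i (ℕ.<⇒≤ (i<index A i)))

odd-vanishes : ∀ {N} A i → N ≤ i → odd A i ≈[ N ] 0ˢ
odd-vanishes A i N≤i = ζ-vanishes (ℕ.≤-trans N≤i (ℕ.<⇒≤ (i<index A i)))

-- (Λ₁ , … , Λₘ ; Λₘ₊₁ , …) with m = length anti and the zeros after the
-- semicolon dropped.
record Superpartition : Set where
  field
    anti            : List ℕ
    rest            : List ℕ
    anti-decreasing : Linked _>_ anti
    rest-decreasing : Linked _≥_ rest
    rest-positive   : All (0 <_) rest

  fermionicDegree : ℕ
  fermionicDegree = length anti

  parts : List ℕ
  parts = anti ++ rest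

  ℓ : ℕ
  ℓ = length parts

open Superpartition public

insertions : {A : Set} → A → List A → List (List A)
insertions a []       = [ [ a ] ]
insertions a (b ∷ bs) = (a ∷ b ∷ bs) ∷ map (b ∷_) (insertions a bs)

permutations : {A : Set} → List A → List (List A)
permutations []       = [ [] ]
permutations (a ∷ as) = concatMap (insertions a) (permutations as)

-- ζ_{s₁} ⋯ ζ_{sₘ} · z_{s₁}^Λ₁ z_{s₂}^Λ₂ ⋯, in the variables of A.  The list s
-- has at least ℓ Λ entries.  The resulting monomial has no trailing
-- (0 , false), so that equal terms are equal as elements of Term.
term : Alphabet → Superpartition → List ℕ → Term
term A Λ s = ∏ᵗ (zipWith (λ _ i → ζᵗ (index A i)) (anti Λ) s)
          *ᵗ ∏ᵗ (zipWith (λ k i → zᵗ (index A i) ^ᵗ k) (parts Λ) s)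

-- The distinct terms obtained by permuting the first N pairs of variables
-- (N ≥ ℓ Λ).
distinctTerms : Alphabet → Superpartition → ℕ → List Term
distinctTerms A Λ N = deduplicate _≟ᵗ_ (map (term A Λ) (permutations (upTo N)))

-- A term containing the i-th variable of either kind with i ≥ length μ has
-- coefficient 0 at μ, so permutations of the first ℓ Λ + length μ pairs are
-- enough to determine the coefficient at μ.
m : Alphabet → Superpartition → Series
m A Λ μ = ∑ (distinctTerms A Λ (ℓ Λ + length μ)) (λ T → series T μ)

-- f with its anticommuting variables in reverse order, for f homogeneous of
-- degree d in them; d C 2 is d(d-1)/2.
reversal : ℕ → Series → Series
reversal d f = (-1^ (d C 2)) • f

generatingFactor : Alphabet → ℕ → Series
generatingFactor A i = (1ˢ -ˢ t *ˢ even A i -ˢ τ *ˢ odd A i) ⁻¹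

generatingFactor-inverse : ∀ A i →
  generatingFactor A i *ˢ (1ˢ -ˢ t *ˢ even A i -ˢ τ *ˢ odd A i) ≈ 1ˢ
generatingFactor-inverse A i = ⁻¹-inverse _
  (1-fg-hk-constant {g = even A i} {k = odd A i} (z-constant 0) (ζ-constant 0))

generatingFactor-trivial : ∀ {N} A i → N ≤ i → generatingFactor A i ≈[ N ] 1ˢ
generatingFactor-trivial A i N≤i = ⁻¹-trivial (1-f-g {f = t *ˢ even A i} {g = τ *ˢ odd A i}
  (*-zeroʳ t (even-vanishes A i N≤i)) (*-zeroʳ τ (odd-vanishes A i N≤i)))

generating-convergent : ∀ A → Convergent (λ n → ∏< n (generatingFactor A))
generating-convergent A μ = length μ , λ n N≤n →
  ∏<-stable′ (generatingFactor A) (generatingFactor-trivial A) N≤n μ ℕ.≤-refl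

generatingFunction : Alphabet → Series
generatingFunction A = limit (λ n → ∏< n (generatingFactor A)) (generating-convergent A)

-- [tτ^ n , b ] F = f, where F = ∑ tⁿ τᵇ f with f free of t and τ, and τ to the
-- left of f (τ = ζ₀ comes first in every monomial).
[tτ^_,_] : ℕ → Bool → Series → Series
[tτ^ n , b ] F []                   = F [ n , b ]
[tτ^ n , b ] F ((zero , false) ∷ μ) = F ((n , b) ∷ μ)
[tτ^ n , b ] F (_ ∷ μ)              = 0ℤ

h h̃ : Alphabet → ℕ → Series
h A n = [tτ^ n , false ] (generatingFunction A)
h̃ A n = [tτ^ n , true ] (generatingFunction A)

hΛ : Alphabet → Superpartition → Series
hΛ A Λ = ∏ˢ (map (h̃ A) (anti Λ) ++ map (h A) (rest Λ))

kernelFactor : ℕ → ℕ → Series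
kernelFactor i j = (1ˢ -ˢ x i *ˢ y j -ˢ θ i *ˢ φ j) ⁻¹

kernelFactor-inverse : ∀ i j →
  kernelFactor i j *ˢ (1ˢ -ˢ x i *ˢ y j -ˢ θ i *ˢ φ j) ≈ 1ˢ
kernelFactor-inverse i j = ⁻¹-inverse _
  (1-fg-hk-constant {g = y j} {k = φ j} (z-constant (index X i)) (ζ-constant (index X i)))

kernelPartial : ℕ → Series
kernelPartial n = ∏< n (λ i → ∏< n (λ j → kernelFactor i j))

kernelFactor-trivialˡ : ∀ {N} i j → N ≤ i → kernelFactor i j ≈[ N ] 1ˢ
kernelFactor-trivialˡ i j N≤i = ⁻¹-trivial (1-f-g {f = x i *ˢ y j} {g = θ i *ˢ φ j}
  (*-zeroˡ (y j) (even-vanishes X i N≤i)) (*-zeroˡ (φ j) (odd-vanishes X i N≤i)))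

kernelFactor-trivialʳ : ∀ {N} i j → N ≤ j → kernelFactor i j ≈[ N ] 1ˢ
kernelFactor-trivialʳ i j N≤j = ⁻¹-trivial (1-f-g {f = x i *ˢ y j} {g = θ i *ˢ φ j}
  (*-zeroʳ (x i) (even-vanishes Y j N≤j)) (*-zeroʳ (θ i) (odd-vanishes Y j N≤j)))

kernel-convergent : Convergent kernelPartial
kernel-convergent μ = length μ , λ n N≤n → trans
  (∏<-stable′ {M = length μ} (λ i → ∏< n (kernelFactor i))
    (λ i N≤i → ∏<-trivial n (kernelFactor i) λ j → kernelFactor-trivialˡ i j N≤i) N≤n μ ℕ.≤-refl)
  (∏<-cong (length μ) (λ i → ∏<-stable′ (kernelFactor i) (kernelFactor-trivialʳ i) N≤n) μ ℕ.≤-refl)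

K : Series
K = limit kernelPartial kernel-convergent

{-# OPTIONS --safe #-}
module Submission where

-- Expanding the i-th row of the kernel gives ∏ⱼ (1 - xᵢyⱼ - θᵢφⱼ)⁻¹ =
-- ∑ₙ xᵢⁿ (hₙ + θᵢ h̃ₙ): both sides obey the same recursion in the number of
-- variables y, namely the one read off from the generating function of h and
-- h̃.  So K is the sum, over all families of pairs (nᵢ , bᵢ), of the products of
-- the factors xᵢⁿ hₙ (bᵢ = 0) and xᵢⁿ θᵢ h̃ₙ (bᵢ = 1).  These factors are even,
-- hence commute, so each product can be sorted by decreasing n; it vanishes if
-- two odd factors have the same n, because h̃ₙ² = 0, and is otherwise indexed by
-- a superpartition Λ and one of the terms of m_Λ.  Moving the θ's to the front
-- turns it into that term times h_Λ, up to the sign of the reversal.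
-- All coefficients at a monomial μ are computed in the quotient of the ring of
-- series that only remembers the first length μ pairs of variables and the
-- degrees at most degree μ.

open import Algebra.Bundles using (CommutativeMonoid; CommutativeSemigroup; Ring)
import Algebra.Properties.CommutativeSemigroup
import Algebra.Properties.Ring
open import Data.Bool.Base using (Bool; true; false; if_then_else_; _∨_)
import Data.Bool.Properties as Bool
open import Data.List.Base using (List; []; _∷_; [_]; _++_; map; foldr; length; replicate; take; drop; upTo; applyUpTo; zip; zipWith; mapMaybe; concatMap; deduplicate; cartesianProduct; cartesianProductWith)
open import Data.List.Membership.Propositional using (_∈_; find; lose)
open import Data.List.Membership.Propositional.Properties using (∈-∃++; ∈-concatMap⁺; ∈-concatMap⁻; ∈-map⁺; ∈-map⁻; ∈-cartesianProduct⁺; ∈-cartesianProductWith⁺; ∈-cartesianProductWith⁻; ∈-upTo⁺; ∈-deduplicate⁺; ∈-deduplicate⁻)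
import Data.List.Properties as List
open import Data.List.Relation.Binary.Permutation.Propositional using (_↭_; prep; swap; ↭-sym; ↭-trans; ↭-refl; ↭-reflexive)
import Data.List.Relation.Binary.Permutation.Propositional as ↭
import Data.List.Relation.Binary.Permutation.Propositional.Properties as ↭
open import Data.List.Relation.Unary.All as All using (All; []; _∷_)
import Data.List.Relation.Unary.All.Properties as All
open import Data.List.Relation.Unary.AllPairs using (AllPairs; []; _∷_)
open import Data.List.Relation.Unary.Any as Any using (Any; here; there)
open import Data.List.Relation.Unary.Linked as Linked using (Linked; []; [-]; _∷_)
import Data.List.Relation.Unary.Linked.Properties as Linked
import Data.List.Relation.Unary.Unique.DecPropositional.Properties as DecUnique
open import Data.List.Relation.Unary.Unique.Propositional using (Unique)
import Data.List.Relation.Unary.Unique.Propositional.Properties as Unique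
open import Data.Maybe.Base using (Maybe; just; nothing)
open import Data.Nat.Base as ℕ using (ℕ; zero; suc; _∸_; _≤_; _<_; _>_; _≥_; z≤n; s≤s; z<s)
open import Data.Nat.Combinatorics using (_C_; nCk+nC[k+1]≡[n+1]C[k+1]; nC1≡n)
import Data.Nat.Properties as ℕ
open import Data.Product.Base using (∃-syntax; _×_; _,_; proj₁; proj₂; uncurry)
import Data.Product.Properties as Product
open import Data.Sum.Base using (_⊎_; inj₁; inj₂; [_,_]′)
open import Data.Unit.Base using (⊤; tt)
open import Function.Base using (_∘_; id; flip)
open import Level using (0ℓ)
import Relation.Binary.Construct.Flip.EqAndOrd as Flip
import Relation.Binary.Construct.On as On
open import Relation.Binary.Definitions using (DecidableEquality)
open import Relation.Binary.PropositionalEquality as ≡ using (_≡_; _≢_)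
import Relation.Binary.Reasoning.Setoid
open import Relation.Nullary using (Dec; does; yes; no; contradiction; ¬_)
open import Relation.Nullary.Decidable using (dec-true; dec-false; _×-dec_; _⊎-dec_; map′)
open import Data.List.Sort (On.decTotalOrder (Flip.decTotalOrder ℕ.≤-decTotalOrder) (proj₂ {A = ℕ} {B = λ _ → ℕ})) using (sort; sort-↭; sort-↗)

-- Identities in a supercommutative ring

-- The definition of m_Λ shapes the second half. It keeps the distinct terms among those of all
-- permutations of the first ℓ Λ + N pairs, N being the length of μ, so many permutations share one
-- term and the number of variables changes with Λ. Instead of a bijection between terms and
-- families, both are compared through their underlying monomials: a term and a family are matched
-- when these agree, and the matched contributions are summed in both orders. Families on N
-- variables are padded with zero entries to length ℓ Λ + N, and assignments that leave the
-- truncation contribute 0. Since distinctness is that of signed monomials, two terms could still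
-- differ by a sign; this is excluded because Λ₁ > ... > Λₘ fixes the order in which the θ's are
-- multiplied. Bounding the degree by D makes the powers of xᵢ above the D-th vanish, so each row is
-- a finite sum and finite distributivity is enough. The identities are stated for an abstract
-- supercommutative ring because they serve two rings: the generating function is unfolded in the
-- full ring of series, the kernel in the quotient.

Entry : Set
Entry = ℕ × Bool

-- `odd-square` is an axiom of its own because anticommutation yields only f * f ≈ - (f * f); in the
-- rings of series it follows since ℤ has no 2-torsion.
record SuperRing : Set₁ where
  field
    ring         : Ring 0ℓ 0ℓ
  open Ring ring public
  field
    Even Odd     : Carrier → Set
    even-comm    : ∀ {f} g → Even f → f * g ≈ g * f
    odd-anticomm : ∀ {f g} → Odd f → Odd g → f * g ≈ - (g * f)
    odd-square   : ∀ {f} → Odd f → f * f ≈ 0#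
    1-even       : Even 1#
    *-even       : ∀ {f g} → Even f → Even g → Even (f * g)
    odd*odd-even : ∀ {f g} → Odd f → Odd g → Even (f * g)

words : {A : Set} → List A → ℕ → List (List A)
words as zero    = [] ∷ []
words as (suc n) = cartesianProductWith _∷_ as (words as n)

entries : List ℕ → List ℕ → List (Entry)
entries as rs = map (_, true) as ++ map (_, false) rs

asOdd asPos : ℕ × ℕ → ℕ × Entry
asOdd (i , n) = i , n , true
asPos (i , n) = i , n , false

module SuperRingProperties (𝓡 : SuperRing) where
  open SuperRing 𝓡
  open Algebra.Properties.Ring ring
  open Algebra.Properties.CommutativeSemigroup (CommutativeMonoid.commutativeSemigroup +-commutativeMonoid) using (interchange)
  open Relation.Binary.Reasoning.Setoid setoid

  infixr 8 _^_
  _^_ : Carrier → ℕ → Carrier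
  f ^ zero  = 1#
  f ^ suc k = f ^ k * f

  ^-even : ∀ {f} → Even f → ∀ k → Even (f ^ k)
  ^-even e zero    = 1-even
  ^-even e (suc k) = *-even (^-even e k) e

  sign : ℕ → Carrier → Carrier
  sign zero    f = f
  sign (suc n) f = - sign n f

  sign-cong : ∀ n {f g} → f ≈ g → sign n f ≈ sign n g
  sign-cong zero    p = p
  sign-cong (suc n) p = -‿cong (sign-cong n p)

  sign-*ʳ : ∀ n f g → sign n f * g ≈ sign n (f * g)
  sign-*ʳ zero    f g = refl
  sign-*ʳ (suc n) f g = trans (sym (-‿distribˡ-* _ g)) (-‿cong (sign-*ʳ n f g))

  sign-*ˡ : ∀ n f g → f * sign n g ≈ sign n (f * g)
  sign-*ˡ zero    f g = refl
  sign-*ˡ (suc n) f g = trans (sym (-‿distribʳ-* f _)) (-‿cong (sign-*ˡ n f g))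

  sign-+ : ∀ m n f → sign (m ℕ.+ n) f ≈ sign m (sign n f)
  sign-+ zero    n f = refl
  sign-+ (suc m) n f = -‿cong (sign-+ m n f)

  x∙yz≈y∙xz : ∀ {f g} → f * g ≈ g * f → ∀ h → f * (g * h) ≈ g * (f * h)
  x∙yz≈y∙xz {f} {g} c h = trans (sym (*-assoc f g h)) (trans (*-congʳ c) (*-assoc g f h))

  ∏ : List Carrier → Carrier
  ∏ = foldr _*_ 1#

  ∏-++ : ∀ fs gs → ∏ (fs ++ gs) ≈ ∏ fs * ∏ gs
  ∏-++ []       gs = sym (*-identityˡ _)
  ∏-++ (f ∷ fs) gs = trans (*-congˡ (∏-++ fs gs)) (sym (*-assoc f _ _))

  ∏-map-upTo-suc : ∀ (F : ℕ → Carrier) n → ∏ (map F (upTo (suc n))) ≈ ∏ (map F (upTo n)) * F n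
  ∏-map-upTo-suc F n = begin
    ∏ (map F (upTo (suc n)))              ≡⟨ ≡.cong (∏ ∘ map F) (List.upTo-∷ʳ n) ⟨
    ∏ (map F (upTo n ++ n ∷ []))          ≡⟨ ≡.cong ∏ (List.map-++ F (upTo n) (n ∷ [])) ⟩
    ∏ (map F (upTo n) ++ F n ∷ [])        ≈⟨ ∏-++ (map F (upTo n)) (F n ∷ []) ⟩
    ∏ (map F (upTo n)) * (F n * 1#)       ≈⟨ *-congˡ (*-identityʳ _) ⟩
    ∏ (map F (upTo n)) * F n              ∎

  module _ {A : Set} (F : A → Carrier) where
    ∏-map-↭ : (∀ a → Even (F a)) → ∀ {as bs} → as ↭ bs → ∏ (map F as) ≈ ∏ (map F bs)
    ∏-map-↭ even ↭.refl        = refl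
    ∏-map-↭ even (prep a p)    = *-congˡ (∏-map-↭ even p)
    ∏-map-↭ even (swap a b p)  = trans (x∙yz≈y∙xz (even-comm (F b) (even a)) _) (*-congˡ (*-congˡ (∏-map-↭ even p)))
    ∏-map-↭ even (↭.trans p q) = trans (∏-map-↭ even p) (∏-map-↭ even q)

    ∏-map-zero : ∀ {as} → Any (λ a → F a ≈ 0#) as → ∏ (map F as) ≈ 0#
    ∏-map-zero (here e)  = trans (*-congʳ e) (zeroˡ _)
    ∏-map-zero (there i) = trans (*-congˡ (∏-map-zero i)) (zeroʳ _)

  ∑ᴿ : {A : Set} → List A → (A → Carrier) → Carrier
  ∑ᴿ []       F = 0#
  ∑ᴿ (a ∷ as) F = F a + ∑ᴿ as F

  module _ {A : Set} where
    ∑ᴿ-cong : ∀ (as : List A) {F G} → (∀ a → F a ≈ G a) → ∑ᴿ as F ≈ ∑ᴿ as G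
    ∑ᴿ-cong []       p = refl
    ∑ᴿ-cong (a ∷ as) p = +-cong (p a) (∑ᴿ-cong as p)

    ∑ᴿ-*ʳ : ∀ (as : List A) F g → ∑ᴿ as F * g ≈ ∑ᴿ as (λ a → F a * g)
    ∑ᴿ-*ʳ []       F g = zeroˡ g
    ∑ᴿ-*ʳ (a ∷ as) F g = trans (distribʳ g _ _) (+-congˡ (∑ᴿ-*ʳ as F g))

    ∑ᴿ-*ˡ : ∀ (as : List A) f G → f * ∑ᴿ as G ≈ ∑ᴿ as (λ a → f * G a)
    ∑ᴿ-*ˡ []       f G = zeroʳ f
    ∑ᴿ-*ˡ (a ∷ as) f G = trans (distribˡ f _ _) (+-congˡ (∑ᴿ-*ˡ as f G))

    ∑ᴿ-++ : ∀ (as bs : List A) F → ∑ᴿ (as ++ bs) F ≈ ∑ᴿ as F + ∑ᴿ bs F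
    ∑ᴿ-++ []       bs F = sym (+-identityˡ _)
    ∑ᴿ-++ (a ∷ as) bs F = trans (+-congˡ (∑ᴿ-++ as bs F)) (sym (+-assoc _ _ _))

    ∑ᴿ-map : ∀ {B : Set} (g : B → A) bs F → ∑ᴿ (map g bs) F ≡ ∑ᴿ bs (F ∘ g)
    ∑ᴿ-map g []       F = ≡.refl
    ∑ᴿ-map g (b ∷ bs) F = ≡.cong (F (g b) +_) (∑ᴿ-map g bs F)

  ∑ᴿ-product : ∀ {A B C : Set} (g : A → B → C) as bs F →
               ∑ᴿ (cartesianProductWith g as bs) F ≈ ∑ᴿ as (λ a → ∑ᴿ bs (F ∘ g a))
  ∑ᴿ-product g []       bs F = refl
  ∑ᴿ-product g (a ∷ as) bs F = trans (∑ᴿ-++ (map (g a) bs) _ F)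
    (+-cong (reflexive (∑ᴿ-map (g a) bs F)) (∑ᴿ-product g as bs F))

  -- Plain distributivity: a word records the summand chosen in each factor and keeps the order of
  -- the factors, so nothing has to commute.
  ∏-∑ : ∀ {I A : Set} (F : I → A → Carrier) (as : List A) (is : List I) →
        ∏ (map (λ i → ∑ᴿ as (F i)) is) ≈ ∑ᴿ (words as (length is)) (λ w → ∏ (zipWith F is w))
  ∏-∑ F as []       = sym (+-identityʳ _)
  ∏-∑ F as (i ∷ is) = begin
    ∑ᴿ as (F i) * ∏ (map (λ i → ∑ᴿ as (F i)) is)
      ≈⟨ *-congˡ (∏-∑ F as is) ⟩
    ∑ᴿ as (F i) * ∑ᴿ (words as (length is)) (λ w → ∏ (zipWith F is w))
      ≈⟨ ∑ᴿ-*ʳ as (F i) _ ⟩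
    ∑ᴿ as (λ a → F i a * ∑ᴿ (words as (length is)) (λ w → ∏ (zipWith F is w)))
      ≈⟨ ∑ᴿ-cong as (λ a → ∑ᴿ-*ˡ (words as (length is)) (F i a) _) ⟩
    ∑ᴿ as (λ a → ∑ᴿ (words as (length is)) (λ w → F i a * ∏ (zipWith F is w)))
      ≈⟨ ∑ᴿ-product _∷_ as (words as (length is)) (λ w → ∏ (zipWith F (i ∷ is) w)) ⟨
    ∑ᴿ (words as (length (i ∷ is))) (λ w → ∏ (zipWith F (i ∷ is) w)) ∎

  -- Grows at its top index, unlike `∑ᴿ`, which is what the induction in `S-step` needs.
  ∑< : ℕ → (ℕ → Carrier) → Carrier
  ∑< zero    F = 0#
  ∑< (suc n) F = ∑< n F + F n

  ∑<-cong : ∀ n {F G} → (∀ k → F k ≈ G k) → ∑< n F ≈ ∑< n G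
  ∑<-cong zero    p = refl
  ∑<-cong (suc n) p = +-cong (∑<-cong n p) (p n)

  ∑ᴿ-upTo : ∀ n F → ∑ᴿ (upTo n) F ≈ ∑< n F
  ∑ᴿ-upTo zero    F = refl
  ∑ᴿ-upTo (suc n) F = begin
    ∑ᴿ (upTo (suc n)) F           ≡⟨ ≡.cong (λ l → ∑ᴿ l F) (List.upTo-∷ʳ n) ⟨
    ∑ᴿ (upTo n ++ n ∷ []) F       ≈⟨ ∑ᴿ-++ (upTo n) (n ∷ []) F ⟩
    ∑ᴿ (upTo n) F + (F n + 0#)    ≈⟨ +-cong (∑ᴿ-upTo n F) (+-identityʳ _) ⟩
    ∑< (suc n) F                  ∎

  -- Products of the factors xᵢⁿ hₙ and xᵢⁿ θᵢ h̃ₙ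

  module Factors (x θ h h̃ : ℕ → Carrier) (x-even : ∀ i → Even (x i)) (θ-odd : ∀ i → Odd (θ i))
                 (h-even : ∀ n → Even (h n)) (h̃-odd : ∀ n → Odd (h̃ n)) where

    factor : ℕ → Entry → Carrier
    factor i (n , false) = x i ^ n * h n
    factor i (n , true)  = x i ^ n * (θ i * h̃ n)

    factor-even : ∀ i p → Even (factor i p)
    factor-even i (n , false) = *-even (^-even (x-even i) n) (h-even n)
    factor-even i (n , true)  = *-even (^-even (x-even i) n) (odd*odd-even (θ-odd i) (h̃-odd n))

    factor-0 : h 0 ≈ 1# → ∀ i → factor i (0 , false) ≈ 1#
    factor-0 h₀ i = trans (*-identityˡ _) h₀

    ∑-factor : ∀ (h′ h̃′ : ℕ → Carrier) → (∀ n → h′ n ≈ h n) → (∀ n → h̃′ n ≈ h̃ n) → ∀ D i →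
               ∑< D (λ n → x i ^ n * h′ n + x i ^ n * (θ i * h̃′ n))
               ≈ ∑ᴿ (cartesianProduct (upTo D) (false ∷ true ∷ [])) (factor i)
    ∑-factor h′ h̃′ p p̃ D i = begin
      ∑< D (λ n → x i ^ n * h′ n + x i ^ n * (θ i * h̃′ n))
        ≈⟨ ∑<-cong D (λ n → +-cong (*-congˡ (p n)) (trans (*-congˡ (*-congˡ (p̃ n))) (sym (+-identityʳ _)))) ⟩
      ∑< D (λ n → factor i (n , false) + (factor i (n , true) + 0#))
        ≈⟨ ∑ᴿ-upTo D _ ⟨
      ∑ᴿ (upTo D) (λ n → factor i (n , false) + (factor i (n , true) + 0#))
        ≈⟨ ∑ᴿ-product _,_ (upTo D) (false ∷ true ∷ []) (factor i) ⟨
      ∑ᴿ (cartesianProduct (upTo D) (false ∷ true ∷ [])) (factor i) ∎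

    ∏-factor-pad : h 0 ≈ 1# → ∀ is es k →
                   ∏ (map (uncurry factor) (zip is (es ++ replicate k (0 , false)))) ≈ ∏ (map (uncurry factor) (zip is es))
    ∏-factor-pad h₀ []       []       zero    = refl
    ∏-factor-pad h₀ []       []       (suc k) = refl
    ∏-factor-pad h₀ (i ∷ is) []       zero    = refl
    ∏-factor-pad h₀ (i ∷ is) []       (suc k) =
      trans (*-cong (factor-0 h₀ i) (trans (∏-factor-pad h₀ is [] k) (reflexive (≡.cong (∏ ∘ map (uncurry factor)) (List.zipWith-zeroʳ _,_ is)))))
        (*-identityˡ _)
    ∏-factor-pad h₀ []       (e ∷ es) k       = refl
    ∏-factor-pad h₀ (i ∷ is) (e ∷ es) k       = *-congˡ (∏-factor-pad h₀ is es k)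

    factor-power-zero : ∀ i p → x i ^ proj₁ p ≈ 0# → factor i p ≈ 0#
    factor-power-zero i (n , false) e = trans (*-congʳ e) (zeroˡ _)
    factor-power-zero i (n , true)  e = trans (*-congʳ e) (zeroˡ _)

    factor-variables-zero : ∀ i p → x i ≈ 0# → θ i ≈ 0# → p ≢ (0 , false) → factor i p ≈ 0#
    factor-variables-zero i (zero , false)  x₀ θ₀ ne = contradiction ≡.refl ne
    factor-variables-zero i (suc n , false) x₀ θ₀ ne = trans (*-congʳ (trans (*-congˡ x₀) (zeroʳ _))) (zeroˡ _)
    factor-variables-zero i (n , true)      x₀ θ₀ ne = trans (*-congˡ (trans (*-congʳ θ₀) (zeroˡ _))) (zeroʳ _)

    -- The second factor is even as a whole, so it moves to the left of the `h̃ n` ending the first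
    -- one; the two copies of `h̃ n` then meet and square to zero.
    factor-odd-repeated : ∀ i j n → factor i (n , true) * factor j (n , true) ≈ 0#
    factor-odd-repeated i j n = begin
      (x i ^ n * (θ i * h̃ n)) * (x j ^ n * (θ j * h̃ n))
        ≈⟨ *-congʳ (sym (*-assoc _ _ _)) ⟩
      ((x i ^ n * θ i) * h̃ n) * (x j ^ n * (θ j * h̃ n))
        ≈⟨ *-assoc _ _ _ ⟩
      (x i ^ n * θ i) * (h̃ n * (x j ^ n * (θ j * h̃ n)))
        ≈⟨ *-congˡ (even-comm _ (factor-even j (n , true))) ⟨
      (x i ^ n * θ i) * ((x j ^ n * (θ j * h̃ n)) * h̃ n)
        ≈⟨ *-congˡ (*-assoc _ _ _) ⟩
      (x i ^ n * θ i) * (x j ^ n * ((θ j * h̃ n) * h̃ n))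
        ≈⟨ *-congˡ (*-congˡ (trans (*-assoc _ _ _) (*-congˡ (odd-square (h̃-odd n))))) ⟩
      (x i ^ n * θ i) * (x j ^ n * (θ j * 0#))
        ≈⟨ *-congˡ (trans (*-congˡ (zeroʳ _)) (zeroʳ _)) ⟩
      (x i ^ n * θ i) * 0#
        ≈⟨ zeroʳ _ ⟩
      0# ∎

    -- A weakly decreasing list fails to be strict only at two adjacent equal exponents, and those
    -- two adjacent factors already multiply to zero. `R` is to be filled with the even factors.
    strict-or-zero : ∀ ts → Linked (λ a b → proj₂ a ≥ proj₂ b) ts →
      Linked (λ a b → proj₂ a > proj₂ b) ts ⊎ (∀ R → ∏ (map (uncurry factor) (map asOdd ts ++ R)) ≈ 0#)
    strict-or-zero []                         _       = inj₁ []
    strict-or-zero (_ ∷ [])                   _       = inj₁ [-]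
    strict-or-zero ((i , n) ∷ (j , n′) ∷ ts)  (g ∷ l) with n ℕ.≟ n′
    ... | yes ≡.refl = inj₂ λ R → trans (sym (*-assoc _ _ _)) (trans (*-congʳ (factor-odd-repeated i j n)) (zeroˡ _))
    ... | no n≢n′ with strict-or-zero ((j , n′) ∷ ts) l
    ...   | inj₁ l′ = inj₁ (ℕ.≤∧≢⇒< g (n≢n′ ∘ ≡.sym) ∷ l′)
    ...   | inj₂ e  = inj₂ λ R → trans (*-congˡ (e R)) (zeroʳ _)

    θs : List ℕ → List ℕ → Carrier
    θs ns is = ∏ (zipWith (λ _ i → θ i) ns is)

    xs : List ℕ → List ℕ → Carrier
    xs ns is = ∏ (zipWith (λ n i → x i ^ n) ns is)

    xs-even : ∀ ns is → Even (xs ns is)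
    xs-even []       is       = 1-even
    xs-even (n ∷ ns) []       = 1-even
    xs-even (n ∷ ns) (i ∷ is) = *-even (^-even (x-even i) n) (xs-even ns is)

    odd-θs : ∀ {f} → Odd f → ∀ ns is → length ns ≤ length is →
             f * θs ns is ≈ sign (length ns) (θs ns is * f)
    odd-θs {f} o []       is       l       = trans (*-identityʳ f) (sym (*-identityˡ f))
    odd-θs {f} o (n ∷ ns) (i ∷ is) (s≤s l) = begin
      f * (θ i * θs ns is)                       ≈⟨ *-assoc _ _ _ ⟨
      (f * θ i) * θs ns is                       ≈⟨ *-congʳ (odd-anticomm o (θ-odd i)) ⟩
      (- (θ i * f)) * θs ns is                   ≈⟨ -‿distribˡ-* _ _ ⟨
      - ((θ i * f) * θs ns is)                   ≈⟨ -‿cong (*-assoc _ _ _) ⟩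
      - (θ i * (f * θs ns is))                   ≈⟨ -‿cong (*-congˡ (odd-θs o ns is l)) ⟩
      - (θ i * sign (length ns) (θs ns is * f))  ≈⟨ -‿cong (sign-*ˡ (length ns) _ _) ⟩
      - sign (length ns) (θ i * (θs ns is * f))  ≈⟨ -‿cong (sign-cong (length ns) (*-assoc _ _ _)) ⟨
      - sign (length ns) ((θ i * θs ns is) * f)  ∎

    -- Collecting the θ's in front of the h̃'s costs the sign of the reversal.
    ∏-factor : ∀ as rs is → length (as ++ rs) ≤ length is →
               sign (length as C 2) ((θs as is * xs (as ++ rs) is) * ∏ (map h̃ as ++ map h rs))
               ≈ ∏ (zipWith factor is (entries as rs))
    ∏-factor [] rs is l = trans (*-congʳ (*-identityˡ _)) (evens rs is l)
      where
      evens : ∀ rs is → length rs ≤ length is → xs rs is * ∏ (map h rs) ≈ ∏ (zipWith factor is (map (_, false) rs))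
      evens []       []       l       = *-identityˡ _
      evens []       (_ ∷ _)  l       = *-identityˡ _
      evens (r ∷ rs) (i ∷ is) (s≤s l) = begin
        (x i ^ r * xs rs is) * (h r * ∏ (map h rs))  ≈⟨ *-assoc _ _ _ ⟩
        x i ^ r * (xs rs is * (h r * ∏ (map h rs)))  ≈⟨ *-congˡ (x∙yz≈y∙xz (even-comm _ (xs-even rs is)) _) ⟩
        x i ^ r * (h r * (xs rs is * ∏ (map h rs)))  ≈⟨ *-assoc _ _ _ ⟨
        factor i (r , false) * (xs rs is * ∏ (map h rs))  ≈⟨ *-congˡ (evens rs is l) ⟩
        factor i (r , false) * ∏ (zipWith factor is (map (_, false) rs)) ∎
    ∏-factor (n ∷ as) rs (i ∷ is) (s≤s l) = begin
      sign (suc m C 2) (((θ i * Θ) * (x i ^ n * X)) * (h̃ n * H))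
        -- Pascal's rule splits off the `m` sign changes that `h̃ n` picks up on its way left
        -- through the `m` remaining θ's.
        ≡⟨ ≡.cong (λ k → sign k (((θ i * Θ) * (x i ^ n * X)) * (h̃ n * H)))
             (≡.trans (≡.sym (nCk+nC[k+1]≡[n+1]C[k+1] m 1)) (≡.cong (ℕ._+ m C 2) (nC1≡n m))) ⟩
      sign (m ℕ.+ m C 2) (((θ i * Θ) * (x i ^ n * X)) * (h̃ n * H))
        ≡⟨ ≡.cong (λ k → sign k (((θ i * Θ) * (x i ^ n * X)) * (h̃ n * H))) (ℕ.+-comm m (m C 2)) ⟩
      sign (m C 2 ℕ.+ m) (((θ i * Θ) * (x i ^ n * X)) * (h̃ n * H))
        ≈⟨ sign-+ (m C 2) m _ ⟩
      sign (m C 2) (sign m (((θ i * Θ) * (x i ^ n * X)) * (h̃ n * H)))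
        ≈⟨ sign-cong (m C 2) rearrange ⟩
      sign (m C 2) (factor i (n , true) * ((Θ * X) * H))
        ≈⟨ sign-*ˡ (m C 2) _ _ ⟨
      factor i (n , true) * sign (m C 2) ((Θ * X) * H)
        ≈⟨ *-congˡ (∏-factor as rs is l) ⟩
      factor i (n , true) * ∏ (zipWith factor is (entries as rs)) ∎
      where
      m = length as
      Θ = θs as is
      X = xs (as ++ rs) is
      H = ∏ (map h̃ as ++ map h rs)
      m≤ : m ≤ length is
      m≤ = ℕ.≤-trans (≡.subst (m ≤_) (≡.sym (List.length-++ as)) (ℕ.m≤m+n m (length rs))) l
      rearrange : sign m (((θ i * Θ) * (x i ^ n * X)) * (h̃ n * H)) ≈ factor i (n , true) * ((Θ * X) * H)
      rearrange = begin
        sign m (((θ i * Θ) * (x i ^ n * X)) * (h̃ n * H))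
          ≈⟨ sign-cong m (*-congʳ (x∙yz≈y∙xz (sym (even-comm _ (^-even (x-even i) n))) X)) ⟩
        sign m ((x i ^ n * ((θ i * Θ) * X)) * (h̃ n * H))
          ≈⟨ sign-cong m (trans (*-assoc _ _ _) (*-congˡ (trans (*-congʳ (*-assoc _ _ _)) (*-assoc _ _ _)))) ⟩
        sign m (x i ^ n * (θ i * ((Θ * X) * (h̃ n * H))))
          ≈⟨ sign-cong m (*-congˡ (*-congˡ (trans (*-assoc _ _ _) (*-congˡ (x∙yz≈y∙xz (even-comm _ (xs-even (as ++ rs) is)) H))))) ⟩
        sign m (x i ^ n * (θ i * (Θ * (h̃ n * (X * H)))))
          ≈⟨ sign-*ˡ m _ _ ⟨
        x i ^ n * sign m (θ i * (Θ * (h̃ n * (X * H))))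
          ≈⟨ *-congˡ (sign-*ˡ m _ _) ⟨
        x i ^ n * (θ i * sign m (Θ * (h̃ n * (X * H))))
          ≈⟨ *-congˡ (*-congˡ (sign-cong m (*-assoc _ _ _))) ⟨
        x i ^ n * (θ i * sign m ((Θ * h̃ n) * (X * H)))
          ≈⟨ *-congˡ (*-congˡ (trans (*-congʳ (odd-θs (h̃-odd n) as is m≤)) (sign-*ʳ m _ _))) ⟨
        x i ^ n * (θ i * ((h̃ n * Θ) * (X * H)))
          ≈⟨ *-congˡ (*-congˡ (*-assoc _ _ _)) ⟩
        x i ^ n * (θ i * (h̃ n * (Θ * (X * H))))
          ≈⟨ trans (*-assoc _ _ _) (*-congˡ (*-assoc _ _ _)) ⟨
        factor i (n , true) * (Θ * (X * H))
          ≈⟨ *-congˡ (*-assoc _ _ _) ⟨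
        factor i (n , true) * ((Θ * X) * H) ∎

  -- One row of the kernel: adjoining a pair (y , φ)

  module Row (X Θ y φ : Carrier) (X-even : Even X) (Θ-odd : Odd Θ) (y-even : Even y) (φ-odd : Odd φ)
             (h h̃ h′ h̃′ : ℕ → Carrier)
             (h-zero : h′ 0 ≈ h 0) (h-suc : ∀ n → h′ (suc n) ≈ h (suc n) + y * h′ n)
             (h̃-zero : h̃′ 0 ≈ h̃ 0 + φ * h′ 0)
             (h̃-suc : ∀ n → h̃′ (suc n) ≈ (h̃ (suc n) + y * h̃′ n) + φ * h′ (suc n)) where

    -- Even and odd terms of the expanded row; the primed ones belong to the alphabet enlarged by (y
    -- , φ).
    E O E′ O′ : ℕ → Carrier
    E  n = X ^ n * h n
    O  n = X ^ n * (Θ * h̃ n)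
    E′ n = X ^ n * h′ n
    O′ n = X ^ n * (Θ * h̃′ n)

    Xⁿ : ∀ n → Even (X ^ n)
    Xⁿ = ^-even X-even

    pull-Xy : ∀ n f → X ^ suc n * (y * f) ≈ (X * y) * (X ^ n * f)
    pull-Xy n f = begin
      (X ^ n * X) * (y * f)  ≈⟨ *-assoc _ _ _ ⟩
      X ^ n * (X * (y * f))  ≈⟨ *-congˡ (*-assoc _ _ _) ⟨
      X ^ n * ((X * y) * f)  ≈⟨ x∙yz≈y∙xz (even-comm _ (Xⁿ n)) f ⟩
      (X * y) * (X ^ n * f)  ∎

    pull-Θφ : ∀ n f → X ^ n * (Θ * (φ * f)) ≈ (Θ * φ) * (X ^ n * f)
    pull-Θφ n f = trans (*-congˡ (sym (*-assoc _ _ _))) (x∙yz≈y∙xz (even-comm _ (Xⁿ n)) f)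

    E-suc : ∀ n → E′ (suc n) ≈ E (suc n) + (X * y) * E′ n
    E-suc n = trans (*-congˡ (h-suc n)) (trans (distribˡ _ _ _) (+-congˡ (pull-Xy n (h′ n))))

    O-zero : O′ 0 ≈ O 0 + (Θ * φ) * E′ 0
    O-zero = trans (*-congˡ (trans (*-congˡ h̃-zero) (distribˡ _ _ _)))
      (trans (distribˡ _ _ _) (+-congˡ (pull-Θφ 0 (h′ 0))))

    O-suc : ∀ n → O′ (suc n) ≈ (O (suc n) + (X * y) * O′ n) + (Θ * φ) * E′ (suc n)
    O-suc n = begin
      X ^ suc n * (Θ * h̃′ (suc n))
        ≈⟨ *-congˡ (trans (*-congˡ (h̃-suc n)) (trans (distribˡ _ _ _) (+-congʳ (distribˡ _ _ _)))) ⟩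
      X ^ suc n * ((Θ * h̃ (suc n) + Θ * (y * h̃′ n)) + Θ * (φ * h′ (suc n)))
        ≈⟨ trans (distribˡ _ _ _) (+-cong (distribˡ _ _ _) (pull-Θφ (suc n) (h′ (suc n)))) ⟩
      (O (suc n) + X ^ suc n * (Θ * (y * h̃′ n))) + (Θ * φ) * E′ (suc n)
        ≈⟨ +-congʳ (+-congˡ (trans (*-congˡ (x∙yz≈y∙xz (sym (even-comm _ y-even)) (h̃′ n))) (pull-Xy n (Θ * h̃′ n)))) ⟩
      (O (suc n) + (X * y) * O′ n) + (Θ * φ) * E′ (suc n) ∎

    -- Θ occurs twice. Hence `Θ * φ` may be applied to `E′ + O′` where the recursions supply it for
    -- `E′` only, which turns two recursions into one for the sum.
    kill-O : ∀ n → (Θ * φ) * O′ n ≈ 0#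
    kill-O n = begin
      (Θ * φ) * (X ^ n * (Θ * h̃′ n))    ≈⟨ x∙yz≈y∙xz (sym (even-comm _ (Xⁿ n))) _ ⟩
      X ^ n * ((Θ * φ) * (Θ * h̃′ n))    ≈⟨ *-congˡ (*-assoc _ _ _) ⟨
      X ^ n * (((Θ * φ) * Θ) * h̃′ n)    ≈⟨ *-congˡ (*-congʳ (even-comm Θ (odd*odd-even Θ-odd φ-odd))) ⟩
      X ^ n * ((Θ * (Θ * φ)) * h̃′ n)    ≈⟨ *-congˡ (*-congʳ (*-assoc _ _ _)) ⟨
      X ^ n * (((Θ * Θ) * φ) * h̃′ n)    ≈⟨ *-congˡ (*-congʳ (trans (*-congʳ (odd-square Θ-odd)) (zeroˡ _))) ⟩
      X ^ n * (0# * h̃′ n)               ≈⟨ trans (*-congˡ (zeroˡ _)) (zeroʳ _) ⟩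
      0#                                ∎

    S S′ : ℕ → Carrier
    S  n = ∑< n (λ k → E k + O k)
    S′ n = ∑< n (λ k → E′ k + O′ k)

    step : ∀ n → E′ (suc n) + O′ (suc n) ≈ (E (suc n) + O (suc n)) + ((X * y) * (E′ n + O′ n) + (Θ * φ) * (E′ (suc n) + O′ (suc n)))
    step n = begin
      E′ (suc n) + O′ (suc n)
        ≈⟨ +-cong (E-suc n) (O-suc n) ⟩
      (E (suc n) + (X * y) * E′ n) + ((O (suc n) + (X * y) * O′ n) + (Θ * φ) * E′ (suc n))
        ≈⟨ +-assoc _ _ _ ⟨
      ((E (suc n) + (X * y) * E′ n) + (O (suc n) + (X * y) * O′ n)) + (Θ * φ) * E′ (suc n)
        ≈⟨ +-cong (interchange _ _ _ _) (sym (trans (distribˡ _ _ _) (trans (+-congˡ (kill-O (suc n))) (+-identityʳ _)))) ⟩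
      ((E (suc n) + O (suc n)) + ((X * y) * E′ n + (X * y) * O′ n)) + (Θ * φ) * (E′ (suc n) + O′ (suc n))
        ≈⟨ trans (+-assoc _ _ _) (+-congˡ (+-congʳ (sym (distribˡ _ _ _)))) ⟩
      (E (suc n) + O (suc n)) + ((X * y) * (E′ n + O′ n) + (Θ * φ) * (E′ (suc n) + O′ (suc n))) ∎

    S-step : ∀ n → S′ (suc n) ≈ S (suc n) + ((X * y) * S′ n + (Θ * φ) * S′ (suc n))
    S-step zero = begin
      0# + (E′ 0 + O′ 0)
        ≈⟨ +-identityˡ _ ⟩
      E′ 0 + O′ 0
        ≈⟨ +-cong (*-congˡ h-zero) O-zero ⟩
      E 0 + (O 0 + (Θ * φ) * E′ 0)
        ≈⟨ +-assoc _ _ _ ⟨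
      (E 0 + O 0) + (Θ * φ) * E′ 0
        ≈⟨ +-cong (+-identityˡ _) (+-identityʳ _) ⟨
      (0# + (E 0 + O 0)) + ((Θ * φ) * E′ 0 + 0#)
        ≈⟨ +-congˡ (+-congˡ (kill-O 0)) ⟨
      (0# + (E 0 + O 0)) + ((Θ * φ) * E′ 0 + (Θ * φ) * O′ 0)
        ≈⟨ +-congˡ (trans (+-cong (zeroʳ _) (trans (*-congˡ (+-identityˡ _)) (distribˡ _ _ _))) (+-identityˡ _)) ⟨
      (0# + (E 0 + O 0)) + ((X * y) * 0# + (Θ * φ) * (0# + (E′ 0 + O′ 0))) ∎
    S-step (suc n) = begin
      S′ (suc n) + (E′ (suc n) + O′ (suc n))
        ≈⟨ +-cong (S-step n) (step n) ⟩
      (S (suc n) + ((X * y) * S′ n + (Θ * φ) * S′ (suc n)))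
        + ((E (suc n) + O (suc n)) + ((X * y) * (E′ n + O′ n) + (Θ * φ) * (E′ (suc n) + O′ (suc n))))
        ≈⟨ trans (interchange _ _ _ _) (+-congˡ (interchange _ _ _ _)) ⟩
      S (suc (suc n)) + (((X * y) * S′ n + (X * y) * (E′ n + O′ n)) + ((Θ * φ) * S′ (suc n) + (Θ * φ) * (E′ (suc n) + O′ (suc n))))
        ≈⟨ +-congˡ (+-cong (distribˡ _ _ _) (distribˡ _ _ _)) ⟨
      S (suc (suc n)) + ((X * y) * S′ (suc n) + (Θ * φ) * S′ (suc (suc n))) ∎

    -- `S-step` says that (1 - Xy - Θφ) times `S′` is `S`, except that Xy meets the sum without its
    -- top term. That term times Xy contains X to the power D + 1, which is zero, so the equation
    -- closes up and can be multiplied by the inverse `k`.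
    geometric : ∀ D k → X ^ suc D ≈ 0# → k * (1# - X * y - Θ * φ) ≈ 1# → S′ (suc D) ≈ S (suc D) * k
    geometric D k X^D≈0 inv = begin
      T                    ≈⟨ *-identityʳ _ ⟨
      T * 1#               ≈⟨ *-congˡ inv ⟨
      T * (k * u)          ≈⟨ *-congˡ (u-central k) ⟨
      T * (u * k)          ≈⟨ *-assoc _ _ _ ⟨
      (T * u) * k          ≈⟨ *-congʳ (u-central T) ⟨
      (u * T) * k          ≈⟨ *-congʳ uT ⟩
      S (suc D) * k        ∎
      where
      T u v : Carrier
      T = S′ (suc D)
      u = 1# - X * y - Θ * φ
      v = X * y + Θ * φ

      Xy-top : (X * y) * S′ (suc D) ≈ (X * y) * S′ D
      Xy-top = begin
        (X * y) * (S′ D + (E′ D + O′ D))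
          ≈⟨ distribˡ _ _ _ ⟩
        (X * y) * S′ D + (X * y) * (E′ D + O′ D)
          ≈⟨ +-congˡ (*-congˡ (distribˡ (X ^ D) (h′ D) (Θ * h̃′ D))) ⟨
        (X * y) * S′ D + (X * y) * (X ^ D * (h′ D + Θ * h̃′ D))
          ≈⟨ +-congˡ (pull-Xy D _) ⟨
        (X * y) * S′ D + X ^ suc D * (y * (h′ D + Θ * h̃′ D))
          ≈⟨ +-congˡ (trans (*-congʳ X^D≈0) (zeroˡ _)) ⟩
        (X * y) * S′ D + 0#
          ≈⟨ +-identityʳ _ ⟩
        (X * y) * S′ D ∎

      u≈1-v : u ≈ 1# - v
      u≈1-v = trans (+-assoc _ _ _) (+-congˡ (-‿+-comm _ _))

      T≈S+vT : T ≈ S (suc D) + v * T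
      T≈S+vT = trans (S-step D) (+-congˡ (trans (+-congʳ (sym Xy-top)) (sym (distribʳ _ _ _))))

      uT : u * T ≈ S (suc D)
      uT = begin
        u * T                           ≈⟨ *-congʳ u≈1-v ⟩
        (1# - v) * T                    ≈⟨ distribʳ _ _ _ ⟩
        1# * T + (- v) * T              ≈⟨ +-cong (trans (*-identityˡ _) T≈S+vT) (sym (-‿distribˡ-* v T)) ⟩
        (S (suc D) + v * T) - v * T     ≈⟨ +-assoc _ _ _ ⟩
        S (suc D) + (v * T - v * T)     ≈⟨ +-congˡ (-‿inverseʳ _) ⟩
        S (suc D) + 0#                  ≈⟨ +-identityʳ _ ⟩
        S (suc D)                       ∎

      -- The axioms give no parity for sums, so centrality is carried through the sum and the
      -- difference by hand.
      v-central : ∀ f → v * f ≈ f * v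
      v-central f = trans (distribʳ _ _ _) (trans
        (+-cong (even-comm f (*-even X-even y-even)) (even-comm f (odd*odd-even Θ-odd φ-odd))) (sym (distribˡ _ _ _)))

      u-central : ∀ f → u * f ≈ f * u
      u-central f = begin
        u * f                ≈⟨ *-congʳ u≈1-v ⟩
        (1# - v) * f         ≈⟨ trans (distribʳ _ _ _) (+-cong (*-identityˡ _) (sym (-‿distribˡ-* v f))) ⟩
        f - v * f            ≈⟨ +-congˡ (-‿cong (v-central f)) ⟩
        f - f * v            ≈⟨ trans (distribˡ _ _ _) (+-cong (*-identityʳ _) (sym (-‿distribʳ-* f v))) ⟨
        f * (1# - v)         ≈⟨ *-congˡ u≈1-v ⟨
        f * u                ∎

    trivial-row : ∀ D → h 0 ≈ 1# → (∀ n → h (suc n) ≈ 0#) → (∀ n → h̃ n ≈ 0#) → S (suc D) ≈ 1#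
    trivial-row D h₀ hₙ h̃ₙ = go D
      where
      O≈0 : ∀ n → O n ≈ 0#
      O≈0 n = trans (*-congˡ (trans (*-congˡ (h̃ₙ n)) (zeroʳ _))) (zeroʳ _)
      go : ∀ n → S (suc n) ≈ 1#
      go zero    = trans (+-identityˡ _) (trans (+-cong (trans (*-identityˡ _) h₀) (O≈0 0)) (+-identityʳ _))
      go (suc n) = trans (+-cong (go n) (trans (+-cong (trans (*-congˡ (hₙ n)) (zeroʳ _)) (O≈0 (suc n))) (+-identityʳ _)))
        (+-identityʳ _)

  -- Solves F (1 - a - b) = f for F = f k. With a = tyⱼ and b = τφⱼ it unfolds the generating
  -- function by one variable without expanding the inverse.
  peel : ∀ {a b k} f → Even a → Even b → k * (1# - a - b) ≈ 1# → f * k ≈ (f + a * (f * k)) + b * (f * k)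
  peel {a} {b} {k} f a-even b-even inv = begin
    F                                      ≈⟨ +-identityʳ _ ⟨
    F + 0#                                 ≈⟨ +-congˡ (trans (+-cong (-‿inverseˡ (a * F)) (-‿inverseˡ (b * F))) (+-identityˡ _)) ⟨
    F + ((- (a * F) + a * F) + (- (b * F) + b * F)) ≈⟨ +-congˡ (interchange _ _ _ _) ⟩
    F + ((- (a * F) - b * F) + (a * F + b * F)) ≈⟨ +-assoc _ _ _ ⟨
    (F + (- (a * F) - b * F)) + (a * F + b * F) ≈⟨ +-congʳ (+-assoc _ _ _) ⟨
    (F - a * F - b * F) + (a * F + b * F)  ≈⟨ +-congʳ FU ⟩
    f + (a * F + b * F)                    ≈⟨ +-assoc _ _ _ ⟨
    (f + a * F) + b * F                    ∎
    where
    F : Carrier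
    F = f * k
    FU : F - a * F - b * F ≈ f
    FU = begin
      F - a * F - b * F                ≈⟨ +-cong (+-cong (*-identityʳ _) (-‿cong (sym (even-comm F a-even)))) (-‿cong (sym (even-comm F b-even))) ⟨
      F * 1# - F * a - F * b           ≈⟨ +-cong (trans (distribˡ _ _ _) (+-congˡ (sym (-‿distribʳ-* F a)))) (sym (-‿distribʳ-* F b)) ⟨
      F * (1# - a) + F * (- b)         ≈⟨ distribˡ _ _ _ ⟨
      F * (1# - a - b)                 ≈⟨ *-assoc _ _ _ ⟩
      f * (k * (1# - a - b))           ≈⟨ *-congˡ inv ⟩
      f * 1#                           ≈⟨ *-identityʳ _ ⟩
      f                                ∎

-- The ring of series

open import Defs
import Algebra.Properties.CommutativeSemigroup ℕ.+-commutativeSemigroup as ℕ+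
open import Data.Integer.Base as ℤ using (ℤ; 0ℤ; 1ℤ; -1ℤ; +_; -[1+_])
import Data.Integer.Properties as ℤ
import Algebra.Properties.CommutativeSemigroup ℤ.+-commutativeSemigroup as ℤ+
import Algebra.Properties.CommutativeSemigroup ℤ.*-commutativeSemigroup as ℤ*
open import Data.Integer.Tactic.RingSolver using (solve-∀)
open import Relation.Binary.PropositionalEquality using (refl; sym; trans; cong; cong₂; subst; module ≡-Reasoning)
import Relation.Binary.PropositionalEquality.Properties as ≡

-- Convolution over the factorisations of a monomial

conv : ℕ → (ℕ → ℕ → ℤ) → ℤ
conv zero    f = f 0 0
conv (suc e) f = f (suc e) 0 ℤ.+ conv e (λ a b → f a (suc b))

∑-upTo-suc : ∀ n (f : ℕ → ℤ) → ∑ (applyUpTo suc n) f ≡ ∑ (upTo n) (f ∘ suc)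
∑-upTo-suc n f = go n id
  where
  go : ∀ n (g : ℕ → ℕ) → ∑ (applyUpTo (suc ∘ g) n) f ≡ ∑ (applyUpTo g n) (f ∘ suc)
  go zero    g = refl
  go (suc n) g = cong (ℤ._+_ (f (suc (g 0)))) (go n (g ∘ suc))

-- `conv` is the Cauchy sum over a + b = e; as a recursion it frees the proofs of commutativity and
-- associativity from truncated subtraction.
∑-conv : ∀ e (f : ℕ → ℕ → ℤ) → ∑ (upTo (suc e)) (λ i → f (e ∸ i) i) ≡ conv e f
∑-conv zero    f = ℤ.+-identityʳ _
∑-conv (suc e) f = cong (ℤ._+_ (f (suc e) 0))
  (trans (∑-upTo-suc (suc e) (λ i → f (suc e ∸ i) i)) (∑-conv e (λ a b → f a (suc b))))

conv-cong : ∀ e {f g : ℕ → ℕ → ℤ} → (∀ a b → f a b ≡ g a b) → conv e f ≡ conv e g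
conv-cong zero    p = p 0 0
conv-cong (suc e) p = cong₂ ℤ._+_ (p (suc e) 0) (conv-cong e λ a b → p a (suc b))

conv-+ : ∀ e (f g : ℕ → ℕ → ℤ) → conv e (λ a b → f a b ℤ.+ g a b) ≡ conv e f ℤ.+ conv e g
conv-+ zero    f g = refl
conv-+ (suc e) f g = trans (cong (ℤ._+_ (f (suc e) 0 ℤ.+ g (suc e) 0)) (conv-+ e _ _)) (ℤ+.interchange (f (suc e) 0) (g (suc e) 0) _ _)

conv-zero : ∀ e {f : ℕ → ℕ → ℤ} → (∀ a b → f a b ≡ 0ℤ) → conv e f ≡ 0ℤ
conv-zero zero    p = p 0 0
conv-zero (suc e) p = cong₂ ℤ._+_ (p (suc e) 0) (conv-zero e λ a b → p a (suc b))

conv-sucʳ : ∀ e (f : ℕ → ℕ → ℤ) → conv (suc e) f ≡ conv e (λ a b → f (suc a) b) ℤ.+ f 0 (suc e)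
conv-sucʳ zero    f = refl
conv-sucʳ (suc e) f = trans (cong (ℤ._+_ (f (suc (suc e)) 0)) (conv-sucʳ e (λ a b → f a (suc b))))
  (sym (ℤ.+-assoc (f (suc (suc e)) 0) _ _))

conv-comm : ∀ e (f : ℕ → ℕ → ℤ) → conv e f ≡ conv e (flip f)
conv-comm zero    f = refl
conv-comm (suc e) f = trans (cong (ℤ._+_ (f (suc e) 0)) (conv-comm e (λ a b → f a (suc b))))
  (trans (ℤ.+-comm (f (suc e) 0) _) (sym (conv-sucʳ e (flip f))))

conv-assoc : ∀ e (f : ℕ → ℕ → ℕ → ℤ) →
             conv e (λ a c → conv a (λ i j → f i j c)) ≡ conv e (λ a c → conv c (λ i j → f a i j))
conv-assoc zero    f = refl
conv-assoc (suc e) f = begin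
  conv (suc e) (λ i j → f i j 0) ℤ.+ conv e (λ a c → conv a (λ i j → f i j (suc c)))
    ≡⟨ cong (ℤ._+_ (conv (suc e) (λ i j → f i j 0))) (conv-assoc e (λ a b c → f a b (suc c))) ⟩
  (f (suc e) 0 0 ℤ.+ conv e (λ a c → f a (suc c) 0)) ℤ.+ conv e (λ a c → conv c (λ i j → f a i (suc j)))
    ≡⟨ ℤ.+-assoc (f (suc e) 0 0) _ _ ⟩
  f (suc e) 0 0 ℤ.+ (conv e (λ a c → f a (suc c) 0) ℤ.+ conv e (λ a c → conv c (λ i j → f a i (suc j))))
    ≡⟨ cong (ℤ._+_ (f (suc e) 0 0)) (conv-+ e _ _) ⟨
  f (suc e) 0 0 ℤ.+ conv e (λ a c → conv (suc c) (λ i j → f a i j)) ∎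
  where open ≡-Reasoning

conv-only-0 : ∀ n (f : ℕ → ℕ → ℤ) → (∀ a b → f (suc a) b ≡ 0ℤ) → conv n f ≡ f 0 n
conv-only-0 zero    f p = refl
conv-only-0 (suc n) f p = trans (conv-sucʳ n f)
  (trans (cong (ℤ._+ f 0 (suc n)) (conv-zero n p)) (ℤ.+-identityˡ _))

conv-only-1 : ∀ n (f : ℕ → ℕ → ℤ) → (∀ b → f 0 b ≡ 0ℤ) → (∀ a b → f (suc (suc a)) b ≡ 0ℤ) →
              conv (suc n) f ≡ f 1 n
conv-only-1 n f p q = trans (conv-sucʳ n f)
  (trans (cong₂ ℤ._+_ (conv-only-0 n (f ∘ suc) q) (p (suc n))) (ℤ.+-identityʳ _))

convE : Entry → (Entry → Entry → ℤ) → ℤ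
convE (e , false) g = conv e (λ a b → g (a , false) (b , false))
convE (e , true)  g = conv e (λ a b → g (a , true) (b , false)) ℤ.+ conv e (λ a b → g (a , false) (b , true))

∑-splitEntry : ∀ p (g : Entry → Entry → ℤ) → ∑ (splitEntry p) (uncurry g) ≡ convE p g
∑-splitEntry (e , false) g = trans (∑-map (uncurry g) _ (upTo (suc e))) (∑-conv e _)
∑-splitEntry (e , true)  g = trans (∑-++ (uncurry g) (map (λ i → (e ∸ i , true) , (i , false)) (upTo (suc e))) _)
  (cong₂ ℤ._+_ (trans (∑-map (uncurry g) _ (upTo (suc e))) (∑-conv e _))
               (trans (∑-map (uncurry g) _ (upTo (suc e))) (∑-conv e _)))

convE-cong : ∀ p {f g : Entry → Entry → ℤ} → (∀ a b → f a b ≡ g a b) → convE p f ≡ convE p g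
convE-cong (e , false) p = conv-cong e (λ a b → p _ _)
convE-cong (e , true)  p = cong₂ ℤ._+_ (conv-cong e (λ a b → p _ _)) (conv-cong e (λ a b → p _ _))

convE-comm : ∀ p g → convE p g ≡ convE p (flip g)
convE-comm (e , false) g = conv-comm e _
convE-comm (e , true)  g = trans (ℤ.+-comm (conv e (λ a b → g (a , true) (b , false))) _)
  (cong₂ ℤ._+_ (conv-comm e _) (conv-comm e _))

convE-assoc : ∀ p (f : Entry → Entry → Entry → ℤ) →
              convE p (λ a c → convE a (λ i j → f i j c)) ≡ convE p (λ a c → convE c (λ i j → f a i j))
convE-assoc (e , false) f = conv-assoc e _
convE-assoc (e , true)  f = begin
  conv e (λ a c → conv a (λ i j → f (i , true) (j , false) (c , false)) ℤ.+ conv a (λ i j → f (i , false) (j , true) (c , false)))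
    ℤ.+ conv e (λ a c → conv a (λ i j → f (i , false) (j , false) (c , true)))
    ≡⟨ cong₂ ℤ._+_ (conv-+ e _ _) (conv-assoc e λ i j c → f (i , false) (j , false) (c , true)) ⟩
  (conv e (λ a c → conv a (λ i j → f (i , true) (j , false) (c , false)))
    ℤ.+ conv e (λ a c → conv a (λ i j → f (i , false) (j , true) (c , false))))
    ℤ.+ conv e (λ a c → conv c (λ i j → f (a , false) (i , false) (j , true)))
    ≡⟨ cong₂ (λ u v → u ℤ.+ v ℤ.+ conv e (λ a c → conv c (λ i j → f (a , false) (i , false) (j , true))))
         (conv-assoc e λ i j c → f (i , true) (j , false) (c , false))
         (conv-assoc e λ i j c → f (i , false) (j , true) (c , false)) ⟩
  (conv e (λ a c → conv c (λ i j → f (a , true) (i , false) (j , false)))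
    ℤ.+ conv e (λ a c → conv c (λ i j → f (a , false) (i , true) (j , false))))
    ℤ.+ conv e (λ a c → conv c (λ i j → f (a , false) (i , false) (j , true)))
    ≡⟨ ℤ.+-assoc (conv e (λ a c → conv c (λ i j → f (a , true) (i , false) (j , false)))) _ _ ⟩
  conv e (λ a c → conv c (λ i j → f (a , true) (i , false) (j , false)))
    ℤ.+ (conv e (λ a c → conv c (λ i j → f (a , false) (i , true) (j , false)))
    ℤ.+ conv e (λ a c → conv c (λ i j → f (a , false) (i , false) (j , true))))
    ≡⟨ cong (ℤ._+_ (conv e (λ a c → conv c (λ i j → f (a , true) (i , false) (j , false))))) (conv-+ e _ _) ⟨
  conv e (λ a c → conv c (λ i j → f (a , true) (i , false) (j , false)))
    ℤ.+ conv e (λ a c → conv c (λ i j → f (a , false) (i , true) (j , false)) ℤ.+ conv c (λ i j → f (a , false) (i , false) (j , true))) ∎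
  where open ≡-Reasoning

convS : Mon → (Mon → Mon → ℤ) → ℤ
convS μ g = ∑ (splits μ) (uncurry g)

convS-∷ : ∀ p μ g → convS (p ∷ μ) g ≡ convE p (λ a b → convS μ (λ α β → g (a ∷ α) (b ∷ β)))
convS-∷ p μ g = trans (∑-product (uncurry g) _ (splitEntry p) (splits μ))
  (∑-splitEntry p (λ a b → convS μ (λ α β → g (a ∷ α) (b ∷ β))))

convS-cong : ∀ μ {f g : Mon → Mon → ℤ} → (∀ α β → f α β ≡ g α β) → convS μ f ≡ convS μ g
convS-cong μ p = ∑-cong′ (splits μ) λ _ → p _ _

convS-cong-∈ : ∀ {P : Mon × Mon → Set} μ {f g : Mon → Mon → ℤ} → All P (splits μ) →
               (∀ α β → P (α , β) → f α β ≡ g α β) → convS μ f ≡ convS μ g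
convS-cong-∈ μ all p = ∑-cong (All.map (p _ _) all)

convS-comm : ∀ μ g → convS μ g ≡ convS μ (flip g)
convS-comm []      g = refl
convS-comm (p ∷ μ) g = begin
  convS (p ∷ μ) g
    ≡⟨ convS-∷ p μ g ⟩
  convE p (λ a b → convS μ (λ α β → g (a ∷ α) (b ∷ β)))
    ≡⟨ convE-comm p _ ⟩
  convE p (λ a b → convS μ (λ α β → g (b ∷ α) (a ∷ β)))
    ≡⟨ convE-cong p (λ a b → convS-comm μ _) ⟩
  convE p (λ a b → convS μ (λ α β → g (b ∷ β) (a ∷ α)))
    ≡⟨ convS-∷ p μ (flip g) ⟨
  convS (p ∷ μ) (flip g) ∎
  where open ≡-Reasoning

convS-convE-swap : ∀ μ p (F : Mon → Mon → Entry → Entry → ℤ) →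
                   convS μ (λ α β → convE p (F α β)) ≡ convE p (λ a b → convS μ (λ α β → F α β a b))
convS-convE-swap μ p F = begin
  convS μ (λ α β → convE p (F α β))
    ≡⟨ convS-cong μ (λ α β → sym (∑-splitEntry p (F α β))) ⟩
  ∑ (splits μ) (λ s → ∑ (splitEntry p) (λ q → F (proj₁ s) (proj₂ s) (proj₁ q) (proj₂ q)))
    ≡⟨ ∑-swap _ (splits μ) (splitEntry p) ⟩
  ∑ (splitEntry p) (λ q → ∑ (splits μ) (λ s → F (proj₁ s) (proj₂ s) (proj₁ q) (proj₂ q)))
    ≡⟨ ∑-splitEntry p (λ a b → convS μ (λ α β → F α β a b)) ⟩
  convE p (λ a b → convS μ (λ α β → F α β a b)) ∎
  where open ≡-Reasoning

-- Both sides run over the factorisations of μ into three. Signs are absorbed into `f` and are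
-- compared separately, by `ε-cocycle`.
convS-assoc : ∀ μ (f : Mon → Mon → Mon → ℤ) →
              convS μ (λ α γ → convS α (λ σ τ → f σ τ γ)) ≡ convS μ (λ α γ → convS γ (λ σ τ → f α σ τ))
convS-assoc []      f = refl
convS-assoc (p ∷ μ) f = begin
  convS (p ∷ μ) (λ α γ → convS α (λ σ τ → f σ τ γ))
    ≡⟨ convS-∷ p μ _ ⟩
  convE p (λ a c → convS μ (λ α γ → convS (a ∷ α) (λ σ τ → f σ τ (c ∷ γ))))
    ≡⟨ convE-cong p (λ a c → trans (convS-cong μ (λ α γ → convS-∷ a α _))
         (convS-convE-swap μ a λ α γ i j → convS α (λ σ τ → f (i ∷ σ) (j ∷ τ) (c ∷ γ)))) ⟩
  convE p (λ a c → convE a (λ i j → convS μ (λ α γ → convS α (λ σ τ → f (i ∷ σ) (j ∷ τ) (c ∷ γ)))))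
    ≡⟨ convE-assoc p _ ⟩
  convE p (λ a c → convE c (λ i j → convS μ (λ α γ → convS α (λ σ τ → f (a ∷ σ) (i ∷ τ) (j ∷ γ)))))
    ≡⟨ convE-cong p (λ a c → convE-cong c λ i j → convS-assoc μ λ σ τ γ → f (a ∷ σ) (i ∷ τ) (j ∷ γ)) ⟩
  convE p (λ a c → convE c (λ i j → convS μ (λ α γ → convS γ (λ σ τ → f (a ∷ α) (i ∷ σ) (j ∷ τ)))))
    ≡⟨ convE-cong p (λ a c → trans (convS-cong μ (λ α γ → convS-∷ c γ _))
         (convS-convE-swap μ c λ α γ i j → convS γ (λ σ τ → f (a ∷ α) (i ∷ σ) (j ∷ τ)))) ⟨
  convE p (λ a c → convS μ (λ α γ → convS (c ∷ γ) (λ σ τ → f (a ∷ α) σ τ)))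
    ≡⟨ convS-∷ p μ _ ⟨
  convS (p ∷ μ) (λ α γ → convS γ (λ σ τ → f α σ τ)) ∎
  where open ≡-Reasoning

-- Signs and parity

sgn : Mon → ℤ
sgn μ = -1^ oddDegree μ

-1^-+ : ∀ m n → -1^ (m ℕ.+ n) ≡ (-1^ m) ℤ.* (-1^ n)
-1^-+ m n = ℤ.^-distribˡ-+-* -1ℤ m n

-1^n*-1^n≡1 : ∀ n → (-1^ n) ℤ.* (-1^ n) ≡ 1ℤ
-1^n*-1^n≡1 zero    = refl
-1^n*-1^n≡1 (suc n) = trans (ℤ*.interchange -1ℤ (-1^ n) -1ℤ (-1^ n)) (trans (ℤ.*-identityˡ _) (-1^n*-1^n≡1 n))

-- Parity is additive unless α and β share a ζ, which `_∙_` merges into one; in that case ε α β is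
-- 0, hence the factor on both sides.
ε-sgn : ∀ α β → ε α β ℤ.* sgn (α ∙ β) ≡ ε α β ℤ.* (sgn α ℤ.* sgn β)
ε-sgn []                []                = refl
ε-sgn []                (b ∷ β)           = cong (ℤ._*_ 1ℤ) (sym (ℤ.*-identityˡ _))
ε-sgn (a ∷ α)           []                = cong (ℤ._*_ 1ℤ) (sym (ℤ.*-identityʳ _))
ε-sgn ((_ , false) ∷ α) ((_ , false) ∷ β) = ε-sgn α β
ε-sgn ((_ , true) ∷ α)  ((_ , false) ∷ β) = trans (ℤ*.x∙yz≈y∙xz (ε α β) -1ℤ _)
  (trans (cong (ℤ._*_ -1ℤ) (ε-sgn α β)) (lemma (ε α β) (sgn α) (sgn β)))
  where
  lemma : ∀ a b c → -1ℤ ℤ.* (a ℤ.* (b ℤ.* c)) ≡ a ℤ.* ((-1ℤ ℤ.* b) ℤ.* c)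
  lemma = solve-∀
ε-sgn ((_ , false) ∷ α) ((_ , true) ∷ β)  = trans (lemma₁ (sgn α) (ε α β) (sgn (α ∙ β)))
  (trans (cong (λ c → sgn α ℤ.* (-1ℤ ℤ.* c)) (ε-sgn α β)) (lemma₂ (ε α β) (sgn α) (sgn β)))
  where
  lemma₁ : ∀ a b c → (a ℤ.* b) ℤ.* (-1ℤ ℤ.* c) ≡ a ℤ.* (-1ℤ ℤ.* (b ℤ.* c))
  lemma₁ = solve-∀
  lemma₂ : ∀ a b c → b ℤ.* (-1ℤ ℤ.* (a ℤ.* (b ℤ.* c))) ≡ (b ℤ.* a) ℤ.* (b ℤ.* (-1ℤ ℤ.* c))
  lemma₂ = solve-∀
ε-sgn ((_ , true) ∷ α)  ((_ , true) ∷ β)  = refl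

∙-identityʳ : ∀ α → α ∙ [] ≡ α
∙-identityʳ []      = refl
∙-identityʳ (_ ∷ _) = refl

-- The 2-cocycle identity, which is associativity of the product at the level of signs. If two of
-- the monomials share a ζ, both sides are 0.
ε-cocycle : ∀ α β γ → ε α β ℤ.* ε (α ∙ β) γ ≡ ε α (β ∙ γ) ℤ.* ε β γ
ε-cocycle []      β       γ  = refl
ε-cocycle (a ∷ α) []      γ  = trans (ℤ.*-identityˡ _) (sym (ℤ.*-identityʳ _))
ε-cocycle (a ∷ α) (b ∷ β) [] = refl
ε-cocycle ((_ , false) ∷ α) ((_ , false) ∷ β) ((_ , false) ∷ γ) = ε-cocycle α β γ
ε-cocycle ((_ , true) ∷ α)  ((_ , false) ∷ β) ((_ , false) ∷ γ) = ε-cocycle α β γ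
ε-cocycle ((_ , false) ∷ α) ((_ , true) ∷ β)  ((_ , false) ∷ γ) =
  trans (ℤ.*-assoc (sgn α) _ _) (trans (cong (ℤ._*_ (sgn α)) (ε-cocycle α β γ)) (sym (ℤ.*-assoc (sgn α) _ _)))
ε-cocycle ((_ , true) ∷ α)  ((_ , true) ∷ β)  ((_ , false) ∷ γ) = refl
ε-cocycle ((_ , false) ∷ α) ((_ , false) ∷ β) ((_ , true) ∷ γ)  = begin
  ε α β ℤ.* (sgn (α ∙ β) ℤ.* ε (α ∙ β) γ)         ≡⟨ ℤ.*-assoc (ε α β) _ _ ⟨
  (ε α β ℤ.* sgn (α ∙ β)) ℤ.* ε (α ∙ β) γ         ≡⟨ cong (ℤ._* ε (α ∙ β) γ) (ε-sgn α β) ⟩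
  (ε α β ℤ.* (sgn α ℤ.* sgn β)) ℤ.* ε (α ∙ β) γ   ≡⟨ ℤ*.xy∙z≈xz∙y (ε α β) _ _ ⟩
  (ε α β ℤ.* ε (α ∙ β) γ) ℤ.* (sgn α ℤ.* sgn β)   ≡⟨ cong (ℤ._* (sgn α ℤ.* sgn β)) (ε-cocycle α β γ) ⟩
  (ε α (β ∙ γ) ℤ.* ε β γ) ℤ.* (sgn α ℤ.* sgn β)   ≡⟨ lemma (ε α (β ∙ γ)) (ε β γ) (sgn α) (sgn β) ⟩
  (sgn α ℤ.* ε α (β ∙ γ)) ℤ.* (sgn β ℤ.* ε β γ)   ∎
  where
  open ≡-Reasoning
  lemma : ∀ a b c d → (a ℤ.* b) ℤ.* (c ℤ.* d) ≡ (c ℤ.* a) ℤ.* (d ℤ.* b)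
  lemma = solve-∀
ε-cocycle ((_ , true) ∷ α)  ((_ , false) ∷ β) ((_ , true) ∷ γ)  = ℤ.*-zeroʳ (ε α β)
ε-cocycle ((_ , false) ∷ α) ((_ , true) ∷ β)  ((_ , true) ∷ γ)  = trans (ℤ.*-zeroʳ (sgn α ℤ.* ε α β)) (sym (ℤ.*-zeroʳ (sgn α ℤ.* ε α (β ∙ γ))))
ε-cocycle ((_ , true) ∷ α)  ((_ , true) ∷ β)  ((_ , true) ∷ γ)  = refl

-- The Koszul sign: -1 to the product of the two odd degrees.
sgn₂ : Mon → Mon → ℤ
sgn₂ α β = sgn α ℤ.^ oddDegree β

^-*-distrib : ∀ a b n → (a ℤ.* b) ℤ.^ n ≡ a ℤ.^ n ℤ.* b ℤ.^ n
^-*-distrib a b zero    = refl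
^-*-distrib a b (suc n) = trans (cong (ℤ._*_ (a ℤ.* b)) (^-*-distrib a b n)) (ℤ*.interchange a b (a ℤ.^ n) (b ℤ.^ n))

ε-swap : ∀ α β → ε α β ≡ sgn₂ α β ℤ.* ε β α
ε-swap []                []                = refl
ε-swap []                (b ∷ β)           = sym (trans (ℤ.*-identityʳ _) (ℤ.^-zeroˡ (oddDegree (b ∷ β))))
ε-swap (_ ∷ _)           []                = refl
ε-swap ((_ , false) ∷ α) ((_ , false) ∷ β) = ε-swap α β
ε-swap ((_ , false) ∷ α) ((_ , true) ∷ β)  = trans (cong (ℤ._*_ (sgn α)) (ε-swap α β)) (sym (ℤ.*-assoc (sgn α) _ _))
ε-swap ((_ , true) ∷ α)  ((_ , false) ∷ β) = trans (ε-swap α β) (sym (begin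
  ((-1ℤ ℤ.* sgn α) ℤ.^ oddDegree β) ℤ.* (sgn β ℤ.* ε β α)  ≡⟨ cong (ℤ._* (sgn β ℤ.* ε β α)) (^-*-distrib -1ℤ (sgn α) (oddDegree β)) ⟩
  (sgn β ℤ.* sgn₂ α β) ℤ.* (sgn β ℤ.* ε β α)               ≡⟨ ℤ*.interchange (sgn β) _ _ _ ⟩
  (sgn β ℤ.* sgn β) ℤ.* (sgn₂ α β ℤ.* ε β α)               ≡⟨ cong (ℤ._* (sgn₂ α β ℤ.* ε β α)) (-1^n*-1^n≡1 (oddDegree β)) ⟩
  1ℤ ℤ.* (sgn₂ α β ℤ.* ε β α)                              ≡⟨ ℤ.*-identityˡ _ ⟩
  sgn₂ α β ℤ.* ε β α                                       ∎))
  where open ≡-Reasoning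
ε-swap ((_ , true) ∷ α)  ((_ , true) ∷ β)  = sym (ℤ.*-zeroʳ (sgn₂ ((0 , true) ∷ α) ((0 , true) ∷ β)))

splitEntry-∙ : ∀ p → All (λ (a , b) → (proj₁ a ℕ.+ proj₁ b , proj₂ a ∨ proj₂ b) ≡ p ×
                                      bit (proj₂ a) ℕ.+ bit (proj₂ b) ≡ bit (proj₂ p)) (splitEntry p)
splitEntry-∙ (e , false) = All.map⁺ (All.applyUpTo⁺₁ id (suc e) λ i<1+e →
  cong (_, false) (ℕ.m∸n+n≡m (ℕ.m<1+n⇒m≤n i<1+e)) , refl)
splitEntry-∙ (e , true)  = All.++⁺
  (All.map⁺ (All.applyUpTo⁺₁ id (suc e) λ i<1+e → cong (_, true) (ℕ.m∸n+n≡m (ℕ.m<1+n⇒m≤n i<1+e)) , refl))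
  (All.map⁺ (All.applyUpTo⁺₁ id (suc e) λ i<1+e → cong (_, true) (ℕ.m∸n+n≡m (ℕ.m<1+n⇒m≤n i<1+e)) , refl))

-- A split never gives the same ζ to both factors, so here the odd degrees add exactly.
splits-∙ : ∀ μ → All (λ (α , β) → α ∙ β ≡ μ × oddDegree α ℕ.+ oddDegree β ≡ oddDegree μ) (splits μ)
splits-∙ []      = (refl , refl) ∷ []
splits-∙ (p ∷ μ) = All.cartesianProductWith⁺ (≡.setoid _) (≡.setoid _) _ (splitEntry p) (splits μ)
  λ {(a , b)} {(α , β)} m m′ → let e , o = All.lookup (splitEntry-∙ p) m ; e′ , o′ = All.lookup (splits-∙ μ) m′ in
    cong₂ _∷_ e e′ , trans (ℕ+.interchange (bit (proj₂ a)) (oddDegree α) _ _) (cong₂ ℕ._+_ o o′)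

*-assoc : ∀ f g h → (f *ˢ g) *ˢ h ≈ f *ˢ (g *ˢ h)
*-assoc f g h μ = begin
  convS μ (λ α γ → ε α γ ℤ.* (convS α (λ σ τ → ε σ τ ℤ.* (f σ ℤ.* g τ)) ℤ.* h γ))
    ≡⟨ convS-cong μ (λ α γ → trans (lemma₁ (ε α γ) _ (h γ)) (sym (∑-*ˡ (ε α γ ℤ.* h γ) _ (splits α)))) ⟩
  convS μ (λ α γ → convS α (λ σ τ → (ε α γ ℤ.* h γ) ℤ.* (ε σ τ ℤ.* (f σ ℤ.* g τ))))
    ≡⟨ convS-cong μ (λ α γ → convS-cong-∈ α (splits-∙ α) λ σ τ e →
         trans (cong (λ ρ → (ε ρ γ ℤ.* h γ) ℤ.* (ε σ τ ℤ.* (f σ ℤ.* g τ))) (sym (proj₁ e)))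
               (lemma₂ (ε (σ ∙ τ) γ) (ε σ τ) (f σ) (g τ) (h γ))) ⟩
  convS μ (λ α γ → convS α (λ σ τ → (ε σ τ ℤ.* ε (σ ∙ τ) γ) ℤ.* (f σ ℤ.* (g τ ℤ.* h γ))))
    ≡⟨ convS-assoc μ (λ σ τ γ → (ε σ τ ℤ.* ε (σ ∙ τ) γ) ℤ.* (f σ ℤ.* (g τ ℤ.* h γ))) ⟩
  convS μ (λ α γ → convS γ (λ σ τ → (ε α σ ℤ.* ε (α ∙ σ) τ) ℤ.* (f α ℤ.* (g σ ℤ.* h τ))))
    ≡⟨ convS-cong μ (λ α γ → convS-cong-∈ γ (splits-∙ γ) λ σ τ e →
         trans (cong (ℤ._* (f α ℤ.* (g σ ℤ.* h τ))) (trans (ε-cocycle α σ τ) (cong (λ ρ → ε α ρ ℤ.* ε σ τ) (proj₁ e))))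
               (lemma₃ (ε α γ) (ε σ τ) (f α) (g σ) (h τ))) ⟩
  convS μ (λ α γ → convS γ (λ σ τ → (ε α γ ℤ.* f α) ℤ.* (ε σ τ ℤ.* (g σ ℤ.* h τ))))
    ≡⟨ convS-cong μ (λ α γ → trans (∑-*ˡ (ε α γ ℤ.* f α) _ (splits γ)) (ℤ.*-assoc (ε α γ) (f α) _)) ⟩
  convS μ (λ α γ → ε α γ ℤ.* (f α ℤ.* convS γ (λ σ τ → ε σ τ ℤ.* (g σ ℤ.* h τ)))) ∎
  where
  open ≡-Reasoning
  lemma₁ : ∀ a b c → a ℤ.* (b ℤ.* c) ≡ (a ℤ.* c) ℤ.* b
  lemma₁ = solve-∀
  lemma₂ : ∀ a b c d e → (a ℤ.* e) ℤ.* (b ℤ.* (c ℤ.* d)) ≡ (b ℤ.* a) ℤ.* (c ℤ.* (d ℤ.* e))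
  lemma₂ = solve-∀
  lemma₃ : ∀ a b c d e → (a ℤ.* b) ℤ.* (c ℤ.* (d ℤ.* e)) ≡ (a ℤ.* c) ℤ.* (b ℤ.* (d ℤ.* e))
  lemma₃ = solve-∀

-- Over ℤ this says that f vanishes at all monomials of the wrong parity; the equational form passes
-- through sums and products without a case distinction.
Even Odd : Series → Set
Even f = ∀ μ → sgn μ ℤ.* f μ ≡ f μ
Odd  f = ∀ μ → sgn μ ℤ.* f μ ≡ ℤ.- f μ

sgn₂-even : ∀ {f} → Even f → ∀ α β → sgn₂ α β ℤ.* f α ≡ f α
sgn₂-even {f} even α β = go (oddDegree β)
  where
  go : ∀ n → (sgn α ℤ.^ n) ℤ.* f α ≡ f α
  go zero    = ℤ.*-identityˡ _
  go (suc n) = trans (ℤ.*-assoc (sgn α) _ _) (trans (cong (ℤ._*_ (sgn α)) (go n)) (even α))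

sgn₂-odd : ∀ {f} → Odd f → ∀ α β → sgn₂ α β ℤ.* f α ≡ sgn β ℤ.* f α
sgn₂-odd {f} odd α β = go (oddDegree β)
  where
  lemma : ∀ a b c → a ℤ.* (b ℤ.* c) ≡ b ℤ.* (a ℤ.* c)
  lemma = solve-∀
  lemma′ : ∀ b c → b ℤ.* (ℤ.- c) ≡ (-1ℤ ℤ.* b) ℤ.* c
  lemma′ = solve-∀
  go : ∀ n → (sgn α ℤ.^ n) ℤ.* f α ≡ (-1^ n) ℤ.* f α
  go zero    = refl
  go (suc n) = begin
    (sgn α ℤ.* sgn α ℤ.^ n) ℤ.* f α   ≡⟨ ℤ.*-assoc (sgn α) _ _ ⟩
    sgn α ℤ.* (sgn α ℤ.^ n ℤ.* f α)   ≡⟨ cong (ℤ._*_ (sgn α)) (go n) ⟩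
    sgn α ℤ.* ((-1^ n) ℤ.* f α)       ≡⟨ lemma (sgn α) (-1^ n) (f α) ⟩
    (-1^ n) ℤ.* (sgn α ℤ.* f α)       ≡⟨ cong (ℤ._*_ (-1^ n)) (odd α) ⟩
    (-1^ n) ℤ.* (ℤ.- f α)             ≡⟨ lemma′ (-1^ n) (f α) ⟩
    (-1^ suc n) ℤ.* f α               ∎
    where open ≡-Reasoning

even-comm : ∀ {f} g → Even f → f *ˢ g ≈ g *ˢ f
even-comm {f} g even μ = trans (convS-cong μ λ α β → begin
    ε α β ℤ.* (f α ℤ.* g β)                     ≡⟨ cong (ℤ._* (f α ℤ.* g β)) (ε-swap α β) ⟩
    (sgn₂ α β ℤ.* ε β α) ℤ.* (f α ℤ.* g β)      ≡⟨ lemma (sgn₂ α β) (ε β α) (f α) (g β) ⟩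
    ε β α ℤ.* (g β ℤ.* (sgn₂ α β ℤ.* f α))      ≡⟨ cong (λ c → ε β α ℤ.* (g β ℤ.* c)) (sgn₂-even even α β) ⟩
    ε β α ℤ.* (g β ℤ.* f α)                     ∎)
  (convS-comm μ _)
  where
  open ≡-Reasoning
  lemma : ∀ a b c d → (a ℤ.* b) ℤ.* (c ℤ.* d) ≡ b ℤ.* (d ℤ.* (a ℤ.* c))
  lemma = solve-∀

infix 8 -ˢ_
-ˢ_ : Series → Series
(-ˢ f) μ = ℤ.- f μ

odd-anticomm : ∀ {f g} → Odd f → Odd g → f *ˢ g ≈ -ˢ (g *ˢ f)
odd-anticomm {f} {g} odd-f odd-g μ = begin
  convS μ (λ α β → ε α β ℤ.* (f α ℤ.* g β))
    ≡⟨ convS-cong μ step ⟩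
  convS μ (λ α β → -1ℤ ℤ.* (ε β α ℤ.* (g β ℤ.* f α)))
    ≡⟨ ∑-*ˡ -1ℤ _ (splits μ) ⟩
  -1ℤ ℤ.* convS μ (λ α β → ε β α ℤ.* (g β ℤ.* f α))
    ≡⟨ ℤ.-1*i≡-i _ ⟩
  ℤ.- convS μ (λ α β → ε β α ℤ.* (g β ℤ.* f α))
    ≡⟨ cong ℤ.-_ (convS-comm μ _) ⟩
  ℤ.- (g *ˢ f) μ ∎
  where
  open ≡-Reasoning
  lemma : ∀ a b c d → (a ℤ.* b) ℤ.* (c ℤ.* d) ≡ b ℤ.* (d ℤ.* (a ℤ.* c))
  lemma = solve-∀
  lemma′ : ∀ a b c d → a ℤ.* (b ℤ.* (c ℤ.* d)) ≡ a ℤ.* ((c ℤ.* b) ℤ.* d)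
  lemma′ = solve-∀
  lemma″ : ∀ a b c → a ℤ.* ((ℤ.- b) ℤ.* c) ≡ -1ℤ ℤ.* (a ℤ.* (b ℤ.* c))
  lemma″ = solve-∀
  step : ∀ α β → ε α β ℤ.* (f α ℤ.* g β) ≡ -1ℤ ℤ.* (ε β α ℤ.* (g β ℤ.* f α))
  step α β = begin
    ε α β ℤ.* (f α ℤ.* g β)                     ≡⟨ cong (ℤ._* (f α ℤ.* g β)) (ε-swap α β) ⟩
    (sgn₂ α β ℤ.* ε β α) ℤ.* (f α ℤ.* g β)      ≡⟨ lemma (sgn₂ α β) (ε β α) (f α) (g β) ⟩
    ε β α ℤ.* (g β ℤ.* (sgn₂ α β ℤ.* f α))      ≡⟨ cong (λ c → ε β α ℤ.* (g β ℤ.* c)) (sgn₂-odd odd-f α β) ⟩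
    ε β α ℤ.* (g β ℤ.* (sgn β ℤ.* f α))         ≡⟨ lemma′ (ε β α) (g β) (sgn β) (f α) ⟩
    ε β α ℤ.* ((sgn β ℤ.* g β) ℤ.* f α)         ≡⟨ cong (λ c → ε β α ℤ.* (c ℤ.* f α)) (odd-g β) ⟩
    ε β α ℤ.* ((ℤ.- g β) ℤ.* f α)               ≡⟨ lemma″ (ε β α) (g β) (f α) ⟩
    -1ℤ ℤ.* (ε β α ℤ.* (g β ℤ.* f α))           ∎

oddDegree-norm : ∀ μ → oddDegree (norm μ) ≡ oddDegree μ
oddDegree-norm []                   = refl
oddDegree-norm ((zero , false) ∷ μ) with norm μ | oddDegree-norm μ
... | []    | e = e
... | _ ∷ _ | e = e
oddDegree-norm ((zero , true) ∷ μ)  = cong suc (oddDegree-norm μ)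
oddDegree-norm ((suc _ , b) ∷ μ)    = cong (bit b ℕ.+_) (oddDegree-norm μ)

series-sgn : ∀ T μ → sgn μ ℤ.* series T μ ≡ sgn (proj₂ T) ℤ.* series T μ
series-sgn (c , α) μ with norm α ≟ᵐ norm μ
... | no  _ = trans (ℤ.*-zeroʳ (sgn μ)) (sym (ℤ.*-zeroʳ (sgn α)))
... | yes e = cong (λ n → (-1^ n) ℤ.* c)
  (trans (sym (oddDegree-norm μ)) (trans (cong oddDegree (sym e)) (oddDegree-norm α)))

series-even : ∀ T → sgn (proj₂ T) ≡ 1ℤ → Even (series T)
series-even T e μ = trans (series-sgn T μ) (trans (cong (ℤ._* series T μ) e) (ℤ.*-identityˡ _))

series-odd : ∀ T → sgn (proj₂ T) ≡ -1ℤ → Odd (series T)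
series-odd T e μ = trans (series-sgn T μ) (trans (cong (ℤ._* series T μ) e) (ℤ.-1*i≡-i _))

1ˢ-even : Even 1ˢ
1ˢ-even = series-even 1ᵗ refl

z-even : ∀ k → Even (z k)
z-even k = series-even (zᵗ k) (go k)
  where
  go : ∀ k → sgn (proj₂ (zᵗ k)) ≡ 1ℤ
  go zero    = refl
  go (suc k) = go k

ζ-odd : ∀ k → Odd (ζ k)
ζ-odd k = series-odd (ζᵗ k) (go k)
  where
  go : ∀ k → sgn (proj₂ (ζᵗ k)) ≡ -1ℤ
  go zero    = refl
  go (suc k) = go k

-ˢ-even : ∀ {f g} → Even f → Even g → Even (f -ˢ g)
-ˢ-even {f} {g} p q μ = trans (lemma (sgn μ) (f μ) (g μ)) (cong₂ ℤ._-_ (p μ) (q μ))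
  where
  lemma : ∀ a b c → a ℤ.* (b ℤ.- c) ≡ a ℤ.* b ℤ.- a ℤ.* c
  lemma = solve-∀

*-sgn : ∀ f g μ → sgn μ ℤ.* (f *ˢ g) μ ≡ convS μ (λ α β → ε α β ℤ.* ((sgn α ℤ.* f α) ℤ.* (sgn β ℤ.* g β)))
*-sgn f g μ = trans (sym (∑-*ˡ (sgn μ) _ (splits μ))) (convS-cong-∈ μ (splits-∙ μ) λ α β e →
  trans (cong (λ n → (-1^ n) ℤ.* (ε α β ℤ.* (f α ℤ.* g β))) (sym (proj₂ e)))
  (trans (cong (ℤ._* (ε α β ℤ.* (f α ℤ.* g β))) (-1^-+ (oddDegree α) (oddDegree β)))
         (lemma (sgn α) (sgn β) (ε α β) (f α) (g β))))
  where
  lemma : ∀ a b c d e → (a ℤ.* b) ℤ.* (c ℤ.* (d ℤ.* e)) ≡ c ℤ.* ((a ℤ.* d) ℤ.* (b ℤ.* e))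
  lemma = solve-∀

*-even : ∀ {f g} → Even f → Even g → Even (f *ˢ g)
*-even {f} {g} p q μ = trans (*-sgn f g μ) (convS-cong μ λ α β → cong₂ (λ a b → ε α β ℤ.* (a ℤ.* b)) (p α) (q β))

odd*odd-even : ∀ {f g} → Odd f → Odd g → Even (f *ˢ g)
odd*odd-even {f} {g} p q μ = trans (*-sgn f g μ) (convS-cong μ λ α β →
  trans (cong₂ (λ a b → ε α β ℤ.* (a ℤ.* b)) (p α) (q β)) (lemma (ε α β) (f α) (g β)))
  where
  lemma : ∀ a b c → a ℤ.* ((ℤ.- b) ℤ.* (ℤ.- c)) ≡ a ℤ.* (b ℤ.* c)
  lemma = solve-∀

^-even : ∀ {f} → Even f → ∀ k → Even (f ^ˢ k)
^-even p zero    = 1ˢ-even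
^-even p (suc k) = *-even (^-even p k) p

⁻¹-even : ∀ {f} → Even f → Even (f ⁻¹)
⁻¹-even {f} p μ = trans (sym (∑-*ˡ (sgn μ) _ (upTo (suc (degree μ)))))
  (∑-cong′ (upTo (suc (degree μ))) λ k → ^-even (-ˢ-even 1ˢ-even p) k μ)

∏<-even : ∀ n {F} → (∀ i → Even (F i)) → Even (∏< n F)
∏<-even zero    p = 1ˢ-even
∏<-even (suc n) p = *-even (∏<-even n p) (p n)

-- A monomial ideal, given by its complement `Supp`. Closure of `Supp` under factors makes the
-- product compatible with equality on `Supp`.
record Ideal : Set₁ where
  field
    Supp        : Mon → Set
    Supp-splits : ∀ {μ} → Supp μ → All (λ (α , β) → Supp α × Supp β) (splits μ)

-- The quotient of the ring of series by those vanishing on Supp.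
module _ (I : Ideal) where
  open Ideal I

  infix 4 _≈ᴵ_
  record _≈ᴵ_ (f g : Series) : Set where
    constructor on
    field at : ∀ {μ} → Supp μ → f μ ≡ g μ
  open _≈ᴵ_ public

  quotient : Ring 0ℓ 0ℓ
  quotient = record
    { Carrier = Series ; _≈_ = _≈ᴵ_ ; _+_ = _+ˢ_ ; _*_ = _*ˢ_ ; -_ = -ˢ_ ; 0# = 0ˢ ; 1# = 1ˢ
    ; isRing = record
      { +-isAbelianGroup = record
        { isGroup = record
          { isMonoid = record
            { isSemigroup = record
              { isMagma = record
                { isEquivalence = record
                  { refl = on λ _ → refl ; sym = λ p → on λ s → sym (at p s) ; trans = λ p q → on λ s → trans (at p s) (at q s) }
                ; ∙-cong = λ p q → on λ s → cong₂ ℤ._+_ (at p s) (at q s) }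
              ; assoc = λ f g h → on λ {μ} _ → ℤ.+-assoc (f μ) (g μ) (h μ) }
            ; identity = (λ f → on λ {μ} _ → ℤ.+-identityˡ (f μ)) , (λ f → on λ {μ} _ → ℤ.+-identityʳ (f μ)) }
          ; inverse = (λ f → on λ {μ} _ → ℤ.+-inverseˡ (f μ)) , (λ f → on λ {μ} _ → ℤ.+-inverseʳ (f μ))
          ; ⁻¹-cong = λ p → on λ s → cong ℤ.-_ (at p s) }
        ; comm = λ f g → on λ {μ} _ → ℤ.+-comm (f μ) (g μ) }
      ; *-cong = λ p q → on λ {μ} s → convS-cong-∈ μ (Supp-splits s) λ α β (sα , sβ) →
          cong (ℤ._*_ (ε α β)) (cong₂ ℤ._*_ (at p sα) (at q sβ))
      ; *-assoc = λ f g h → on λ {μ} _ → *-assoc f g h μ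
      ; *-identity = (λ f → on λ {μ} _ → trans (even-comm f 1ˢ-even μ) (*-identityʳ f μ)) , (λ f → on λ {μ} _ → *-identityʳ f μ)
      ; distrib = (λ f g h → on λ {μ} _ → trans (convS-cong μ λ α β → lemmaˡ (ε α β) (f α) (g β) (h β)) (∑-+ _ _ (splits μ)))
                , (λ f g h → on λ {μ} _ → trans (convS-cong μ λ α β → lemmaʳ (ε α β) (f β) (g α) (h α)) (∑-+ _ _ (splits μ))) } }
    where
    lemmaˡ : ∀ e a b c → e ℤ.* (a ℤ.* (b ℤ.+ c)) ≡ e ℤ.* (a ℤ.* b) ℤ.+ e ℤ.* (a ℤ.* c)
    lemmaˡ = solve-∀
    lemmaʳ : ∀ e a b c → e ℤ.* ((b ℤ.+ c) ℤ.* a) ≡ e ℤ.* (b ℤ.* a) ℤ.+ e ℤ.* (c ℤ.* a)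
    lemmaʳ = solve-∀

infix 4 _≟ᵉ_
_≟ᵉ_ : DecidableEquality Entry
_≟ᵉ_ = Product.≡-dec ℕ._≟_ Bool._≟_

◃-injective : ∀ p q α β → p ◃ α ≡ q ◃ β → p ≡ q × α ≡ β
◃-injective (zero , false)  (zero , false)  []      []      e = refl , refl
◃-injective (zero , false)  (zero , false)  []      (_ ∷ _) ()
◃-injective (zero , false)  (zero , true)   []      _       ()
◃-injective (zero , false)  (suc _ , _)     []      _       ()
◃-injective (zero , false)  (zero , false)  (_ ∷ _) []      ()
◃-injective (zero , true)   (zero , false)  _       []      ()
◃-injective (suc _ , _)     (zero , false)  _       []      ()
◃-injective (zero , false)  (zero , false)  (_ ∷ _) (_ ∷ _) refl = refl , refl
◃-injective (zero , false)  (zero , true)   (_ ∷ _) _       ()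
◃-injective (zero , false)  (suc _ , _)     (_ ∷ _) _       ()
◃-injective (zero , true)   (zero , false)  _       (_ ∷ _) ()
◃-injective (suc _ , _)     (zero , false)  _       (_ ∷ _) ()
◃-injective (zero , true)   (zero , true)   _       _       refl = refl , refl
◃-injective (zero , true)   (suc _ , _)     _       _       ()
◃-injective (suc _ , _)     (zero , true)   _       _       ()
◃-injective (suc _ , _)     (suc _ , _)     _       _       refl = refl , refl

δ : Entry → Entry → ℤ
δ p q = if does (p ≟ᵉ q) then 1ℤ else 0ℤ

-- As `_◃_` is injective, normal forms can be compared entry by entry even though `norm` deletes
-- trailing entries.
series-∷ : ∀ c p α q μ → series (c , p ∷ α) (q ∷ μ) ≡ δ p q ℤ.* series (c , α) μ
series-∷ c p α q μ with p ≟ᵉ q | norm α ≟ᵐ norm μ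
... | yes refl | yes e rewrite dec-true (norm (p ∷ α) ≟ᵐ norm (p ∷ μ)) (cong (p ◃_) e) = sym (ℤ.*-identityˡ c)
... | yes refl | no ne rewrite dec-false (norm (p ∷ α) ≟ᵐ norm (p ∷ μ)) (λ e → ne (proj₂ (◃-injective p p _ _ e))) = refl
... | no ne    | _     rewrite dec-false (norm (p ∷ α) ≟ᵐ norm (q ∷ μ)) (λ e → ne (proj₁ (◃-injective p q _ _ e))) = refl

-- Slices of a series by the power of the first pair of variables

slice : Entry → Series → Series
slice p f μ = f (p ∷ μ)

sgn• : Series → Series
sgn• f μ = sgn μ ℤ.* f μ

-- The products of slices of f and g making up the slices of f *ˢ g: the
-- exponents of the first anticommuting variable are (false , false),
-- (true , false) and (false , true); in the last case it is moved past f.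
FF TF FT : Series → Series → Mon → ℕ → ℕ → ℤ
FF f g ν a b = (slice (a , false) f *ˢ slice (b , false) g) ν
TF f g ν a b = (slice (a , true) f *ˢ slice (b , false) g) ν
FT f g ν a b = (sgn• (slice (a , false) f) *ˢ slice (b , true) g) ν

*-slice-false : ∀ f g e ν → (f *ˢ g) ((e , false) ∷ ν) ≡ conv e (FF f g ν)
*-slice-false f g e ν = convS-∷ (e , false) ν _

*-slice-true : ∀ f g e ν → (f *ˢ g) ((e , true) ∷ ν) ≡ conv e (TF f g ν) ℤ.+ conv e (FT f g ν)
*-slice-true f g e ν = trans (convS-∷ (e , true) ν _) (cong (ℤ._+_ (conv e (TF f g ν)))
  (conv-cong e λ a b → convS-cong ν λ α β → lemma (sgn α) (ε α β) (f ((a , false) ∷ α)) (g ((b , true) ∷ β))))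
  where
  lemma : ∀ a b c d → (a ℤ.* b) ℤ.* (c ℤ.* d) ≡ b ℤ.* ((a ℤ.* c) ℤ.* d)
  lemma = solve-∀

*ˢ-zeroˡ : ∀ f g → f ≈ 0ˢ → f *ˢ g ≈ 0ˢ
*ˢ-zeroˡ f g p μ = *-zeroˡ g (λ ν _ → p ν) μ ℕ.≤-refl

*ˢ-zeroʳ : ∀ f g → g ≈ 0ˢ → f *ˢ g ≈ 0ˢ
*ˢ-zeroʳ f g p μ = *-zeroʳ f (λ ν _ → p ν) μ ℕ.≤-refl

*ˢ-congˡ : ∀ f f′ g → f ≈ f′ → f *ˢ g ≈ f′ *ˢ g
*ˢ-congˡ f f′ g p μ = *-cong {f = f} {f′ = f′} {g = g} {g′ = g} (λ ν _ → p ν) (λ _ _ → refl) μ ℕ.≤-refl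

1*ˢ : ∀ f → 1ˢ *ˢ f ≈ f
1*ˢ f μ = trans (even-comm f 1ˢ-even μ) (*-identityʳ f μ)

≈1⇒*-identityˡ : ∀ f g → f ≈ 1ˢ → f *ˢ g ≈ g
≈1⇒*-identityˡ f g p μ = trans (*ˢ-congˡ f 1ˢ g p μ) (1*ˢ g μ)

FF-zeroˡ : ∀ f g ν a b → slice (a , false) f ≈ 0ˢ → FF f g ν a b ≡ 0ℤ
FF-zeroˡ f g ν a b p = *ˢ-zeroˡ (slice (a , false) f) (slice (b , false) g) p ν

TF-zeroˡ : ∀ f g ν a b → slice (a , true) f ≈ 0ˢ → TF f g ν a b ≡ 0ℤ
TF-zeroˡ f g ν a b p = *ˢ-zeroˡ (slice (a , true) f) (slice (b , false) g) p ν

FT-zeroˡ : ∀ f g ν a b → slice (a , false) f ≈ 0ˢ → FT f g ν a b ≡ 0ℤ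
FT-zeroˡ f g ν a b p = *ˢ-zeroˡ (sgn• (slice (a , false) f)) (slice (b , true) g)
  (λ μ → trans (cong (ℤ._*_ (sgn μ)) (p μ)) (ℤ.*-zeroʳ (sgn μ))) ν

FF-zeroʳ : ∀ f g ν a b → slice (b , false) g ≈ 0ˢ → FF f g ν a b ≡ 0ℤ
FF-zeroʳ f g ν a b p = *ˢ-zeroʳ (slice (a , false) f) (slice (b , false) g) p ν

FT-zeroʳ : ∀ f g ν a b → slice (b , true) g ≈ 0ˢ → FT f g ν a b ≡ 0ℤ
FT-zeroʳ f g ν a b p = *ˢ-zeroʳ (sgn• (slice (a , false) f)) (slice (b , true) g) p ν

module _ (f : Series) (f≈0 : ∀ p → p ≢ (1 , false) → slice p f ≈ 0ˢ) (f≈1 : slice (1 , false) f ≈ 1ˢ) where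

  -- Multiplication by t shifts the exponent of the first variable; only the slice of exponent 1 of
  -- `f` survives in the convolution.
  t-slice-suc : ∀ F n b ν → (f *ˢ F) ((suc n , b) ∷ ν) ≡ F ((n , b) ∷ ν)
  t-slice-suc F n false ν = trans (*-slice-false f F (suc n) ν) (trans
    (conv-only-1 n (FF f F ν) (λ b → FF-zeroˡ f F ν 0 b (f≈0 _ λ ())) (λ a b → FF-zeroˡ f F ν (suc (suc a)) b (f≈0 _ λ ())))
    (≈1⇒*-identityˡ (slice (1 , false) f) (slice (n , false) F) f≈1 ν))
  t-slice-suc F n true ν = trans (*-slice-true f F (suc n) ν) (trans (cong₂ ℤ._+_
    (conv-zero (suc n) (λ a b → TF-zeroˡ f F ν a b (f≈0 _ λ ())))
    (trans (conv-only-1 n (FT f F ν) (λ b → FT-zeroˡ f F ν 0 b (f≈0 _ λ ())) (λ a b → FT-zeroˡ f F ν (suc (suc a)) b (f≈0 _ λ ())))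
    (≈1⇒*-identityˡ (sgn• (slice (1 , false) f)) (slice (n , true) F)
      (λ α → trans (cong (ℤ._*_ (sgn α)) (f≈1 α)) (1ˢ-even α)) ν)))
    (ℤ.+-identityˡ _))

  t-slice-zero : ∀ F b ν → (f *ˢ F) ((0 , b) ∷ ν) ≡ 0ℤ
  t-slice-zero F false ν = trans (*-slice-false f F 0 ν) (FF-zeroˡ f F ν 0 0 (f≈0 _ λ ()))
  t-slice-zero F true  ν = trans (*-slice-true f F 0 ν) (cong₂ ℤ._+_
    (TF-zeroˡ f F ν 0 0 (f≈0 _ λ ())) (FT-zeroˡ f F ν 0 0 (f≈0 _ λ ())))

module _ (f : Series) (f≈0 : ∀ p → p ≢ (0 , true) → slice p f ≈ 0ˢ) (f≈1 : slice (0 , true) f ≈ 1ˢ) where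

  -- No sign arises: τ is the left factor and also comes first in the order of the anticommuting
  -- variables.
  τ-slice-true : ∀ F n ν → (f *ˢ F) ((n , true) ∷ ν) ≡ F ((n , false) ∷ ν)
  τ-slice-true F n ν = trans (*-slice-true f F n ν) (trans (cong₂ ℤ._+_
    (trans (conv-only-0 n (TF f F ν) λ a b → TF-zeroˡ f F ν (suc a) b (f≈0 _ λ ()))
      (≈1⇒*-identityˡ (slice (0 , true) f) (slice (n , false) F) f≈1 ν))
    (conv-zero n λ a b → FT-zeroˡ f F ν a b (f≈0 _ λ ())))
    (ℤ.+-identityʳ _))

  τ-slice-false : ∀ F n ν → (f *ˢ F) ((n , false) ∷ ν) ≡ 0ℤ
  τ-slice-false F n ν = trans (*-slice-false f F n ν) (conv-zero n λ a b → FF-zeroˡ f F ν a b (f≈0 _ λ ()))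

δ-≢ : ∀ {p q} → p ≢ q → δ p q ≡ 0ℤ
δ-≢ {p} {q} ne rewrite dec-false (p ≟ᵉ q) ne = refl

slice-series-≢ : ∀ c p α q → q ≢ p → slice q (series (c , p ∷ α)) ≈ 0ˢ
slice-series-≢ c p α q ne μ = trans (series-∷ c p α q μ) (cong (ℤ._* series (c , α) μ) (δ-≢ (λ e → ne (sym e))))

slice-series-≡ : ∀ c p α → slice p (series (c , p ∷ α)) ≈ series (c , α)
slice-series-≡ c p α μ rewrite series-∷ c p α p μ | dec-true (p ≟ᵉ p) refl = ℤ.*-identityˡ _

comp : Bool → ℕ → Series → Series
comp b n F = [tτ^ n , b ] F

-- A series may take different values at `[]` and at `[ 0 , false ]`, and the component has its own
-- clause for `[]`; this is why the two values of `g` are compared separately.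
comp-ext : ∀ b n {F} {g : Series} → (∀ ν → F ((n , b) ∷ ν) ≡ g ((0 , false) ∷ ν)) →
           (∀ p → p ≢ (0 , false) → slice p g ≈ 0ˢ) → g [] ≡ g [ 0 , false ] → comp b n F ≈ g
comp-ext b n e z g₀ []                   = trans (e []) (sym g₀)
comp-ext b n e z g₀ ((zero , false) ∷ μ) = e μ
comp-ext b n e z g₀ ((zero , true) ∷ μ)  = sym (z _ (λ ()) μ)
comp-ext b n e z g₀ ((suc _ , _) ∷ μ)    = sym (z _ (λ ()) μ)

comp-slice-≢ : ∀ b n F p → p ≢ (0 , false) → slice p (comp b n F) ≈ 0ˢ
comp-slice-≢ b n F (zero , false)  ne μ = contradiction refl ne
comp-slice-≢ b n F (zero , true)   ne μ = refl
comp-slice-≢ b n F (suc _ , _)     ne μ = refl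

comp-cong : ∀ b n {F G} → F ≈ G → comp b n F ≈ comp b n G
comp-cong b n {F} {G} p = comp-ext b n {F} {comp b n G} (λ ν → p _) (comp-slice-≢ b n G) refl

comp-+ : ∀ b n F G → comp b n (F +ˢ G) ≈ comp b n F +ˢ comp b n G
comp-+ b n F G = comp-ext b n {F +ˢ G} {comp b n F +ˢ comp b n G} (λ ν → refl)
  (λ p ne ν → cong₂ ℤ._+_ (comp-slice-≢ b n F p ne ν) (comp-slice-≢ b n G p ne ν)) refl

comp-t-suc : ∀ b n F → comp b (suc n) (t *ˢ F) ≈ comp b n F
comp-t-suc b n F = comp-ext b (suc n) {t *ˢ F} {comp b n F}
  (t-slice-suc t (slice-series-≢ 1ℤ (1 , false) []) (slice-series-≡ 1ℤ (1 , false) []) F n b) (comp-slice-≢ b n F) refl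

comp-t-zero : ∀ b F → comp b 0 (t *ˢ F) ≈ 0ˢ
comp-t-zero b F = comp-ext b 0 {t *ˢ F} {0ˢ}
  (t-slice-zero t (slice-series-≢ 1ℤ (1 , false) []) (slice-series-≡ 1ℤ (1 , false) []) F b) (λ _ _ _ → refl) refl

comp-τ-true : ∀ n F → comp true n (τ *ˢ F) ≈ comp false n F
comp-τ-true n F = comp-ext true n {τ *ˢ F} {comp false n F}
  (τ-slice-true τ (slice-series-≢ 1ℤ (0 , true) []) (slice-series-≡ 1ℤ (0 , true) []) F n) (comp-slice-≢ false n F) refl

comp-τ-false : ∀ n F → comp false n (τ *ˢ F) ≈ 0ˢ
comp-τ-false n F = comp-ext false n {τ *ˢ F} {0ˢ}
  (τ-slice-false τ (slice-series-≢ 1ℤ (0 , true) []) (slice-series-≡ 1ℤ (0 , true) []) F n) (λ _ _ _ → refl) refl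

module _ (f : Series) (f≈0 : ∀ p → p ≢ (0 , false) → slice p f ≈ 0ˢ) (f₀ : f [] ≡ f [ 0 , false ]) where

  private
    free-slice : ∀ b n F p → p ≢ (0 , false) → slice p (f *ˢ comp b n F) ≈ 0ˢ
    free-slice b n F (zero , false)  ne ν = contradiction refl ne
    free-slice b n F (suc e , false) ne ν = trans (*-slice-false f (comp b n F) (suc e) ν)
      (trans (conv-only-0 (suc e) (FF f (comp b n F) ν) λ a c → FF-zeroˡ f (comp b n F) ν (suc a) c (f≈0 _ λ ()))
             (FF-zeroʳ f (comp b n F) ν 0 (suc e) (comp-slice-≢ b n F (suc e , false) λ ())))
    free-slice b n F (e , true)      ne ν = trans (*-slice-true f (comp b n F) e ν) (cong₂ ℤ._+_
      (conv-zero e λ a c → TF-zeroˡ f (comp b n F) ν a c (f≈0 _ λ ()))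
      (conv-zero e λ a c → FT-zeroʳ f (comp b n F) ν a c (comp-slice-≢ b n F (c , true) λ ())))

    free-[] : ∀ b n F → (f *ˢ comp b n F) [] ≡ (f *ˢ comp b n F) [ 0 , false ]
    free-[] b n F = cong (λ c → 1ℤ ℤ.* (c ℤ.* F [ n , b ]) ℤ.+ 0ℤ) f₀

  comp-false-* : ∀ n F → comp false n (f *ˢ F) ≈ f *ˢ comp false n F
  comp-false-* n F = comp-ext false n {f *ˢ F} {f *ˢ comp false n F} (λ ν → trans
    (trans (*-slice-false f F n ν) (conv-only-0 n (FF f F ν) λ a b → FF-zeroˡ f F ν (suc a) b (f≈0 _ λ ())))
    (sym (*-slice-false f (comp false n F) 0 ν)))
    (free-slice false n F) (free-[] false n F)

  -- τ has to be moved past f to reach the front, which is free of charge for even f. The odd φⱼ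
  -- never meets this situation: `comp-τ-true` strips the τ first, leaving a case of `comp-false-*`.
  comp-true-* : Even f → ∀ n F → comp true n (f *ˢ F) ≈ f *ˢ comp true n F
  comp-true-* even n F = comp-ext true n {f *ˢ F} {f *ˢ comp true n F} (λ ν → trans
    (trans (*-slice-true f F n ν) (trans (cong₂ ℤ._+_
      (conv-zero n λ a b → TF-zeroˡ f F ν a b (f≈0 _ λ ()))
      (trans (conv-only-0 n (FT f F ν) λ a b → FT-zeroˡ f F ν (suc a) b (f≈0 _ λ ()))
        (*ˢ-congˡ (sgn• (slice (0 , false) f)) (slice (0 , false) f) (slice (n , true) F) (λ α → even ((0 , false) ∷ α)) ν)))
      (ℤ.+-identityˡ _)))
    (sym (*-slice-false f (comp true n F) 0 ν)))
    (free-slice true n F) (free-[] true n F)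

comp-even : ∀ n {F} → Even F → Even (comp false n F)
comp-even n even []                   = even [ n , false ]
comp-even n even ((zero , false) ∷ μ) = even ((n , false) ∷ μ)
comp-even n even ((zero , true) ∷ μ)  = ℤ.*-zeroʳ (sgn ((0 , true) ∷ μ))
comp-even n even ((suc k , b) ∷ μ)    = ℤ.*-zeroʳ (sgn ((suc k , b) ∷ μ))

sgn-true : ∀ n (F : Series) μ → sgn ((n , true) ∷ μ) ℤ.* F ((n , true) ∷ μ) ≡ F ((n , true) ∷ μ) →
           sgn μ ℤ.* F ((n , true) ∷ μ) ≡ ℤ.- F ((n , true) ∷ μ)
sgn-true n F μ e = trans (sym (ℤ.neg-involutive _))
  (cong ℤ.-_ (trans (sym (ℤ.-1*i≡-i _)) (trans (sym (ℤ.*-assoc -1ℤ (sgn μ) _)) e)))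

-- Stripping τ from a monomial changes its parity.
comp-odd : ∀ n {F} → Even F → Odd (comp true n F)
comp-odd n {F} even []                   = sgn-true n F [] (even [ n , true ])
comp-odd n {F} even ((zero , false) ∷ μ) = sgn-true n F μ (even ((n , true) ∷ μ))
comp-odd n     even ((zero , true) ∷ μ)  = ℤ.*-zeroʳ (sgn ((0 , true) ∷ μ))
comp-odd n     even ((suc k , b) ∷ μ)    = ℤ.*-zeroʳ (sgn ((suc k , b) ∷ μ))

-- Monomials multiply as series the way they do as terms

infixl 6 _⊕_
_⊕_ : Entry → Entry → Entry
(d , a) ⊕ (e , b) = d ℕ.+ e , a ∨ b

conv-point : ∀ n k (F : ℕ → ℕ → ℤ) → (∀ a b → (a , b) ≢ (n , k) → F a b ≡ 0ℤ) → conv (n ℕ.+ k) F ≡ F n k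
conv-point n zero F p rewrite ℕ.+-identityʳ n with n
... | zero  = refl
... | suc m = trans (cong (ℤ._+_ (F (suc m) 0)) (conv-zero m λ a b → p a (suc b) λ ())) (ℤ.+-identityʳ _)
conv-point n (suc k) F p rewrite ℕ.+-suc n k = trans (cong₂ ℤ._+_ (p (suc (n ℕ.+ k)) 0 λ ())
  (conv-point n k (λ a b → F a (suc b)) λ a b ne → p a (suc b) λ { refl → ne refl })) (ℤ.+-identityˡ _)

VanishesOff : Entry → Entry → (Entry → Entry → ℤ) → Set
VanishesOff p r F = ∀ a b → a ≢ p ⊎ b ≢ r → F a b ≡ 0ℤ

convE-point-≢ : ∀ p r q F → VanishesOff p r F → p ⊕ r ≢ q → convE q F ≡ 0ℤ
convE-point-≢ p r q F v ne = trans (sym (∑-splitEntry q F)) (∑-zero (All.map (λ {s} → vanish s) (splitEntry-∙ q)))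
  where
  vanish : ∀ s → (proj₁ (proj₁ s) ℕ.+ proj₁ (proj₂ s) , proj₂ (proj₁ s) ∨ proj₂ (proj₂ s)) ≡ q ×
                 bit (proj₂ (proj₁ s)) ℕ.+ bit (proj₂ (proj₂ s)) ≡ bit (proj₂ q) → uncurry F s ≡ 0ℤ
  vanish (a , b) (e , _) with a ≟ᵉ p | b ≟ᵉ r
  ... | no a≢p   | _        = v a b (inj₁ a≢p)
  ... | yes _    | no b≢r   = v a b (inj₂ b≢r)
  ... | yes refl | yes refl = contradiction e ne

bothTrue : Entry → Entry → Bool
bothTrue (_ , true) (_ , true) = true
bothTrue _          _          = false

-- If both bits were set, `p ⊕ r` would contain a single ζ and (p , r) would not be among its
-- factorisations.
convE-point-≡ : ∀ p r F → VanishesOff p r F → bothTrue p r ≡ false → convE (p ⊕ r) F ≡ F p r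
convE-point-≡ (n , false) (k , false) F v _ = conv-point n k _ λ a b ne → off a b ne
  where
  off : ∀ a b → (a , b) ≢ (n , k) → F (a , false) (b , false) ≡ 0ℤ
  off a b ne with a ℕ.≟ n
  ... | no a≢n   = v _ _ (inj₁ λ { refl → a≢n refl })
  ... | yes refl = v _ _ (inj₂ λ { refl → ne refl })
convE-point-≡ (n , true) (k , false) F v _ = trans (cong₂ ℤ._+_ (conv-point n k _ λ a b ne → off a b ne)
  (conv-zero (n ℕ.+ k) λ a b → v _ _ (inj₁ λ ()))) (ℤ.+-identityʳ _)
  where
  off : ∀ a b → (a , b) ≢ (n , k) → F (a , true) (b , false) ≡ 0ℤ
  off a b ne with a ℕ.≟ n
  ... | no a≢n   = v _ _ (inj₁ λ { refl → a≢n refl })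
  ... | yes refl = v _ _ (inj₂ λ { refl → ne refl })
convE-point-≡ (n , false) (k , true) F v _ = trans (cong₂ ℤ._+_
  (conv-zero (n ℕ.+ k) λ a b → v _ _ (inj₂ λ ())) (conv-point n k _ λ a b ne → off a b ne)) (ℤ.+-identityˡ _)
  where
  off : ∀ a b → (a , b) ≢ (n , k) → F (a , false) (b , true) ≡ 0ℤ
  off a b ne with a ℕ.≟ n
  ... | no a≢n   = v _ _ (inj₁ λ { refl → a≢n refl })
  ... | yes refl = v _ _ (inj₂ λ { refl → ne refl })

⟦_⟧ : Mon → Series
⟦ α ⟧ = series (1ℤ , α)

series-• : ∀ c α → series (c , α) ≈ c • ⟦ α ⟧
series-• c α μ with norm α ≟ᵐ norm μ
... | yes _ = sym (ℤ.*-identityʳ c)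
... | no  _ = sym (ℤ.*-zeroʳ c)

-- At q ∷ μ the product is a convolution concentrated at (p , r), so it vanishes unless q is
-- `p ⊕ r`, and there the tails multiply by induction. If p and r share their ζ, the sign kills
-- every summand.
⟦⟧-* : ∀ α β μ → (⟦ α ⟧ *ˢ ⟦ β ⟧) μ ≡ ε α β ℤ.* ⟦ α ∙ β ⟧ μ
⟦⟧-* []      β       μ       = trans (1*ˢ ⟦ β ⟧ μ) (sym (ℤ.*-identityˡ _))
⟦⟧-* (p ∷ α) []      μ       = trans (*-identityʳ ⟦ p ∷ α ⟧ μ) (sym (ℤ.*-identityˡ _))
⟦⟧-* (p ∷ α) (r ∷ β) μ       = cases μ
  where
  inner : Mon → Entry → Entry → ℤ
  inner μ a b = convS μ (λ σ τ → ε (a ∷ σ) (b ∷ τ) ℤ.* (⟦ p ∷ α ⟧ (a ∷ σ) ℤ.* ⟦ r ∷ β ⟧ (b ∷ τ)))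

  inner-off : ∀ μ → VanishesOff p r (inner μ)
  inner-off μ a b (inj₁ a≢p) = trans (convS-cong μ λ σ τ →
    trans (cong (λ c → ε (a ∷ σ) (b ∷ τ) ℤ.* (c ℤ.* ⟦ r ∷ β ⟧ (b ∷ τ))) (slice-series-≢ 1ℤ p α a a≢p σ))
          (ℤ.*-zeroʳ (ε (a ∷ σ) (b ∷ τ)))) (∑-0 (splits μ))
  inner-off μ a b (inj₂ b≢r) = trans (convS-cong μ λ σ τ →
    trans (cong (λ c → ε (a ∷ σ) (b ∷ τ) ℤ.* (⟦ p ∷ α ⟧ (a ∷ σ) ℤ.* c)) (slice-series-≢ 1ℤ r β b b≢r τ))
    (trans (cong (ℤ._*_ (ε (a ∷ σ) (b ∷ τ))) (ℤ.*-zeroʳ (⟦ p ∷ α ⟧ (a ∷ σ)))) (ℤ.*-zeroʳ (ε (a ∷ σ) (b ∷ τ))))) (∑-0 (splits μ))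

  inner-on : ∀ μ → inner μ p r ≡ convS μ (λ σ τ → ε (p ∷ σ) (r ∷ τ) ℤ.* (⟦ α ⟧ σ ℤ.* ⟦ β ⟧ τ))
  inner-on μ = convS-cong μ λ σ τ → cong (ℤ._*_ (ε (p ∷ σ) (r ∷ τ)))
    (cong₂ ℤ._*_ (slice-series-≡ 1ℤ p α σ) (slice-series-≡ 1ℤ r β τ))

  sum-on : ∀ p r μ → convS μ (λ σ τ → ε (p ∷ σ) (r ∷ τ) ℤ.* (⟦ α ⟧ σ ℤ.* ⟦ β ⟧ τ)) ≡ ε (p ∷ α) (r ∷ β) ℤ.* ⟦ α ∙ β ⟧ μ
  sum-on (_ , false) (_ , false) μ = ⟦⟧-* α β μ
  sum-on (_ , true)  (_ , false) μ = ⟦⟧-* α β μ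
  sum-on (_ , true)  (_ , true)  μ = ∑-0 (splits μ)
  sum-on (_ , false) (_ , true)  μ = trans (convS-cong μ λ σ τ →
      trans (lemma (sgn σ) (ε σ τ) (⟦ α ⟧ σ) (⟦ β ⟧ τ))
      (trans (cong (λ c → ε σ τ ℤ.* (c ℤ.* ⟦ β ⟧ τ)) (series-sgn (1ℤ , α) σ)) (lemma′ (ε σ τ) (sgn α) (⟦ α ⟧ σ) (⟦ β ⟧ τ))))
    (trans (∑-*ˡ (sgn α) _ (splits μ)) (trans (cong (ℤ._*_ (sgn α)) (⟦⟧-* α β μ)) (sym (ℤ.*-assoc (sgn α) _ _))))
    where
    lemma : ∀ a b c d → (a ℤ.* b) ℤ.* (c ℤ.* d) ≡ b ℤ.* ((a ℤ.* c) ℤ.* d)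
    lemma = solve-∀
    lemma′ : ∀ b a c d → b ℤ.* ((a ℤ.* c) ℤ.* d) ≡ a ℤ.* (b ℤ.* (c ℤ.* d))
    lemma′ = solve-∀

  both : bothTrue p r ≡ true → ∀ c → ε (p ∷ α) (r ∷ β) ℤ.* c ≡ 0ℤ
  both e c = go p r e
    where
    go : ∀ p r → bothTrue p r ≡ true → ε (p ∷ α) (r ∷ β) ℤ.* c ≡ 0ℤ
    go (_ , true)  (_ , true)  _ = refl
    go (_ , false) (_ , _)     ()
    go (_ , true)  (_ , false) ()

  cons : ∀ q μ → (⟦ p ∷ α ⟧ *ˢ ⟦ r ∷ β ⟧) (q ∷ μ) ≡ ε (p ∷ α) (r ∷ β) ℤ.* ⟦ p ⊕ r ∷ α ∙ β ⟧ (q ∷ μ)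
  cons q μ with p ⊕ r ≟ᵉ q
  ... | no ne = trans (convS-∷ q μ _) (trans (convE-point-≢ p r q (inner μ) (inner-off μ) ne)
    (sym (trans (cong (ℤ._*_ (ε (p ∷ α) (r ∷ β))) (slice-series-≢ 1ℤ (p ⊕ r) (α ∙ β) q (λ e → ne (sym e)) μ))
                (ℤ.*-zeroʳ (ε (p ∷ α) (r ∷ β))))))
  ... | yes refl with bothTrue p r in eq
  ... | false = trans (convS-∷ q μ _) (trans (convE-point-≡ p r (inner μ) (inner-off μ) eq)
    (trans (inner-on μ) (trans (sum-on p r μ)
      (cong (ℤ._*_ (ε (p ∷ α) (r ∷ β))) (sym (slice-series-≡ 1ℤ (p ⊕ r) (α ∙ β) μ))))))
  ... | true = trans (convS-∷ q μ _) (trans (zero-sum μ) (sym (both eq _)))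
    where
    zero-sum : ∀ μ → convE q (inner μ) ≡ 0ℤ
    zero-sum μ = trans (convE-cong q λ a b → inner-zero a b) (trans (sym (∑-splitEntry q (λ _ _ → 0ℤ))) (∑-0 (splitEntry q)))
      where
      inner-zero : ∀ a b → inner μ a b ≡ 0ℤ
      inner-zero a b with a ≟ᵉ p | b ≟ᵉ r
      ... | no a≢p   | _        = inner-off μ a b (inj₁ a≢p)
      ... | yes _    | no b≢r   = inner-off μ a b (inj₂ b≢r)
      ... | yes refl | yes refl = trans (inner-on μ) (trans (sum-on p r μ) (both eq _))

  -- The coefficients at [] and [ 0 , false ] agree by definition.
  cases : ∀ μ → (⟦ p ∷ α ⟧ *ˢ ⟦ r ∷ β ⟧) μ ≡ ε (p ∷ α) (r ∷ β) ℤ.* ⟦ p ⊕ r ∷ α ∙ β ⟧ μ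
  cases []      = cons (0 , false) []
  cases (q ∷ μ) = cons q μ

series-* : ∀ S T → series (S *ᵗ T) ≈ series S *ˢ series T
series-* (c , α) (d , β) μ = begin
  series (ε α β ℤ.* (c ℤ.* d) , α ∙ β) μ
    ≡⟨ series-• (ε α β ℤ.* (c ℤ.* d)) (α ∙ β) μ ⟩
  (ε α β ℤ.* (c ℤ.* d)) ℤ.* ⟦ α ∙ β ⟧ μ
    ≡⟨ lemma (ε α β) (c ℤ.* d) (⟦ α ∙ β ⟧ μ) ⟩
  (c ℤ.* d) ℤ.* (ε α β ℤ.* ⟦ α ∙ β ⟧ μ)
    ≡⟨ cong (ℤ._*_ (c ℤ.* d)) (⟦⟧-* α β μ) ⟨
  (c ℤ.* d) ℤ.* (⟦ α ⟧ *ˢ ⟦ β ⟧) μ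
    ≡⟨ ∑-*ˡ (c ℤ.* d) _ (splits μ) ⟨
  convS μ (λ σ τ → (c ℤ.* d) ℤ.* (ε σ τ ℤ.* (⟦ α ⟧ σ ℤ.* ⟦ β ⟧ τ)))
    ≡⟨ convS-cong μ (λ σ τ → trans (lemma′ c d (ε σ τ) (⟦ α ⟧ σ) (⟦ β ⟧ τ))
         (cong (ℤ._*_ (ε σ τ)) (sym (cong₂ ℤ._*_ (series-• c α σ) (series-• d β τ))))) ⟩
  (series (c , α) *ˢ series (d , β)) μ ∎
  where
  open ≡-Reasoning
  lemma : ∀ a b c → (a ℤ.* b) ℤ.* c ≡ b ℤ.* (a ℤ.* c)
  lemma = solve-∀
  lemma′ : ∀ c d e a b → (c ℤ.* d) ℤ.* (e ℤ.* (a ℤ.* b)) ≡ e ℤ.* ((c ℤ.* a) ℤ.* (d ℤ.* b))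
  lemma′ = solve-∀

-- The expansion of the kernel

i≡-i⇒i≡0 : ∀ i → i ≡ ℤ.- i → i ≡ 0ℤ
i≡-i⇒i≡0 (+ zero)  _ = refl
i≡-i⇒i≡0 (+ suc _) ()
i≡-i⇒i≡0 -[1+ _ ]  ()

superQuotient : Ideal → SuperRing
superQuotient I = record
  { ring         = quotient I
  ; Even         = Even
  ; Odd          = Odd
  ; even-comm    = λ g e → on λ {μ} _ → even-comm g e μ
  ; odd-anticomm = λ o o′ → on λ {μ} _ → odd-anticomm o o′ μ
  ; odd-square   = λ o → on λ {μ} _ → i≡-i⇒i≡0 _ (odd-anticomm o o μ)
  ; 1-even       = 1ˢ-even
  ; *-even       = *-even
  ; odd*odd-even = odd*odd-even
  }

-- The quotient is the full ring of series, in which the generating function is unfolded before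
-- components are taken.
zeroIdeal : Ideal
zeroIdeal = record { Supp = λ _ → ⊤ ; Supp-splits = λ _ → All.universal (λ _ → tt , tt) _ }

truncation : ℕ → ℕ → Ideal
truncation N D = record
  { Supp        = λ μ → length μ ≤ N × degree μ ≤ D
  ; Supp-splits = λ {μ} (l , d) → All.zipWith (λ {(α , β)} ((e , e′) , f) →
      (ℕ.≤-trans (ℕ.≤-reflexive e) l , ℕ.≤-trans (subst (degree α ≤_) f (ℕ.m≤m+n (degree α) (degree β))) d) ,
      (ℕ.≤-trans (ℕ.≤-reflexive e′) l , ℕ.≤-trans (subst (degree β ≤_) f (ℕ.m≤n+m (degree β) (degree α))) d))
      (splits-length μ , splits-degree μ)
  }

x-even : ∀ i → Even (x i)
x-even i = z-even (Alphabet.index X i)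

θ-odd : ∀ i → Odd (θ i)
θ-odd i = ζ-odd (Alphabet.index X i)

y-even : ∀ j → Even (y j)
y-even j = z-even (Alphabet.index Y j)

φ-odd : ∀ j → Odd (φ j)
φ-odd j = ζ-odd (Alphabet.index Y j)

-- Recursions for h and h̃ in finitely many variables

G : ℕ → Series
G J = ∏< J (generatingFactor Y)

hᴳ h̃ᴳ : ℕ → ℕ → Series
hᴳ J n = comp false n (G J)
h̃ᴳ J n = comp true n (G J)

generatingFactor-even : ∀ A i → Even (generatingFactor A i)
generatingFactor-even A i = ⁻¹-even (-ˢ-even (-ˢ-even 1ˢ-even (*-even (z-even 0) (z-even (Alphabet.index A i))))
  (odd*odd-even (ζ-odd 0) (ζ-odd (Alphabet.index A i))))

generatingFunction-even : ∀ A → Even (generatingFunction A)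
generatingFunction-even A μ = ∏<-even (length μ) (generatingFactor-even A) μ

h-even : ∀ A n → Even (h A n)
h-even A n = comp-even n {generatingFunction A} (generatingFunction-even A)

h̃-odd : ∀ A n → Odd (h̃ A n)
h̃-odd A n = comp-odd n {generatingFunction A} (generatingFunction-even A)

G-suc : ∀ J → G (suc J) ≈ (G J +ˢ t *ˢ (y J *ˢ G (suc J))) +ˢ τ *ˢ (φ J *ˢ G (suc J))
G-suc J μ = trans (at (peel (G J) ty-even τφ-even (on λ {ν} _ → generatingFactor-inverse Y J ν)) {μ} tt)
  (cong₂ (λ a b → G J μ ℤ.+ a ℤ.+ b) (*-assoc t (y J) (G (suc J)) μ) (*-assoc τ (φ J) (G (suc J)) μ))
  where
  open SuperRingProperties (superQuotient zeroIdeal)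
  ty-even : Even (t *ˢ y J)
  ty-even = *-even (z-even 0) (y-even J)
  τφ-even : Even (τ *ˢ φ J)
  τφ-even = odd*odd-even (ζ-odd 0) (φ-odd J)

comp-G-suc : ∀ b n J → comp b n (G (suc J)) ≈
  (comp b n (G J) +ˢ comp b n (t *ˢ (y J *ˢ G (suc J)))) +ˢ comp b n (τ *ˢ (φ J *ˢ G (suc J)))
comp-G-suc b n J μ = trans (comp-cong b n {G (suc J)} (G-suc J) μ)
  (trans (comp-+ b n (G J +ˢ t *ˢ (y J *ˢ G (suc J))) (τ *ˢ (φ J *ˢ G (suc J))) μ)
  (cong (ℤ._+ comp b n (τ *ˢ (φ J *ˢ G (suc J))) μ) (comp-+ b n (G J) (t *ˢ (y J *ˢ G (suc J))) μ)))

y-slice : ∀ J p → p ≢ (0 , false) → slice p (y J) ≈ 0ˢ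
y-slice J = slice-series-≢ 1ℤ (0 , false) (replicate (suc (J ℕ.+ J)) (0 , false) ++ [ 1 , false ])

φ-slice : ∀ J p → p ≢ (0 , false) → slice p (φ J) ≈ 0ˢ
φ-slice J = slice-series-≢ 1ℤ (0 , false) (replicate (suc (J ℕ.+ J)) (0 , false) ++ [ 0 , true ])

-- This and the next three are the components of `G-suc`; they generalise hₙ(y₁,...,yⱼ₊₁) =
-- hₙ(y₁,...,yⱼ) + yⱼ₊₁ hₙ₋₁(y₁,...,yⱼ₊₁) and are exactly the hypotheses of `Row`.
hᴳ-zero : ∀ J → hᴳ (suc J) 0 ≈ hᴳ J 0
hᴳ-zero J μ = trans (comp-G-suc false 0 J μ) (trans
  (cong₂ (λ a b → hᴳ J 0 μ ℤ.+ a ℤ.+ b) (comp-t-zero false (y J *ˢ G (suc J)) μ) (comp-τ-false 0 (φ J *ˢ G (suc J)) μ))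
  (trans (ℤ.+-identityʳ _) (ℤ.+-identityʳ _)))

hᴳ-suc : ∀ J n → hᴳ (suc J) (suc n) ≈ hᴳ J (suc n) +ˢ y J *ˢ hᴳ (suc J) n
hᴳ-suc J n μ = trans (comp-G-suc false (suc n) J μ) (trans
  (cong₂ (λ a b → hᴳ J (suc n) μ ℤ.+ a ℤ.+ b)
    (trans (comp-t-suc false n (y J *ˢ G (suc J)) μ) (comp-false-* (y J) (y-slice J) refl n (G (suc J)) μ))
    (comp-τ-false (suc n) (φ J *ˢ G (suc J)) μ))
  (ℤ.+-identityʳ _))

h̃ᴳ-zero : ∀ J → h̃ᴳ (suc J) 0 ≈ h̃ᴳ J 0 +ˢ φ J *ˢ hᴳ (suc J) 0
h̃ᴳ-zero J μ = trans (comp-G-suc true 0 J μ) (cong₂ ℤ._+_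
  (trans (cong (ℤ._+_ (h̃ᴳ J 0 μ)) (comp-t-zero true (y J *ˢ G (suc J)) μ)) (ℤ.+-identityʳ (h̃ᴳ J 0 μ)))
  (trans (comp-τ-true 0 (φ J *ˢ G (suc J)) μ) (comp-false-* (φ J) (φ-slice J) refl 0 (G (suc J)) μ)))

h̃ᴳ-suc : ∀ J n → h̃ᴳ (suc J) (suc n) ≈ (h̃ᴳ J (suc n) +ˢ y J *ˢ h̃ᴳ (suc J) n) +ˢ φ J *ˢ hᴳ (suc J) (suc n)
h̃ᴳ-suc J n μ = trans (comp-G-suc true (suc n) J μ) (cong₂ ℤ._+_
  (cong (ℤ._+_ (h̃ᴳ J (suc n) μ)) (trans (comp-t-suc true n (y J *ˢ G (suc J)) μ)
    (comp-true-* (y J) (y-slice J) refl (y-even J) n (G (suc J)) μ)))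
  (trans (comp-τ-true (suc n) (φ J *ˢ G (suc J)) μ) (comp-false-* (φ J) (φ-slice J) refl (suc n) (G (suc J)) μ)))

series-[]-slice : ∀ p → p ≢ (0 , false) → slice p 1ˢ ≈ 0ˢ
series-[]-slice = slice-series-≢ 1ℤ (0 , false) []

hᴳ-0-0 : hᴳ 0 0 ≈ 1ˢ
hᴳ-0-0 = comp-ext false 0 {1ˢ} {1ˢ} (λ ν → refl) series-[]-slice refl

comp-1-zero : ∀ b n → (n , b) ≢ (0 , false) → comp b n 1ˢ ≈ 0ˢ
comp-1-zero b n ne = comp-ext b n {1ˢ} {0ˢ} (series-[]-slice (n , b) ne) (λ _ _ _ → refl) refl

hᴳ-0 : ∀ J → hᴳ J 0 ≈ 1ˢ
hᴳ-0 zero    = hᴳ-0-0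
hᴳ-0 (suc J) μ = trans (hᴳ-zero J μ) (hᴳ-0 J μ)

-- The component at `[]` is a coefficient at `[ n , b ]`, of length 1, for which
-- `generating-convergent` speaks only from one factor on; hence `suc J`.
comp-generatingFunction : ∀ b n J → comp b n (generatingFunction Y) ≈[ J ] comp b n (G (suc J))
comp-generatingFunction b n J = λ where
    []                   l → stable [ n , b ] (s≤s z≤n)
    ((zero , false) ∷ μ) l → stable ((n , b) ∷ μ) (ℕ.m≤n⇒m≤1+n l)
    ((zero , true) ∷ μ)  l → refl
    ((suc _ , _) ∷ μ)    l → refl
  where
  stable : ∀ ν → length ν ≤ suc J → generatingFunction Y ν ≡ G (suc J) ν
  stable ν l = sym (proj₂ (generating-convergent Y ν) (suc J) l)

-- The truncated kernel as a finite sum over words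

module Truncated (N D : ℕ) where
  I : Ideal
  I = truncation N D

  open SuperRing (superQuotient I) using () renaming (_≈_ to _∼_; *-cong to ∼-*-cong; *-congˡ to ∼-*-congˡ; *-congʳ to ∼-*-congʳ; refl to ∼-refl; sym to ∼-sym; trans to ∼-trans; reflexive to ∼-reflexive) public
  open SuperRingProperties (superQuotient I) public
  open Factors x θ (h Y) (h̃ Y) x-even θ-odd (h-even Y) (h̃-odd Y) public

  ≈⇒∼ : ∀ {f g} → f ≈ g → f ∼ g
  ≈⇒∼ p = on λ {μ} _ → p μ

  ≈[]⇒∼ : ∀ {f g} → f ≈[ N ] g → f ∼ g
  ≈[]⇒∼ p = on λ {μ} (l , _) → p μ l

  ^≡^ˢ : ∀ f k → f ^ k ≡ f ^ˢ k
  ^≡^ˢ f zero    = refl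
  ^≡^ˢ f (suc k) = cong (_*ˢ f) (^≡^ˢ f k)

  x^1+D≈0 : ∀ i n → D < n → x i ^ n ∼ 0ˢ
  x^1+D≈0 i n D<n = on λ {μ} (_ , d) → trans (cong (λ f → f μ) (^≡^ˢ (x i) n))
    (power-vanishes (x i) (z-constant (Alphabet.index X i)) n μ (ℕ.≤-<-trans d D<n))

  module RowStep (i J : ℕ) = Row (x i) (θ i) (y J) (φ J) (x-even i) (θ-odd i) (y-even J) (φ-odd J)
    (hᴳ J) (h̃ᴳ J) (hᴳ (suc J)) (h̃ᴳ (suc J)) (≈⇒∼ (hᴳ-zero J)) (λ n → ≈⇒∼ (hᴳ-suc J n)) (≈⇒∼ (h̃ᴳ-zero J)) (λ n → ≈⇒∼ (h̃ᴳ-suc J n))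

  row-expand : ∀ i J → ∏< J (kernelFactor i) ∼ RowStep.S i J (suc D)
  row-expand i zero    = ∼-sym (RowStep.trivial-row i 0 D (≈⇒∼ hᴳ-0-0)
    (λ n → ≈⇒∼ (comp-1-zero false (suc n) λ ())) (λ n → ≈⇒∼ (comp-1-zero true n λ ())))
  -- The primed sum for J and the unprimed sum for `suc J` are the same by definition, so
  -- `geometric` is the whole induction step.
  row-expand i (suc J) = ∼-trans (∼-*-congʳ (row-expand i J))
    (∼-sym (RowStep.geometric i J D (kernelFactor i J) (x^1+D≈0 i (suc D) ℕ.≤-refl) (≈⇒∼ (kernelFactor-inverse i J))))

  exponents : List Entry
  exponents = cartesianProduct (upTo (suc D)) (false ∷ true ∷ [])

  row : ∀ i → ∏< (suc N) (kernelFactor i) ∼ ∑ᴿ exponents (factor i)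
  row i = ∼-trans (row-expand i (suc N)) (∑-factor (hᴳ (suc N)) (h̃ᴳ (suc N))
    (λ n → ∼-sym (≈[]⇒∼ (comp-generatingFunction false n N)))
    (λ n → ∼-sym (≈[]⇒∼ (comp-generatingFunction true n N))) (suc D) i)

  h-0 : h Y 0 ∼ 1ˢ
  h-0 = ∼-trans (≈[]⇒∼ (comp-generatingFunction false 0 N)) (≈⇒∼ (hᴳ-0 (suc N)))

  ∏<-∏ : ∀ n F → ∏< n F ∼ ∏ (map F (upTo n))
  ∏<-∏ zero    F = ∼-refl
  ∏<-∏ (suc n) F = ∼-trans (∼-*-congʳ {F n} {∏< n F} {∏ (map F (upTo n))} (∏<-∏ n F)) (∼-sym (∏-map-upTo-suc F n))

  ∏<-cong∼ : ∀ n {F F′} → (∀ i → F i ∼ F′ i) → ∏< n F ∼ ∏< n F′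
  ∏<-cong∼ zero    p = ∼-refl
  ∏<-cong∼ (suc n) p = ∼-*-cong (∏<-cong∼ n p) (p n)

  ∑ᴿ-at : ∀ {A : Set} (as : List A) F μ → ∑ᴿ as F μ ≡ ∑ as (λ a → F a μ)
  ∑ᴿ-at []       F μ = refl
  ∑ᴿ-at (a ∷ as) F μ = cong (ℤ._+_ (F a μ)) (∑ᴿ-at as F μ)

  monomials : List (List Entry)
  monomials = words exponents N

  kernel-expand : kernelPartial N ∼ ∑ᴿ monomials (λ w → ∏ (zipWith factor (upTo N) w))
  -- `row` has `suc N` factors because of `comp-generatingFunction`; the additional factor is
  -- trivial up to length N.
  kernel-expand = ∼-trans (≈[]⇒∼ (∏<-cong N λ i μ l →
      sym (∏<-stable′ (kernelFactor i) (kernelFactor-trivialʳ i) (ℕ.n≤1+n N) μ l)))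
    (∼-trans (∏<-cong∼ N row) (∼-trans (∏<-∏ N (λ i → ∑ᴿ exponents (factor i)))
    (∼-trans (∏-∑ factor exponents (upTo N))
    (∼-reflexive (cong (λ k → ∑ᴿ (words exponents k) (λ w → ∏ (zipWith factor (upTo N) w))) (List.length-upTo N))))))

-- Finite lists and permutations

∑-single : ∀ {A : Set} {f : A → ℤ} {as : List A} {a} → Unique as → a ∈ as →
           (∀ {b} → b ∈ as → b ≢ a → f b ≡ 0ℤ) → ∑ as f ≡ f a
∑-single {f = f} (u ∷ us) (here refl) p = trans (cong (ℤ._+_ (f _))
  (∑-zero (All.tabulate λ b∈ → p (there b∈) λ { refl → All.lookup u b∈ refl }))) (ℤ.+-identityʳ _)
∑-single {f = f} (u ∷ us) (there a∈)  p = trans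
  (cong₂ ℤ._+_ (p (here refl) (All.lookup u a∈)) (∑-single us a∈ λ b∈ → p (there b∈))) (ℤ.+-identityˡ _)

-- Each head occurs in the other list. If neither is the head there, each precedes the other, and
-- antisymmetry identifies them.
sorted-↭⇒≡ : ∀ {A : Set} {R : A → A → Set} → (∀ {a b} → R a b → R b a → a ≡ b) →
             ∀ {as bs} → AllPairs R as → AllPairs R bs → as ↭ bs → as ≡ bs
sorted-↭⇒≡ antisym []       ss       p = sym (↭.↭-empty-inv (↭-sym p))
sorted-↭⇒≡ antisym (r ∷ rs) []       p with () ← ↭.↭-empty-inv p
sorted-↭⇒≡ {R = R} antisym {a ∷ as} {b ∷ bs} (r ∷ rs) (s ∷ ss) p = go a≡b
  where
  a≡b : a ≡ b
  a≡b with ↭.∈-resp-↭ p (here refl) | ↭.∈-resp-↭ (↭-sym p) (here refl)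
  ... | here e   | _        = e
  ... | there _  | here e   = sym e
  ... | there a∈ | there b∈ = antisym (All.lookup r b∈) (All.lookup s a∈)
  go : a ≡ b → a ∷ as ≡ b ∷ bs
  go refl = cong (a ∷_) (sorted-↭⇒≡ antisym rs ss (↭.drop-∷ p))

insertions-↭ : ∀ {A : Set} {a : A} bs {cs} → cs ∈ insertions a bs → cs ↭ a ∷ bs
insertions-↭ []       (here refl) = ↭-refl
insertions-↭ (b ∷ bs) (here refl) = ↭-refl
insertions-↭ (b ∷ bs) (there cs∈) with ∈-map⁻ (b ∷_) cs∈
... | ds , ds∈ , refl = ↭-trans (prep b (insertions-↭ bs ds∈)) (swap b _ ↭-refl)

permutations-↭ : ∀ {A : Set} (as : List A) {bs} → bs ∈ permutations as → bs ↭ as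
permutations-↭ []       (here refl) = ↭-refl
permutations-↭ (a ∷ as) bs∈ with find (∈-concatMap⁻ (insertions a) {xs = permutations as} bs∈)
... | cs , cs∈ , bs∈′ = ↭-trans (insertions-↭ cs bs∈′) (prep a (permutations-↭ as cs∈))

insertions-∈ : ∀ {A : Set} (a : A) bs cs → bs ++ a ∷ cs ∈ insertions a (bs ++ cs)
insertions-∈ a []       []       = here refl
insertions-∈ a []       (c ∷ cs) = here refl
insertions-∈ a (b ∷ bs) cs       = there (∈-map⁺ (b ∷_) (insertions-∈ a bs cs))

permutations-∈ : ∀ {A : Set} (as : List A) {bs} → bs ↭ as → bs ∈ permutations as
permutations-∈ []       p rewrite ↭.↭-empty-inv p = here refl
permutations-∈ (a ∷ as) p with ∈-∃++ (↭.∈-resp-↭ (↭-sym p) (here refl))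
... | xs , ys , refl = ∈-concatMap⁺ (insertions a) (Any.map (λ { refl → insertions-∈ a xs ys })
  (permutations-∈ as (↭.drop-mid xs [] p)))

applyUpTo-++ : ∀ {A : Set} (f : ℕ → A) m n → applyUpTo f (m ℕ.+ n) ≡ applyUpTo f m ++ applyUpTo (λ i → f (m ℕ.+ i)) n
applyUpTo-++ f zero    n = refl
applyUpTo-++ f (suc m) n = cong (f 0 ∷_) (applyUpTo-++ (f ∘ suc) m n)

zip-++ : ∀ {A B : Set} (as : List A) (bs : List B) {as′ bs′} → length as ≡ length bs →
         zip (as ++ as′) (bs ++ bs′) ≡ zip as bs ++ zip as′ bs′
zip-++ []       []       e = refl
zip-++ (a ∷ as) (b ∷ bs) e = cong ((a , b) ∷_) (zip-++ as bs (ℕ.suc-injective e))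

zip-unzip : ∀ {A B : Set} (ps : List (A × B)) → zip (map proj₁ ps) (map proj₂ ps) ≡ ps
zip-unzip []       = refl
zip-unzip (p ∷ ps) = cong (p ∷_) (zip-unzip ps)

map-proj₁-zip : ∀ {A B : Set} (as : List A) (bs : List B) → length as ≡ length bs → map proj₁ (zip as bs) ≡ as
map-proj₁-zip []       []       e = refl
map-proj₁-zip (a ∷ as) (b ∷ bs) e = cong (a ∷_) (map-proj₁-zip as bs (ℕ.suc-injective e))

map-proj₂-zip : ∀ {A B : Set} (as : List A) (bs : List B) → length bs ≤ length as → map proj₂ (zip as bs) ≡ bs
map-proj₂-zip []       []       l       = refl
map-proj₂-zip (a ∷ as) []       l       = refl
map-proj₂-zip (a ∷ as) (b ∷ bs) (s≤s l) = cong (b ∷_) (map-proj₂-zip as bs l)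

zip-↭ : ∀ {A B : Set} {as as′ : List A} (bs : List B) → length as ≡ length bs → as ↭ as′ →
        ∃[ bs′ ] (length bs′ ≡ length as′ × zip as bs ↭ zip as′ bs′)
zip-↭ {as = as} {as′} bs e p
  with ↭.↭-map-inv proj₁ (subst (_↭ as′) (sym (map-proj₁-zip as bs e)) p)
... | ps , refl , q = map proj₂ ps , trans (List.length-map proj₂ ps) (sym (List.length-map proj₁ ps)) ,
  subst (zip as bs ↭_) (sym (zip-unzip ps)) q

-- The commutative monoid of monomials

⊕-identityʳ : ∀ p → p ⊕ (0 , false) ≡ p
⊕-identityʳ (e , b) = cong₂ _,_ (ℕ.+-identityʳ e) (Bool.∨-identityʳ b)

∙-comm : ∀ α β → α ∙ β ≡ β ∙ α
∙-comm []            []            = refl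
∙-comm []            (_ ∷ _)       = refl
∙-comm (_ ∷ _)       []            = refl
∙-comm ((d , a) ∷ α) ((e , b) ∷ β) = cong₂ _∷_ (cong₂ _,_ (ℕ.+-comm d e) (Bool.∨-comm a b)) (∙-comm α β)

∙-assoc : ∀ α β γ → (α ∙ β) ∙ γ ≡ α ∙ (β ∙ γ)
∙-assoc []      β       γ       = refl
∙-assoc (_ ∷ _) []      γ       = refl
∙-assoc (_ ∷ _) (_ ∷ _) []      = refl
∙-assoc ((d , a) ∷ α) ((e , b) ∷ β) ((f , c) ∷ γ) =
  cong₂ _∷_ (cong₂ _,_ (ℕ.+-assoc d e f) (Bool.∨-assoc a b c)) (∙-assoc α β γ)

∙-commutativeSemigroup : CommutativeSemigroup 0ℓ 0ℓ
∙-commutativeSemigroup = record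
  { Carrier                = Mon
  ; _≈_                    = _≡_
  ; _∙_                    = _∙_
  ; isCommutativeSemigroup = record
    { isSemigroup = record
      { isMagma = record { isEquivalence = ≡.isEquivalence ; ∙-cong = cong₂ _∙_ }
      ; assoc   = ∙-assoc
      }
    ; comm        = ∙-comm
    }
  }

-- An assignment (i , (n , b)) stands for θᵢᵇ xᵢⁿ.
Assignment : Set
Assignment = ℕ × Entry

ix : ℕ → ℕ
ix = Alphabet.index X

θ-mon : ℕ → Bool → Mon
θ-mon i false = []
θ-mon i true  = proj₂ (ζᵗ (ix i))

assigned : Assignment → Mon
assigned (i , n , b) = θ-mon i b ∙ proj₂ (zᵗ (ix i) ^ᵗ n)

monomial : List Assignment → Mon
monomial as = foldr _∙_ [] (map assigned as)

monomial-++ : ∀ as bs → monomial (as ++ bs) ≡ monomial as ∙ monomial bs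
monomial-++ []       bs = refl
monomial-++ (a ∷ as) bs = trans (cong (assigned a ∙_) (monomial-++ as bs)) (sym (∙-assoc (assigned a) _ _))

monomial-↭ : ∀ {as bs} → as ↭ bs → monomial as ≡ monomial bs
monomial-↭ ↭.refl        = refl
monomial-↭ (prep a p)    = cong (assigned a ∙_) (monomial-↭ p)
monomial-↭ {bs = _ ∷ _ ∷ bs} (swap a b p)  = trans (cong (λ α → assigned a ∙ (assigned b ∙ α)) (monomial-↭ p))
  (trans (sym (∙-assoc (assigned a) (assigned b) (monomial bs))) (trans (cong (_∙ monomial bs) (∙-comm (assigned a) (assigned b))) (∙-assoc (assigned b) (assigned a) (monomial bs))))
monomial-↭ (↭.trans p q) = trans (monomial-↭ p) (monomial-↭ q)

0ᵉ : Entry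
0ᵉ = 0 , false

monomial-zeros : ∀ is k → monomial (zip is (replicate k 0ᵉ)) ≡ []
monomial-zeros []       zero    = refl
monomial-zeros []       (suc k) = refl
monomial-zeros (i ∷ is) zero    = refl
monomial-zeros (i ∷ is) (suc k) = monomial-zeros is k

monomial-pad : ∀ is es k → monomial (zip is (es ++ replicate k 0ᵉ)) ≡ monomial (zip is es)
monomial-pad []       []       k = monomial-zeros [] k
monomial-pad (i ∷ is) []       k = monomial-zeros (i ∷ is) k
monomial-pad []       (e ∷ es) k = refl
monomial-pad (i ∷ is) (e ∷ es) k = cong (assigned (i , e) ∙_) (monomial-pad is es k)

entryAt : Mon → ℕ → Entry
entryAt []      k       = 0ᵉ
entryAt (p ∷ α) zero    = p
entryAt (p ∷ α) (suc k) = entryAt α k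

entryAt-∙ : ∀ α β k → entryAt (α ∙ β) k ≡ entryAt α k ⊕ entryAt β k
entryAt-∙ []      β       k       = refl
entryAt-∙ (p ∷ α) []      k       = sym (⊕-identityʳ _)
entryAt-∙ (p ∷ α) (q ∷ β) zero    = refl
entryAt-∙ (p ∷ α) (q ∷ β) (suc k) = entryAt-∙ α β k

entryAt-shift-≡ : ∀ k p → entryAt (replicate k 0ᵉ ++ [ p ]) k ≡ p
entryAt-shift-≡ zero    p = refl
entryAt-shift-≡ (suc k) p = entryAt-shift-≡ k p

entryAt-shift-≢ : ∀ k p j → k ≢ j → entryAt (replicate k 0ᵉ ++ [ p ]) j ≡ 0ᵉ
entryAt-shift-≢ zero    p zero    ne = contradiction refl ne
entryAt-shift-≢ zero    p (suc j) ne = refl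
entryAt-shift-≢ (suc k) p zero    ne = refl
entryAt-shift-≢ (suc k) p (suc j) ne = entryAt-shift-≢ k p j (ne ∘ cong suc)

ix-injective : ∀ {i j} → ix i ≡ ix j → i ≡ j
ix-injective {i} {j} e = go i j (ℕ.suc-injective e)
  where
  go : ∀ i j → i ℕ.+ i ≡ j ℕ.+ j → i ≡ j
  go zero    zero    e = refl
  go zero    (suc j) ()
  go (suc i) zero    ()
  go (suc i) (suc j) e rewrite ℕ.+-suc i i | ℕ.+-suc j j = cong suc (go i j (ℕ.suc-injective (ℕ.suc-injective e)))

entryAt-^-≡ : ∀ k n → entryAt (proj₂ (zᵗ k ^ᵗ n)) k ≡ (n , false)
entryAt-^-≡ k zero    = refl
entryAt-^-≡ k (suc n) = trans (entryAt-∙ (proj₂ (zᵗ k ^ᵗ n)) _ k)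
  (trans (cong₂ _⊕_ (entryAt-^-≡ k n) (entryAt-shift-≡ k (1 , false))) (cong (_, false) (ℕ.+-comm n 1)))

entryAt-^-≢ : ∀ k n j → k ≢ j → entryAt (proj₂ (zᵗ k ^ᵗ n)) j ≡ 0ᵉ
entryAt-^-≢ k zero    j ne = refl
entryAt-^-≢ k (suc n) j ne = trans (entryAt-∙ (proj₂ (zᵗ k ^ᵗ n)) _ j)
  (cong₂ _⊕_ (entryAt-^-≢ k n j ne) (entryAt-shift-≢ k (1 , false) j ne))

entryAt-assigned-≡ : ∀ i p → entryAt (assigned (i , p)) (ix i) ≡ p
entryAt-assigned-≡ i (n , false) = entryAt-^-≡ (ix i) n
entryAt-assigned-≡ i (n , true)  = trans (entryAt-∙ (proj₂ (ζᵗ (ix i))) (proj₂ (zᵗ (ix i) ^ᵗ n)) (ix i))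
  (cong₂ _⊕_ (entryAt-shift-≡ (ix i) (0 , true)) (entryAt-^-≡ (ix i) n))

entryAt-assigned-≢ : ∀ i p j → i ≢ j → entryAt (assigned (i , p)) (ix j) ≡ 0ᵉ
entryAt-assigned-≢ i (n , false) j ne = entryAt-^-≢ (ix i) n (ix j) (ne ∘ ix-injective)
entryAt-assigned-≢ i (n , true)  j ne = trans (entryAt-∙ (proj₂ (ζᵗ (ix i))) (proj₂ (zᵗ (ix i) ^ᵗ n)) (ix j))
  (cong₂ _⊕_ (entryAt-shift-≢ (ix i) (0 , true) (ix j) (ne ∘ ix-injective)) (entryAt-^-≢ (ix i) n (ix j) (ne ∘ ix-injective)))

entryAt-monomial-∉ : ∀ is c j → All (_≢ j) is → entryAt (monomial (zip is c)) (ix j) ≡ 0ᵉ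
entryAt-monomial-∉ []       c       j _        = refl
entryAt-monomial-∉ (i ∷ is) []      j _        = refl
entryAt-monomial-∉ (i ∷ is) (p ∷ c) j (ne ∷ nes) = trans (entryAt-∙ (assigned (i , p)) _ (ix j))
  (cong₂ _⊕_ (entryAt-assigned-≢ i p j ne) (entryAt-monomial-∉ is c j nes))

-- The pair assigned to the j-th variable is the entry of the monomial at position `ix j`, to which
-- no other variable contributes since `ix` is injective.
monomial-injective : ∀ n c c′ → length c ≡ n → length c′ ≡ n →
                     monomial (zip (upTo n) c) ≡ monomial (zip (upTo n) c′) → c ≡ c′
monomial-injective n c c′ l l′ e = go id id n c c′ l l′ λ j → cong (λ α → entryAt α (ix j)) e
  where
  go : ∀ (f : ℕ → ℕ) → (∀ {i j} → f i ≡ f j → i ≡ j) → ∀ n c c′ → length c ≡ n → length c′ ≡ n →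
       (∀ j → entryAt (monomial (zip (applyUpTo f n) c)) (ix (f j)) ≡ entryAt (monomial (zip (applyUpTo f n) c′)) (ix (f j))) → c ≡ c′
  go f inj zero    []      []        l l′ e = refl
  go f inj (suc n) (p ∷ c) (p′ ∷ c′) l l′ e = cong₂ _∷_
    (trans (sym (head p c)) (trans (e 0) (head p′ c′)))
    (go (f ∘ suc) (ℕ.suc-injective ∘ inj) n c c′ (ℕ.suc-injective l) (ℕ.suc-injective l′)
      λ j → trans (sym (tail p c j)) (trans (e (suc j)) (tail p′ c′ j)))
    where
    head : ∀ p c → entryAt (monomial (zip (applyUpTo f (suc n)) (p ∷ c))) (ix (f 0)) ≡ p
    head p c = trans (entryAt-∙ (assigned (f 0 , p)) _ (ix (f 0))) (trans (cong₂ _⊕_ (entryAt-assigned-≡ (f 0) p)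
      (entryAt-monomial-∉ (applyUpTo (f ∘ suc) n) c (f 0) (All.applyUpTo⁺₂ (f ∘ suc) n λ i q → ℕ.1+n≢0 (inj q)))) (⊕-identityʳ p))
    tail : ∀ p c j → entryAt (monomial (zip (applyUpTo f (suc n)) (p ∷ c))) (ix (f (suc j)))
                   ≡ entryAt (monomial (zip (applyUpTo (f ∘ suc) n) c)) (ix (f (suc j)))
    tail p c j = trans (entryAt-∙ (assigned (f 0 , p)) _ (ix (f (suc j))))
      (cong (_⊕ entryAt (monomial (zip (applyUpTo (f ∘ suc) n) c)) (ix (f (suc j)))) (entryAt-assigned-≢ (f 0) p (f (suc j)) λ q → ℕ.0≢1+n (inj q)))

length-entries : ∀ as rs → length (entries as rs) ≡ length (as ++ rs)
length-entries as rs = trans (List.length-++ (map (_, true) as)) (trans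
  (cong₂ ℕ._+_ (List.length-map (_, true) as) (List.length-map (_, false) rs)) (sym (List.length-++ as)))

term-monomial : ∀ Λ s → length (parts Λ) ≤ length s → proj₂ (term X Λ s) ≡ monomial (zip s (entries (anti Λ) (rest Λ)))
term-monomial Λ s l = go (anti Λ) s l
  where
  open Algebra.Properties.CommutativeSemigroup ∙-commutativeSemigroup using (interchange)

  bosons : ∀ rs s → length rs ≤ length s →
           proj₂ (∏ᵗ (zipWith (λ k i → zᵗ (ix i) ^ᵗ k) rs s)) ≡ monomial (zip s (map (_, false) rs))
  bosons []       []      l       = refl
  bosons []       (_ ∷ _) l       = refl
  bosons (r ∷ rs) (i ∷ s) (s≤s l) = cong (proj₂ (zᵗ (ix i) ^ᵗ r) ∙_) (bosons rs s l)

  go : ∀ as s → length (as ++ rest Λ) ≤ length s →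
       proj₂ (∏ᵗ (zipWith (λ _ i → ζᵗ (ix i)) as s)) ∙ proj₂ (∏ᵗ (zipWith (λ k i → zᵗ (ix i) ^ᵗ k) (as ++ rest Λ) s))
       ≡ monomial (zip s (entries as (rest Λ)))
  go []       s       l       = bosons (rest Λ) s l
  go (a ∷ as) (i ∷ s) (s≤s l) = trans
    (interchange (proj₂ (ζᵗ (ix i))) (proj₂ (∏ᵗ (zipWith (λ _ i → ζᵗ (ix i)) as s))) (proj₂ (zᵗ (ix i) ^ᵗ a))
                   (proj₂ (∏ᵗ (zipWith (λ k i → zᵗ (ix i) ^ᵗ k) (as ++ rest Λ) s))))
    (cong (assigned (i , a , true) ∙_) (go as s l))

-- The sign of a term

Bosonic : Term → Set
Bosonic (c , α) = c ≡ 1ℤ × All (λ p → proj₂ p ≡ false) α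

ε-bosonic : ∀ α {β} → All (λ p → proj₂ p ≡ false) β → ε α β ≡ 1ℤ
ε-bosonic []      _           = refl
ε-bosonic (_ ∷ α) []          = refl
ε-bosonic (_ ∷ α) (refl ∷ bs) = ε-bosonic α bs

∙-bosonic : ∀ {α β} → All (λ p → proj₂ p ≡ false) α → All (λ p → proj₂ p ≡ false) β → All (λ p → proj₂ p ≡ false) (α ∙ β)
∙-bosonic []          bs          = bs
∙-bosonic (refl ∷ as) []          = refl ∷ as
∙-bosonic (refl ∷ as) (refl ∷ bs) = refl ∷ ∙-bosonic as bs

*ᵗ-bosonic : ∀ {S T} → Bosonic S → Bosonic T → Bosonic (S *ᵗ T)
*ᵗ-bosonic {_ , α} {_ , β} (refl , bα) (refl , bβ) = trans (ℤ.*-identityʳ _) (ε-bosonic α bβ) , ∙-bosonic bα bβ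

zᵗ-bosonic : ∀ k n → Bosonic (zᵗ k ^ᵗ n)
zᵗ-bosonic k zero    = refl , []
zᵗ-bosonic k (suc n) = *ᵗ-bosonic (zᵗ-bosonic k n) (refl , All.++⁺ (All.replicate⁺ k refl) (refl ∷ []))

bosons-bosonic : ∀ rs s → Bosonic (∏ᵗ (zipWith (λ k i → zᵗ (ix i) ^ᵗ k) rs s))
bosons-bosonic []       s       = refl , []
bosons-bosonic (r ∷ rs) []      = refl , []
bosons-bosonic (r ∷ rs) (i ∷ s) = *ᵗ-bosonic (zᵗ-bosonic (ix i) r) (bosons-bosonic rs s)

-- The powers of x have coefficient 1 and contain no ζ, so the sign comes from the θ's alone. It is
-- expressed through `zip s (anti Λ)`, the list that `odd-parts-unique` shows to be determined by
-- the monomial.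
term-coefficient : ∀ Λ s → proj₁ (term X Λ s) ≡ proj₁ (∏ᵗ (map (ζᵗ ∘ ix ∘ proj₁) (zip s (anti Λ))))
term-coefficient Λ s = trans (absorb (∏ᵗ (zipWith (λ _ i → ζᵗ (ix i)) (anti Λ) s)) (bosons-bosonic (parts Λ) s))
  (cong (proj₁ ∘ ∏ᵗ) (trans (List.zipWith-flip _ (anti Λ) s) (sym (List.map-zipWith _,_ (ζᵗ ∘ ix ∘ proj₁) s (anti Λ)))))
  where
  absorb : ∀ S {T} → Bosonic T → proj₁ (S *ᵗ T) ≡ proj₁ S
  absorb (c , α) (refl , b) = trans (cong₂ ℤ._*_ (ε-bosonic α b) (ℤ.*-identityʳ c)) (ℤ.*-identityˡ c)

-- With `toNil` below, a partition of the entries into three kinds: odd ones give the parts before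
-- the semicolon, positive even ones the parts after it, zeros the variables that do not occur.
toOdd toPos : Assignment → Maybe (ℕ × ℕ)
toOdd (i , n , true)      = just (i , n)
toOdd (i , n , false)     = nothing
toPos (i , n , true)      = nothing
toPos (i , zero , false)  = nothing
toPos (i , suc n , false) = just (i , suc n)

toNil : Assignment → Maybe ℕ
toNil (i , n , true)      = nothing
toNil (i , zero , false)  = just i
toNil (i , suc n , false) = nothing

odds poss : List Assignment → List (ℕ × ℕ)
odds = mapMaybe toOdd
poss = mapMaybe toPos

nils : List Assignment → List ℕ
nils = mapMaybe toNil

asNil : ℕ → Assignment
asNil i = i , 0ᵉ

classify : ∀ as → as ↭ (map asOdd (odds as) ++ map asPos (poss as)) ++ map asNil (nils as)
classify []                         = ↭-refl
classify ((i , n , true) ∷ as)      = prep _ (classify as)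
classify ((i , suc n , false) ∷ as) = ↭-trans (prep _ (classify as))
  (↭.++⁺ʳ (map asNil (nils as)) (↭-sym (↭.shift (i , suc n , false) (map asOdd (odds as)) (map asPos (poss as)))))
classify ((i , zero , false) ∷ as)  = ↭-trans (prep _ (classify as))
  (↭-sym (↭.shift (i , 0ᵉ) (map asOdd (odds as) ++ map asPos (poss as)) (map asNil (nils as))))

odds-zeros : ∀ is k → odds (zip is (replicate k 0ᵉ)) ≡ []
odds-zeros []       zero    = refl
odds-zeros []       (suc k) = refl
odds-zeros (i ∷ is) zero    = refl
odds-zeros (i ∷ is) (suc k) = odds-zeros is k

poss-zeros : ∀ is k → poss (zip is (replicate k 0ᵉ)) ≡ []
poss-zeros []       zero    = refl
poss-zeros []       (suc k) = refl
poss-zeros (i ∷ is) zero    = refl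
poss-zeros (i ∷ is) (suc k) = poss-zeros is k

odds-pad : ∀ is es k → odds (zip is (es ++ replicate k 0ᵉ)) ≡ odds (zip is es)
odds-pad []       []                 k = odds-zeros [] k
odds-pad (i ∷ is) []                 k = odds-zeros (i ∷ is) k
odds-pad []       (e ∷ es)           k = refl
odds-pad (i ∷ is) ((n , true) ∷ es)  k = cong ((i , n) ∷_) (odds-pad is es k)
odds-pad (i ∷ is) ((n , false) ∷ es) k = odds-pad is es k

poss-pad : ∀ is es k → poss (zip is (es ++ replicate k 0ᵉ)) ≡ poss (zip is es)
poss-pad []       []                     k = poss-zeros [] k
poss-pad (i ∷ is) []                     k = poss-zeros (i ∷ is) k
poss-pad []       (e ∷ es)               k = refl
poss-pad (i ∷ is) ((n , true) ∷ es)      k = poss-pad is es k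
poss-pad (i ∷ is) ((zero , false) ∷ es)  k = poss-pad is es k
poss-pad (i ∷ is) ((suc n , false) ∷ es) k = cong ((i , suc n) ∷_) (poss-pad is es k)

odds-entries : ∀ s as rs → length (as ++ rs) ≤ length s → odds (zip s (entries as rs)) ≡ zip s as
odds-entries []      []       rs       l       = refl
odds-entries (i ∷ s) []       []       l       = refl
odds-entries (i ∷ s) []       (r ∷ rs) (s≤s l) = trans (odds-entries s [] rs l) (List.zipWith-zeroʳ _,_ s)
odds-entries (i ∷ s) (a ∷ as) rs       (s≤s l) = cong ((i , a) ∷_) (odds-entries s as rs l)

poss-entries : ∀ s as rs → length (as ++ rs) ≤ length s → All (0 <_) rs → map proj₂ (poss (zip s (entries as rs))) ≡ rs
poss-entries []      []       []           l       _       = refl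
poss-entries (i ∷ s) []       []           l       _       = refl
poss-entries (i ∷ s) []       (suc r ∷ rs) (s≤s l) (_ ∷ ps) = cong (suc r ∷_) (poss-entries s [] rs l ps)
poss-entries (i ∷ s) (a ∷ as) rs           (s≤s l) ps      = poss-entries s as rs l ps

superpartition-≡ : ∀ {Λ Λ′} → anti Λ ≡ anti Λ′ → rest Λ ≡ rest Λ′ → Λ ≡ Λ′
superpartition-≡ {Λ} {Λ′} = go
  where
  open Superpartition
  go : anti Λ ≡ anti Λ′ → rest Λ ≡ rest Λ′ → Λ ≡ Λ′
  go refl refl
    with refl ← Linked.irrelevant ℕ.≤-irrelevant (anti-decreasing Λ) (anti-decreasing Λ′)
    with refl ← Linked.irrelevant ℕ.≤-irrelevant (rest-decreasing Λ) (rest-decreasing Λ′)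
    with refl ← All.irrelevant ℕ.≤-irrelevant (rest-positive Λ) (rest-positive Λ′) = refl

infix 4 _≟ˢᵖ_
_≟ˢᵖ_ : DecidableEquality Superpartition
Λ ≟ˢᵖ Λ′ = map′ (uncurry superpartition-≡) (λ { refl → refl , refl })
  (List.≡-dec ℕ._≟_ (anti Λ) (anti Λ′) ×-dec List.≡-dec ℕ._≟_ (rest Λ) (rest Λ′))

zip-truncate : ∀ {A B : Set} (as as′ : List A) (bs : List B) → length bs ≡ length as → zip (as ++ as′) bs ≡ zip as bs
zip-truncate []       as′ []       e = List.zipWith-zeroʳ _,_ as′
zip-truncate (a ∷ as) as′ (b ∷ bs) e = cong ((a , b) ∷_) (zip-truncate as as′ bs (ℕ.suc-injective e))

upTo-+ : ∀ k n → upTo (k ℕ.+ n) ≡ upTo n ++ applyUpTo (n ℕ.+_) k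
upTo-+ k n = trans (cong upTo (ℕ.+-comm k n)) (applyUpTo-++ id n k)

zip-upTo-truncate : ∀ {B : Set} k n (bs : List B) → length bs ≡ n → zip (upTo (k ℕ.+ n)) bs ≡ zip (upTo n) bs
zip-upTo-truncate k n bs e = trans (cong (λ l → zip l bs) (upTo-+ k n))
  (zip-truncate (upTo n) _ bs (trans e (sym (List.length-upTo n))))

-- The superpartition of a monomial

oddPart evenPart : List Assignment → List (ℕ × ℕ)
oddPart  as = sort (odds as)
evenPart as = sort (poss as)

shape : (as : List Assignment) → Linked (λ a b → proj₂ a > proj₂ b) (oddPart as) → Superpartition
shape as l = record
  { anti            = map proj₂ (oddPart as)
  ; rest            = map proj₂ (evenPart as)
  ; anti-decreasing = Linked.map⁺ l
  ; rest-decreasing = Linked.map⁺ (sort-↗ (poss as))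
  ; rest-positive   = All.map⁺ (↭.All-resp-↭ (↭-sym (sort-↭ (poss as))) (positive as))
  }
  where
  positive : ∀ as → All (λ p → 0 < proj₂ p) (poss as)
  positive []                         = []
  positive ((i , n , true) ∷ as)      = positive as
  positive ((i , zero , false) ∷ as)  = positive as
  positive ((i , suc n , false) ∷ as) = z<s ∷ positive as

strict? : (as : List Assignment) → Dec (Linked (λ a b → proj₂ a > proj₂ b) (oddPart as))
strict? as = Linked.linked? (λ a b → proj₂ b ℕ.<? proj₂ a) (oddPart as)

-- At most one superpartition; none if an exponent occurs twice among the odd entries.
shapes : List Assignment → List Superpartition
shapes as with strict? as
... | yes l = shape as l ∷ []
... | no  _ = []

shape∈shapes : ∀ as l → shape as l ∈ shapes as
shape∈shapes as l with strict? as
... | yes l′ = here (superpartition-≡ refl refl)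
... | no ¬l  = contradiction l ¬l

classify-sorted : ∀ as → as ↭ (map asOdd (oddPart as) ++ map asPos (evenPart as)) ++ map asNil (nils as)
classify-sorted as = ↭-trans (classify as) (↭.++⁺ʳ (map asNil (nils as))
  (↭.++⁺ (↭.map⁺ asOdd (↭-sym (sort-↭ (odds as)))) (↭.map⁺ asPos (↭-sym (sort-↭ (poss as))))))

monomial-nils : ∀ is → monomial (map asNil is) ≡ []
monomial-nils []       = refl
monomial-nils (i ∷ is) = monomial-nils is

monomial-sorted : ∀ as → monomial as ≡ monomial (map asOdd (oddPart as) ++ map asPos (evenPart as))
monomial-sorted as = trans (monomial-↭ (classify-sorted as)) (trans
  (monomial-++ (map asOdd (oddPart as) ++ map asPos (evenPart as)) (map asNil (nils as)))
  (trans (cong (monomial (map asOdd (oddPart as) ++ map asPos (evenPart as)) ∙_) (monomial-nils (nils as)))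
         (∙-identityʳ (monomial (map asOdd (oddPart as) ++ map asPos (evenPart as))))))

zip-entries : ∀ ts ps is → zip ((map proj₁ ts ++ map proj₁ ps) ++ is) (entries (map proj₂ ts) (map proj₂ ps))
                         ≡ map asOdd ts ++ map asPos ps
zip-entries []       []       is = List.zipWith-zeroʳ _,_ is
zip-entries []       (p ∷ ps) is = cong (asPos p ∷_) (zip-entries [] ps is)
zip-entries (t ∷ ts) ps       is = cong (asOdd t ∷_) (zip-entries ts ps is)

-- Strict decrease excludes ties, so sorting by exponent fixes the variables as well and thereby the
-- order of the θ's. After the semicolon ties are allowed, and `rest-unique` recovers the exponents
-- only.
odd-parts-unique : ∀ Λ Λ′ s s′ → length (anti Λ) ≤ length s → length (anti Λ′) ≤ length s′ →
                   zip s (anti Λ) ↭ zip s′ (anti Λ′) → zip s (anti Λ) ≡ zip s′ (anti Λ′)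
odd-parts-unique Λ Λ′ s s′ l l′ = sorted-↭⇒≡ (λ p q → contradiction q (ℕ.<-asym p)) (decreasing Λ s l) (decreasing Λ′ s′ l′)
  where
  decreasing : ∀ Λ (s : List ℕ) → length (anti Λ) ≤ length s → AllPairs (λ a b → proj₂ a > proj₂ b) (zip s (anti Λ))
  decreasing Λ s l = Linked.Linked⇒AllPairs (λ p q → ℕ.<-trans q p)
    (Linked.map⁻ (subst (Linked _>_) (sym (map-proj₂-zip s (anti Λ) l)) (anti-decreasing Λ)))

rest-unique : ∀ Λ Λ′ → rest Λ ↭ rest Λ′ → rest Λ ≡ rest Λ′
rest-unique Λ Λ′ = sorted-↭⇒≡ (λ p q → ℕ.≤-antisym q p) (decreasing Λ) (decreasing Λ′)
  where
  decreasing : ∀ Λ → AllPairs _≥_ (rest Λ)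
  decreasing Λ = Linked.Linked⇒AllPairs (λ p q → ℕ.≤-trans q p) (rest-decreasing Λ)

length-anti≤ℓ : ∀ Λ → length (anti Λ) ≤ ℓ Λ
length-anti≤ℓ Λ = subst (length (anti Λ) ≤_) (sym (List.length-++ (anti Λ))) (ℕ.m≤m+n _ (length (rest Λ)))

-- Both sides at a fixed monomial μ

module Coefficient {N D : ℕ} (μ : Mon) (μ-length : length μ ≡ N) (μ-degree : degree μ ≡ D) where
  open Truncated N D

  eval : ∀ {f g} → f ∼ g → f μ ≡ g μ
  eval p = at p (ℕ.≤-reflexive μ-length , ℕ.≤-reflexive μ-degree)

  value : List Assignment → ℤ
  value as = ∏ (map (uncurry factor) as) μ

  assignments : List Entry → List Assignment
  assignments = zip (upTo N)

  contribution : List Entry → ℤ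
  contribution c = value (assignments c)

  K-expand : K μ ≡ ∑ monomials contribution
  K-expand = trans (cong (λ n → kernelPartial n μ) μ-length) (trans (eval kernel-expand) (trans (∑ᴿ-at monomials _ μ)
    (∑-cong′ monomials λ c → cong (λ fs → ∏ fs μ) (sym (List.map-zipWith _,_ (uncurry factor) (upTo N) c)))))

  value-↭ : ∀ {as bs} → as ↭ bs → value as ≡ value bs
  value-↭ p = eval (∏-map-↭ (uncurry factor) (λ (i , e) → factor-even i e) p)

  value-pad : ∀ is es k → value (zip is (es ++ replicate k 0ᵉ)) ≡ value (zip is es)
  value-pad is es k = eval (∏-factor-pad h-0 is es k)

  exponents-unique : Unique exponents
  exponents-unique = Unique.cartesianProduct⁺ (Unique.upTo⁺ (suc D)) (((λ ()) ∷ []) ∷ [] ∷ [])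

  words-unique : ∀ n → Unique (words exponents n)
  words-unique zero    = [] ∷ []
  words-unique (suc n) = Unique.cartesianProductWith⁺ _∷_ List.∷-injective exponents-unique (words-unique n)

  monomials-unique : Unique monomials
  monomials-unique = words-unique N

  words-length : ∀ n {c} → c ∈ words exponents n → length c ≡ n
  words-length zero    (here refl) = refl
  words-length (suc n) c∈ with ∈-cartesianProductWith⁻ _∷_ exponents (words exponents n) c∈
  ... | _ , d , _ , d∈ , refl = cong suc (words-length n d∈)

  ∈-exponents : ∀ n b → n ≤ D → (n , b) ∈ exponents
  ∈-exponents n b n≤D = ∈-cartesianProduct⁺ (∈-upTo⁺ (s≤s n≤D)) (bool b)
    where
    bool : ∀ b → b ∈ false ∷ true ∷ []
    bool false = here refl
    bool true  = there (here refl)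

  -- An assignment whose factor may survive the truncation. Since m_Λ permutes more than N
  -- variables, its terms also produce others, and these must be seen to contribute 0.
  Good : Assignment → Set
  Good (i , p) = proj₁ p ≤ D × (i < N ⊎ p ≡ 0ᵉ)

  good? : ∀ a → Dec (Good a)
  good? (i , p) = (proj₁ p ℕ.≤? D) ×-dec ((i ℕ.<? N) ⊎-dec (p ≟ᵉ 0ᵉ))

  bad⇒zero : ∀ a → ¬ Good a → uncurry factor a ∼ 0ˢ
  bad⇒zero (i , p) bad = go (proj₁ p ℕ.≤? D) (i ℕ.<? N) (p ≟ᵉ 0ᵉ)
    where
    go : Dec (proj₁ p ≤ D) → Dec (i < N) → Dec (p ≡ 0ᵉ) → factor i p ∼ 0ˢ
    go (no n≰D)  _         _        = factor-power-zero i p (x^1+D≈0 i (proj₁ p) (ℕ.≰⇒> n≰D))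
    go (yes n≤D) (yes i<N) _        = contradiction (n≤D , inj₁ i<N) bad
    go (yes n≤D) (no _)    (yes e)  = contradiction (n≤D , inj₂ e) bad
    go (yes _)   (no i≮N)  (no p≢0) = factor-variables-zero i p
      (≈[]⇒∼ (even-vanishes X i (ℕ.≮⇒≥ i≮N))) (≈[]⇒∼ (odd-vanishes X i (ℕ.≮⇒≥ i≮N))) p≢0

  bad-value : ∀ as → ¬ All Good as → value as ≡ 0ℤ
  bad-value as ¬all = eval (∏-map-zero (uncurry factor) (Any.map (bad⇒zero _) (All.¬All⇒Any¬ good? as ¬all)))

  good⇒word : ∀ is c → length c ≡ length is → All Good (zip is c) → c ∈ words exponents (length is)
  good⇒word []       []            e []             = here refl
  good⇒word (i ∷ is) ((n , b) ∷ c) e ((n≤D , _) ∷ g) =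
    ∈-cartesianProductWith⁺ _∷_ (∈-exponents n b n≤D) (good⇒word is c (ℕ.suc-injective e) g)

  good⇒zeros : ∀ (f : ℕ → ℕ) → (∀ j → N ≤ f j) → ∀ k c → length c ≡ k → All Good (zip (applyUpTo f k) c) → c ≡ replicate k 0ᵉ
  good⇒zeros f p zero    []      e []                    = refl
  good⇒zeros f p (suc k) (_ ∷ c) e ((_ , inj₁ f0<N) ∷ g) = contradiction f0<N (ℕ.≤⇒≯ (p 0))
  good⇒zeros f p (suc k) (_ ∷ c) e ((_ , inj₂ refl) ∷ g) = cong (0ᵉ ∷_) (good⇒zeros (f ∘ suc) (p ∘ suc) k c (ℕ.suc-injective e) g)

  good-split : ∀ k c′ → length c′ ≡ k ℕ.+ N → All Good (zip (upTo (k ℕ.+ N)) c′) →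
               ∃[ c ] (c ∈ monomials × c′ ≡ c ++ replicate k 0ᵉ)
  good-split k c′ e g = take N c′ , take∈ , trans (sym (List.take++drop≡id N c′)) (cong (take N c′ ++_) drop≡)
    where
    N≤ : N ≤ length c′
    N≤ = subst (N ≤_) (sym e) (ℕ.m≤n+m N k)
    length-take : length (take N c′) ≡ N
    length-take = trans (List.length-take N c′) (ℕ.m≤n⇒m⊓n≡m N≤)
    length-drop : length (drop N c′) ≡ k
    length-drop = trans (List.length-drop N c′) (trans (cong (ℕ._∸ N) e) (ℕ.m+n∸n≡m k N))
    split : zip (upTo (k ℕ.+ N)) c′ ≡ zip (upTo N) (take N c′) ++ zip (applyUpTo (N ℕ.+_) k) (drop N c′)
    split = trans (cong₂ zip (upTo-+ k N) (sym (List.take++drop≡id N c′)))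
      (zip-++ (upTo N) (take N c′) (trans (List.length-upTo N) (sym length-take)))
    both : All Good (zip (upTo N) (take N c′)) × All Good (zip (applyUpTo (N ℕ.+_) k) (drop N c′))
    both = All.++⁻ (zip (upTo N) (take N c′)) (subst (All Good) split g)
    take∈ : take N c′ ∈ monomials
    take∈ = subst (λ n → take N c′ ∈ words exponents n) (List.length-upTo N)
      (good⇒word (upTo N) (take N c′) (trans length-take (sym (List.length-upTo N))) (proj₁ both))
    drop≡ : drop N c′ ≡ replicate k 0ᵉ
    drop≡ = good⇒zeros (N ℕ.+_) (ℕ.m≤m+n N) k (drop N c′) length-drop (proj₂ both)

  weight : Superpartition → Term → ℤ
  weight Λ T = (reversal (fermionicDegree Λ) (series T) *ˢ hΛ Y Λ) μ

  terms : Superpartition → List Term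
  terms Λ = distinctTerms X Λ (ℓ Λ ℕ.+ N)

  weight-sum : ∀ Λ → (reversal (fermionicDegree Λ) (m X Λ) *ˢ hΛ Y Λ) μ ≡ ∑ (terms Λ) (weight Λ)
  weight-sum Λ = begin
    convS μ (λ α β → ε α β ℤ.* ((c ℤ.* m X Λ α) ℤ.* H β))
      -- The number of variables permuted in m_Λ depends on the length of the argument. Splitting
      -- preserves lengths, so it is ℓ Λ + N for every α.
      ≡⟨ convS-cong-∈ μ (splits-length μ) (λ α β (e , _) →
           trans (cong (λ n → ε α β ℤ.* ((c ℤ.* ∑ (distinctTerms X Λ (ℓ Λ ℕ.+ n)) (λ T → series T α)) ℤ.* H β)) (trans e μ-length))
           (trans (lemma (ε α β) c (∑ (terms Λ) (λ T → series T α)) (H β))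
           (trans (sym (∑-*ˡ (ε α β ℤ.* c ℤ.* H β) (λ T → series T α) (terms Λ)))
                  (∑-cong′ (terms Λ) λ T → sym (lemma (ε α β) c (series T α) (H β)))))) ⟩
    convS μ (λ α β → ∑ (terms Λ) (λ T → ε α β ℤ.* ((c ℤ.* series T α) ℤ.* H β)))
      ≡⟨ ∑-swap _ (splits μ) (terms Λ) ⟩
    ∑ (terms Λ) (weight Λ) ∎
    where
    open ≡-Reasoning
    c : ℤ
    c = -1^ (fermionicDegree Λ C 2)
    H : Series
    H = hΛ Y Λ
    lemma : ∀ e c s h → e ℤ.* ((c ℤ.* s) ℤ.* h) ≡ (e ℤ.* c ℤ.* h) ℤ.* s
    lemma = solve-∀

  series-θs : ∀ as s → series (∏ᵗ (zipWith (λ _ i → ζᵗ (ix i)) as s)) ∼ θs as s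
  series-θs []       s       = ∼-refl
  series-θs (a ∷ as) []      = ∼-refl
  series-θs (a ∷ as) (i ∷ s) = ∼-trans (≈⇒∼ (series-* (ζᵗ (ix i)) (∏ᵗ (zipWith (λ _ i → ζᵗ (ix i)) as s))))
    (∼-*-congˡ {θ i} {series (∏ᵗ (zipWith (λ _ i → ζᵗ (ix i)) as s))} {θs as s} (series-θs as s))

  series-^ : ∀ i k → series (zᵗ (ix i) ^ᵗ k) ∼ x i ^ k
  series-^ i zero    = ∼-refl
  series-^ i (suc k) = ∼-trans (≈⇒∼ (series-* (zᵗ (ix i) ^ᵗ k) (zᵗ (ix i))))
    (∼-*-congʳ {x i} {series (zᵗ (ix i) ^ᵗ k)} {x i ^ k} (series-^ i k))

  series-xs : ∀ ks s → series (∏ᵗ (zipWith (λ k i → zᵗ (ix i) ^ᵗ k) ks s)) ∼ xs ks s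
  series-xs []       s       = ∼-refl
  series-xs (k ∷ ks) []      = ∼-refl
  series-xs (k ∷ ks) (i ∷ s) = ∼-trans (≈⇒∼ (series-* (zᵗ (ix i) ^ᵗ k) (∏ᵗ (zipWith (λ k i → zᵗ (ix i) ^ᵗ k) ks s))))
    (∼-*-cong {series (zᵗ (ix i) ^ᵗ k)} {x i ^ k} {series (∏ᵗ (zipWith (λ k i → zᵗ (ix i) ^ᵗ k) ks s))} {xs ks s}
      (series-^ i k) (series-xs ks s))

  series-term : ∀ Λ s → series (term X Λ s) ∼ θs (anti Λ) s *ˢ xs (parts Λ) s
  series-term Λ s = ∼-trans (≈⇒∼ (series-* Θ Z)) (∼-*-cong {series Θ} {θs (anti Λ) s} {series Z} {xs (parts Λ) s}
    (series-θs (anti Λ) s) (series-xs (parts Λ) s))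
    where
    Θ Z : Term
    Θ = ∏ᵗ (zipWith (λ _ i → ζᵗ (ix i)) (anti Λ) s)
    Z = ∏ᵗ (zipWith (λ k i → zᵗ (ix i) ^ᵗ k) (parts Λ) s)

  sign-at : ∀ k f ν → sign k f ν ≡ (-1^ k) ℤ.* f ν
  sign-at zero    f ν = sym (ℤ.*-identityˡ _)
  sign-at (suc k) f ν = trans (cong ℤ.-_ (sign-at k f ν)) (trans (sym (ℤ.-1*i≡-i _)) (sym (ℤ.*-assoc -1ℤ (-1^ k) _)))

  •-* : ∀ c f g ν → ((c • f) *ˢ g) ν ≡ c ℤ.* (f *ˢ g) ν
  •-* c f g ν = trans (convS-cong ν λ α β → lemma (ε α β) c (f α) (g β)) (∑-*ˡ c _ (splits ν))
    where
    lemma : ∀ e c a b → e ℤ.* ((c ℤ.* a) ℤ.* b) ≡ c ℤ.* (e ℤ.* (a ℤ.* b))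
    lemma = solve-∀

  weight-term : ∀ Λ s → ℓ Λ ≤ length s → weight Λ (term X Λ s) ≡ value (zip s (entries (anti Λ) (rest Λ)))
  weight-term Λ s l = begin
    weight Λ (term X Λ s)
      ≡⟨ •-* (-1^ k) (series (term X Λ s)) (hΛ Y Λ) μ ⟩
    (-1^ k) ℤ.* (series (term X Λ s) *ˢ hΛ Y Λ) μ
      ≡⟨ cong (ℤ._*_ (-1^ k)) (eval (∼-*-congʳ {hΛ Y Λ} (series-term Λ s))) ⟩
    (-1^ k) ℤ.* ((θs (anti Λ) s *ˢ xs (parts Λ) s) *ˢ hΛ Y Λ) μ
      ≡⟨ sign-at k ((θs (anti Λ) s *ˢ xs (parts Λ) s) *ˢ hΛ Y Λ) μ ⟨
    sign k ((θs (anti Λ) s *ˢ xs (parts Λ) s) *ˢ hΛ Y Λ) μ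
      ≡⟨ eval (∏-factor (anti Λ) (rest Λ) s l) ⟩
    ∏ (zipWith factor s (entries (anti Λ) (rest Λ))) μ
      ≡⟨ cong (λ fs → ∏ fs μ) (sym (List.map-zipWith _,_ (uncurry factor) s (entries (anti Λ) (rest Λ)))) ⟩
    value (zip s (entries (anti Λ) (rest Λ))) ∎
    where
    open ≡-Reasoning
    k : ℕ
    k = fermionicDegree Λ C 2

  -- How T arises: `s` is an order of the variables, and `c` lists the same assignment by increasing
  -- variable. The N zeros complete the ℓ Λ parts to the ℓ Λ + N variables being permuted.
  record Origin (Λ : Superpartition) (T : Term) : Set where
    field
      s         : List ℕ
      T≡        : T ≡ term X Λ s
      s-length  : length s ≡ ℓ Λ ℕ.+ N
      c         : List Entry
      c-length  : length c ≡ ℓ Λ ℕ.+ N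
      permuted  : zip s (entries (anti Λ) (rest Λ) ++ replicate N 0ᵉ) ↭ zip (upTo (ℓ Λ ℕ.+ N)) c

    ℓ≤ : ℓ Λ ≤ length s
    ℓ≤ = subst (ℓ Λ ≤_) (sym s-length) (ℕ.m≤m+n (ℓ Λ) N)

    T-weight : weight Λ T ≡ value (zip (upTo (ℓ Λ ℕ.+ N)) c)
    T-weight = trans (cong (weight Λ) T≡) (trans (weight-term Λ s ℓ≤)
      (trans (sym (value-pad s (entries (anti Λ) (rest Λ)) N)) (value-↭ permuted)))

    T-monomial : proj₂ T ≡ monomial (zip (upTo (ℓ Λ ℕ.+ N)) c)
    T-monomial = trans (cong proj₂ T≡) (trans (term-monomial Λ s ℓ≤)
      (trans (sym (monomial-pad s (entries (anti Λ) (rest Λ)) N)) (monomial-↭ permuted)))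

  origin : ∀ Λ {T} → T ∈ terms Λ → Origin Λ T
  origin Λ {T} T∈ with ∈-map⁻ (term X Λ) (∈-deduplicate⁻ _≟ᵗ_ (map (term X Λ) (permutations (upTo (ℓ Λ ℕ.+ N)))) T∈)
  ... | s , s∈ , T≡
    with zip-↭ (entries (anti Λ) (rest Λ) ++ replicate N 0ᵉ) same-length (permutations-↭ (upTo (ℓ Λ ℕ.+ N)) s∈)
    where
    same-length : length s ≡ length (entries (anti Λ) (rest Λ) ++ replicate N 0ᵉ)
    same-length = trans (trans (↭.↭-length (permutations-↭ (upTo (ℓ Λ ℕ.+ N)) s∈)) (List.length-upTo (ℓ Λ ℕ.+ N)))
      (sym (trans (List.length-++ (entries (anti Λ) (rest Λ)))
                  (cong₂ ℕ._+_ (length-entries (anti Λ) (rest Λ)) (List.length-replicate N))))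
  ... | c , c-length , permuted = record
    { s = s ; T≡ = T≡ ; c = c ; permuted = permuted
    ; s-length = trans (↭.↭-length (permutations-↭ (upTo (ℓ Λ ℕ.+ N)) s∈)) (List.length-upTo (ℓ Λ ℕ.+ N))
    ; c-length = trans c-length (List.length-upTo (ℓ Λ ℕ.+ N)) }

  pad-monomial : ∀ k c → length c ≡ N → monomial (zip (upTo (k ℕ.+ N)) (c ++ replicate k 0ᵉ)) ≡ monomial (assignments c)
  pad-monomial k c l = trans (monomial-pad (upTo (k ℕ.+ N)) c k) (cong monomial (zip-upTo-truncate k N c l))

  pad-value : ∀ k c → length c ≡ N → value (zip (upTo (k ℕ.+ N)) (c ++ replicate k 0ᵉ)) ≡ contribution c
  pad-value k c l = trans (value-pad (upTo (k ℕ.+ N)) c k) (cong value (zip-upTo-truncate k N c l))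

  module _ {Λ T} (o : Origin Λ T) where
    open Origin o renaming (c to c′)

    origin-padded : ∀ {c} → length c ≡ N → proj₂ T ≡ monomial (assignments c) → c′ ≡ c ++ replicate (ℓ Λ) 0ᵉ
    origin-padded {c} l e = monomial-injective (ℓ Λ ℕ.+ N) c′ (c ++ replicate (ℓ Λ) 0ᵉ) c-length
      (trans (List.length-++ c) (trans (cong₂ ℕ._+_ l (List.length-replicate (ℓ Λ))) (ℕ.+-comm N (ℓ Λ))))
      (trans (sym T-monomial) (trans e (sym (pad-monomial (ℓ Λ) c l))))

    origin-weight : ∀ {c} → length c ≡ N → proj₂ T ≡ monomial (assignments c) → weight Λ T ≡ contribution c
    origin-weight {c} l e = trans T-weight (trans (cong (λ d → value (zip (upTo (ℓ Λ ℕ.+ N)) d)) (origin-padded l e)) (pad-value (ℓ Λ) c l))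

    -- Either some factor vanishes in the quotient, or all entries are good; then those beyond the
    -- first N variables are zero and the others form a word.
    origin-exists : weight Λ T ≡ 0ℤ ⊎ ∃[ c ] (c ∈ monomials × proj₂ T ≡ monomial (assignments c))
    origin-exists = by-cases (All.all? good? (zip (upTo (ℓ Λ ℕ.+ N)) c′))
      where
      by-cases : Dec (All Good (zip (upTo (ℓ Λ ℕ.+ N)) c′)) →
                 weight Λ T ≡ 0ℤ ⊎ ∃[ c ] (c ∈ monomials × proj₂ T ≡ monomial (assignments c))
      by-cases (no ¬good) = inj₁ (trans T-weight (bad-value _ ¬good))
      by-cases (yes good) = let c , c∈ , e = good-split (ℓ Λ) c′ c-length good in
        inj₂ (c , c∈ , trans T-monomial
          (trans (cong (λ d → monomial (zip (upTo (ℓ Λ ℕ.+ N)) d)) e) (pad-monomial (ℓ Λ) c (words-length N c∈))))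

    module _ {c} (l : length c ≡ N) (e : proj₂ T ≡ monomial (assignments c)) where
      origin-↭ : zip s (entries (anti Λ) (rest Λ) ++ replicate N 0ᵉ) ↭ zip (upTo (ℓ Λ ℕ.+ N)) (c ++ replicate (ℓ Λ) 0ᵉ)
      origin-↭ = subst (λ d → zip s (entries (anti Λ) (rest Λ) ++ replicate N 0ᵉ) ↭ zip (upTo (ℓ Λ ℕ.+ N)) d) (origin-padded l e) permuted

      origin-odds : zip s (anti Λ) ↭ odds (assignments c)
      origin-odds = ↭-trans (↭-reflexive (trans (sym (odds-entries s (anti Λ) (rest Λ) ℓ≤)) (sym (odds-pad s (entries (anti Λ) (rest Λ)) N))))
        (↭-trans (↭.mapMaybe-↭ toOdd origin-↭)
        (↭-reflexive (trans (odds-pad (upTo (ℓ Λ ℕ.+ N)) c (ℓ Λ)) (cong odds (zip-upTo-truncate (ℓ Λ) N c l)))))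

      origin-rest : rest Λ ↭ map proj₂ (poss (assignments c))
      origin-rest = ↭-trans (↭-reflexive (trans (sym (poss-entries s (anti Λ) (rest Λ) ℓ≤ (rest-positive Λ)))
          (cong (map proj₂) (sym (poss-pad s (entries (anti Λ) (rest Λ)) N)))))
        (↭.map⁺ proj₂ (↭-trans (↭.mapMaybe-↭ toPos origin-↭)
        (↭-reflexive (trans (poss-pad (upTo (ℓ Λ ℕ.+ N)) c (ℓ Λ)) (cong poss (zip-upTo-truncate (ℓ Λ) N c l))))))

  module _ {Λ Λ′ T T′} (o : Origin Λ T) (o′ : Origin Λ′ T′) {c} (l : length c ≡ N)
           (e : proj₂ T ≡ monomial (assignments c)) (e′ : proj₂ T′ ≡ monomial (assignments c)) where
    private
      module o  = Origin o
      module o′ = Origin o′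

      odd-≡ : zip o.s (anti Λ) ≡ zip o′.s (anti Λ′)
      odd-≡ = odd-parts-unique Λ Λ′ o.s o′.s (ℕ.≤-trans (length-anti≤ℓ Λ) o.ℓ≤) (ℕ.≤-trans (length-anti≤ℓ Λ′) o′.ℓ≤)
        (↭-trans (origin-odds o l e) (↭-sym (origin-odds o′ l e′)))

    superpartition-unique : Λ ≡ Λ′
    superpartition-unique = superpartition-≡
      (trans (sym (map-proj₂-zip o.s (anti Λ) (ℕ.≤-trans (length-anti≤ℓ Λ) o.ℓ≤)))
        (trans (cong (map proj₂) odd-≡) (map-proj₂-zip o′.s (anti Λ′) (ℕ.≤-trans (length-anti≤ℓ Λ′) o′.ℓ≤))))
      (rest-unique Λ Λ′ (↭-trans (origin-rest o l e) (↭-sym (origin-rest o′ l e′))))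

    -- The common monomial fixes the terms up to sign. The θ's appear in the order of the decreasing
    -- odd exponents, which the monomial determines too, so T and its negative cannot both occur.
    term-unique : T ≡ T′
    term-unique = cong₂ _,_
      (trans (cong proj₁ o.T≡) (trans (term-coefficient Λ o.s) (trans (cong (λ ps → proj₁ (∏ᵗ (map (ζᵗ ∘ ix ∘ proj₁) ps))) odd-≡)
        (sym (trans (cong proj₁ o′.T≡) (term-coefficient Λ′ o′.s))))))
      (trans e (sym e′))

  module _ (c : List Entry) (l : length c ≡ N) where
    private
      as : List Assignment
      as = assignments c

    ¬strict⇒zero : ¬ Linked (λ a b → proj₂ a > proj₂ b) (oddPart as) → contribution c ≡ 0ℤ
    ¬strict⇒zero ¬strict = [ (λ strict → contradiction strict ¬strict) , vanish ]′
      (strict-or-zero (oddPart as) (sort-↗ (odds as)))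
      where
      vanish : (∀ R → ∏ (map (uncurry factor) (map asOdd (oddPart as) ++ R)) ∼ 0ˢ) → contribution c ≡ 0ℤ
      vanish e = trans (value-↭ (classify-sorted as))
        (trans (cong value (List.++-assoc (map asOdd (oddPart as)) (map asPos (evenPart as)) (map asNil (nils as))))
               (eval (e (map asPos (evenPart as) ++ map asNil (nils as)))))

    shape-term : ∀ strict → ∃[ T ] (T ∈ terms (shape as strict) × proj₂ T ≡ monomial as)
    shape-term strict = term X Λ s , ∈-deduplicate⁺ _≟ᵗ_ (∈-map⁺ (term X Λ) (permutations-∈ (upTo (ℓ Λ ℕ.+ N)) s↭)) ,
      trans (term-monomial Λ s ℓ≤s) (trans (cong monomial (trans (cong (λ is → zip is (entries (anti Λ) (rest Λ))) (List.++-assoc front (nils as) back))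
        (zip-entries (oddPart as) (evenPart as) (nils as ++ back)))) (sym (monomial-sorted as)))
      where
      Λ : Superpartition
      Λ = shape as strict
      front back s : List ℕ
      front = map proj₁ (oddPart as) ++ map proj₁ (evenPart as)
      back  = applyUpTo (N ℕ.+_) (ℓ Λ)
      -- The variables of the sorted odd and positive entries come first, so that they meet the
      -- parts of Λ; those with zero entry follow, and `ℓ Λ` new ones complete the permutation.
      s     = (front ++ nils as) ++ back
      names : map proj₁ ((map asOdd (oddPart as) ++ map asPos (evenPart as)) ++ map asNil (nils as)) ≡ front ++ nils as
      names = trans (List.map-++ proj₁ (map asOdd (oddPart as) ++ map asPos (evenPart as)) _) (cong₂ _++_
        (trans (List.map-++ proj₁ (map asOdd (oddPart as)) _) (cong₂ _++_ (sym (List.map-∘ (oddPart as))) (sym (List.map-∘ (evenPart as)))))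
        (trans (sym (List.map-∘ (nils as))) (List.map-id (nils as))))
      first : front ++ nils as ↭ upTo N
      first = ↭-trans (↭-reflexive (sym names)) (↭-trans (↭.map⁺ proj₁ (↭-sym (classify-sorted as)))
        (↭-reflexive (map-proj₁-zip (upTo N) c (trans (List.length-upTo N) (sym l)))))
      s↭ : s ↭ upTo (ℓ Λ ℕ.+ N)
      s↭ = ↭-trans (↭.++⁺ʳ back first) (↭-reflexive (sym (upTo-+ (ℓ Λ) N)))
      ℓ≤s : ℓ Λ ≤ length s
      ℓ≤s = subst (ℓ Λ ≤_) (sym (trans (↭.↭-length s↭) (List.length-upTo (ℓ Λ ℕ.+ N)))) (ℕ.m≤m+n (ℓ Λ) N)

  -- Double counting

  -- The weighted incidence matrix of terms and words: summing over words gives the weight of a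
  -- term, summing over all terms the contribution of a word.
  match : Term → List Entry → ℤ
  match T c = if does (proj₂ T ≟ᵐ monomial (assignments c)) then contribution c else 0ℤ

  match-≡ : ∀ T c → proj₂ T ≡ monomial (assignments c) → match T c ≡ contribution c
  match-≡ T c e = cong (λ b → if b then contribution c else 0ℤ) (dec-true (proj₂ T ≟ᵐ monomial (assignments c)) e)

  match-≢ : ∀ T c → proj₂ T ≢ monomial (assignments c) → match T c ≡ 0ℤ
  match-≢ T c ne = cong (λ b → if b then contribution c else 0ℤ) (dec-false (proj₂ T ≟ᵐ monomial (assignments c)) ne)

  match-zero : ∀ T c → (proj₂ T ≡ monomial (assignments c) → contribution c ≡ 0ℤ) → match T c ≡ 0ℤ
  match-zero T c = if-zero (proj₂ T ≟ᵐ monomial (assignments c)) (contribution c)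
    where
    if-zero : ∀ {P : Set} (P? : Dec P) w → (P → w ≡ 0ℤ) → (if does P? then w else 0ℤ) ≡ 0ℤ
    if-zero (yes p) w w≡0 = w≡0 p
    if-zero (no _)  w w≡0 = refl

  sum-over-monomials : ∀ Λ {T} → T ∈ terms Λ → weight Λ T ≡ ∑ monomials (match T)
  sum-over-monomials Λ {T} T∈ = [ without , with-monomial ]′ (origin-exists (origin Λ T∈))
    where
    without : weight Λ T ≡ 0ℤ → weight Λ T ≡ ∑ monomials (match T)
    -- A word may still match T here; by `origin-weight` its contribution is then the weight of T,
    -- that is, 0.
    without w≡0 = trans w≡0 (sym (∑-zero (All.tabulate λ {c} c∈ → match-zero T c λ e →
      trans (sym (origin-weight (origin Λ T∈) (words-length N c∈) e)) w≡0)))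
    with-monomial : ∃[ c ] (c ∈ monomials × proj₂ T ≡ monomial (assignments c)) → weight Λ T ≡ ∑ monomials (match T)
    with-monomial (c , c∈ , e) = trans (origin-weight (origin Λ T∈) (words-length N c∈) e) (sym (trans
      (∑-single monomials-unique c∈ λ {d} d∈ d≢c → match-≢ T d λ e′ →
        d≢c (monomial-injective N d c (words-length N d∈) (words-length N c∈) (trans (sym e′) e)))
      (match-≡ T c e)))

  -- If the odd exponents of c repeat, the contribution is 0 already. Otherwise only the shape of c
  -- has a matching term, by `superpartition-unique`, and it has just one, by `term-unique`.
  sum-over-terms : ∀ L → Unique L → (∀ {c} → c ∈ monomials → ∀ {Λ} → Λ ∈ shapes (assignments c) → Λ ∈ L) →
                   ∀ {c} → c ∈ monomials → ∑ L (λ Λ → ∑ (terms Λ) (λ T → match T c)) ≡ contribution c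
  sum-over-terms L u sub {c} c∈ = by-cases (strict? (assignments c))
    where
    l : length c ≡ N
    l = words-length N c∈

    by-cases : Dec (Linked (λ a b → proj₂ a > proj₂ b) (oddPart (assignments c))) →
               ∑ L (λ Λ → ∑ (terms Λ) (λ T → match T c)) ≡ contribution c
    by-cases (no ¬strict) = trans
      (∑-zero (All.universal (λ Λ → ∑-zero (All.universal (λ T → match-zero T c λ _ → W≡0) (terms Λ))) L)) (sym W≡0)
      where
      W≡0 : contribution c ≡ 0ℤ
      W≡0 = ¬strict⇒zero c l ¬strict
    by-cases (yes strict) = only (shape-term c l strict)
      where
      Λ₀ : Superpartition
      Λ₀ = shape (assignments c) strict
      only : ∃[ T ] (T ∈ terms Λ₀ × proj₂ T ≡ monomial (assignments c)) → ∑ L (λ Λ → ∑ (terms Λ) (λ T → match T c)) ≡ contribution c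
      only (T₀ , T₀∈ , e₀) = trans
        (∑-single u (sub c∈ (shape∈shapes (assignments c) strict)) λ {Λ} _ Λ≢ → ∑-zero (All.tabulate λ {T} T∈ → match-≢ T c λ e →
          Λ≢ (superpartition-unique (origin Λ T∈) (origin Λ₀ T₀∈) l e e₀)))
        (trans (∑-single (DecUnique.deduplicate-! _≟ᵗ_ (map (term X Λ₀) (permutations (upTo (ℓ Λ₀ ℕ.+ N))))) T₀∈
          λ {T} T∈ T≢ → match-≢ T c λ e → T≢ (term-unique (origin Λ₀ T∈) (origin Λ₀ T₀∈) l e e₀))
        (match-≡ T₀ c e₀))

  -- Finite because the truncation leaves finitely many words, each with at most one shape; every
  -- other superpartition contributes 0 at μ.
  support : List Superpartition
  support = deduplicate _≟ˢᵖ_ (concatMap (shapes ∘ assignments) monomials)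

  support-unique : Unique support
  support-unique = DecUnique.deduplicate-! _≟ˢᵖ_ (concatMap (shapes ∘ assignments) monomials)

  shapes⊆support : ∀ {c} → c ∈ monomials → ∀ {Λ} → Λ ∈ shapes (assignments c) → Λ ∈ support
  shapes⊆support c∈ Λ∈ = ∈-deduplicate⁺ _≟ˢᵖ_ (∈-concatMap⁺ (shapes ∘ assignments) (lose c∈ Λ∈))

  total : ∀ L → Unique L → (∀ {Λ} → Λ ∈ support → Λ ∈ L) →
          ∑ L (λ Λ → (reversal (fermionicDegree Λ) (m X Λ) *ˢ hΛ Y Λ) μ) ≡ K μ
  total L u sub = begin
    ∑ L (λ Λ → (reversal (fermionicDegree Λ) (m X Λ) *ˢ hΛ Y Λ) μ)
      ≡⟨ ∑-cong′ L (λ Λ → trans (weight-sum Λ) (∑-cong (All.tabulate (sum-over-monomials Λ)))) ⟩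
    ∑ L (λ Λ → ∑ (terms Λ) (λ T → ∑ monomials (match T)))
      ≡⟨ ∑-cong′ L (λ Λ → ∑-swap match (terms Λ) monomials) ⟩
    ∑ L (λ Λ → ∑ monomials (λ c → ∑ (terms Λ) (λ T → match T c)))
      ≡⟨ ∑-swap _ L monomials ⟩
    ∑ monomials (λ c → ∑ L (λ Λ → ∑ (terms Λ) (λ T → match T c)))
      ≡⟨ ∑-cong (All.tabulate (sum-over-terms L u (λ c∈ Λ∈ → sub (shapes⊆support c∈ Λ∈)))) ⟩
    ∑ monomials contribution
      ≡⟨ K-expand ⟨
    K μ ∎
    where open ≡-Reasoning

proposition34 : HasSum (λ Λ → reversal (fermionicDegree Λ) (m X Λ) *ˢ hΛ Y Λ) K
proposition34 μ = support , support-unique , λ L u sub → total L u sub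
  where open Coefficient μ refl refl
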